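{- Let $d\ge1$ be an integer and let $\sigma$ be a finite relational signature. There is a function $f\in d\text{ - }\mathrm{EXP}$ such that for each $\mathrm{MSO}[\sigma]$-sentence $\varphi$ there is an $\mathrm{FO}[\sigma]$-sentence $\psi$ with $\|\psi\|\le f(\operatorname{qr}(\varphi))$ and $\operatorname{qad}(\psi)\le 2d$ that is equivalent to $\varphi$ on $\mathrm{Fin}_{\sigma,d}$, i.e. $\mathfrak A\models\varphi$ iff $\mathfrak A\models\psi$ for every $\mathfrak A\in\mathrm{Fin}_{\sigma,d}$.
   Context: $\mathrm{FO}$ and $\mathrm{MSO}$ are first-order and monadic second-order logic. Tree-depth: for a finite simple graph $G$, $\operatorname{td}(G)=1$ if $|V(G)|=1$; $\operatorname{td}(G)=1+\min_{r\in V(G)}\operatorname{td}(G\setminus r)$ if $G$ is connected and $|V(G)|>1$; $\operatorname{td}(G)=\max_i \operatorname{td}(K_i)$ if $G$ is disconnected with components $K_1,\dots,K_n$. The Gaifman graph of a $\sigma$-structure $\mathfrak A$ has the universe $A$ as vertex set, with an edge between distinct $x,y$ iff they occur together in a tuple of some relation of $\mathfrak A$. The tree-depth of $\mathfrak A$ is that of its Gaifman graph. $\mathrm{Fin}_{\sigma,d}$ is the class of finite $\sigma$-structures of tree-depth at most $d$. $\operatorname{qr}(\varphi)$ is the quantifier rank (element and set quantifiers both counted) and $\|\varphi\|$ the size (length) of $\varphi$. The quantifier alternation depth $\operatorname{qad}(\varphi)$ of a formula in negation normal form (negations only in front of atoms) is the maximum number of alternations between $\exists$- and $\forall$-quantifiers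 on directed paths of the syntax tree; for other formulae it is that of an equivalent formula in negation normal form obtained by a fixed conversion procedure. The $d$-fold exponential is $0\text{ - }\exp(n)=n$, $(d+1)\text{ - }\exp(n)=2^{d\text{ - }\exp(n)}$. $d\text{ - }\mathrm{EXP}$ is the class of functions $f:\mathbb N\to\mathbb N$ for which there is $c\in\mathbb N$ with $f(n)\le d\text{ - }\exp(n^c)$ for all $n>c$. -}

module Defs where

open import Data.Bool.Base using (Bool; T)
open import Data.Bool.Properties using (T?)
open import Data.Empty using (⊥-elim)
open import Data.Fin.Base using (Fin; zero; suc)
open import Data.Fin.Properties using (any?; all?) renaming (_≟_ to _≟ᶠ_)
open import Data.Fin.Subset using (Subset; inside; outside; _∈_; _∉_; _⊆_; _⊂_; ⊤; ⁅_⁆; _-_; ∣_∣; Nonempty)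
open import Data.Fin.Subset.Properties
open import Data.Maybe.Base using (Maybe; just; nothing)
open import Data.Nat.Base using (ℕ; zero; suc; _+_; _^_; _⊔_; _≤_; _≥_; _<_; s<s)
open import Data.Nat.Induction using (Acc; acc; <-wellFounded)
open import Data.Nat.Properties using (≤-refl; ≤-trans; ≤-total; ≤-antisym; ≤-reflexive; ≤∧≢⇒<; <-≤-trans; <⇒≱; _≟_)
open import Data.Product.Base using (∃; ∃-syntax; _×_; _,_; proj₁; proj₂)
open import Data.Sum.Base using (_⊎_; inj₁; inj₂; swap)
open import Data.Vec.Base using (Vec; []; _∷_; here; there; lookup; map; tabulate)
open import Data.Vec.Membership.Propositional using () renaming (_∈_ to _∈ᵛ_)
open import Data.Vec.Properties using (lookup∘tabulate; []=⇒lookup; lookup⇒[]=)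
import Data.Vec.Membership.DecPropositional as DecMembership
open import Function.Base using (_∘_)
open import Function.Bundles using (_⇔_; mk⇔; Equivalence)
open import Level using (0ℓ)
open import Relation.Binary.Construct.Closure.ReflexiveTransitive using (Star; ε; _◅_; _◅◅_; reverse) renaming (map to Star-map)
open import Relation.Binary.Core using (Rel)
open import Relation.Binary.Definitions using (Decidable; Symmetric; Irreflexive; Reflexive; Transitive; Total)
open import Relation.Binary.PropositionalEquality using (_≡_; _≢_; refl; sym; trans; cong; subst)
open import Relation.Nullary using (¬_; Dec; yes; no; does; contradiction)
open import Relation.Nullary.Decidable using (map′; _×-dec_; _→-dec_; ¬?; dec-true)

record Graph (n : ℕ) : Set₁ where
  field
    Adj    : Rel (Fin n) 0ℓ
    adj?   : Decidable Adj
    symm   : Symmetric Adj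
    irrefl : Irreflexive _≡_ Adj

module _ {n : ℕ} (G : Graph n) where
  open Graph G

  -- The vertex sets S below stand for the induced subgraphs G[S].

  Edge : Subset n → Rel (Fin n) 0ℓ
  Edge S x y = x ∈ S × y ∈ S × Adj x y

  Walk : Subset n → Rel (Fin n) 0ℓ
  Walk S = Star (Edge S)

  Connected : Subset n → Set
  Connected S = ∀ x y → x ∈ S → y ∈ S → Walk S x y

  IsComponent : Subset n → Subset n → Set
  IsComponent S K = ∃[ x ] x ∈ S × (∀ y → y ∈ K ⇔ Walk S x y)

  -- TreeDepth S k is the graph of the function S ↦ td(G[S]); the last two
  -- arguments of `connected` (of `disconnected`) say that k is the minimum
  -- (the maximum) of the values concerned.
  data TreeDepth : Subset n → ℕ → Set where
    singleton    : ∀ {S} → ∣ S ∣ ≡ 1 → TreeDepth S 1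
    connected    : ∀ {S k} → 1 < ∣ S ∣ → Connected S →
                   (∃[ r ] r ∈ S × TreeDepth (S - r) k) →
                   (∀ r → r ∈ S → ∃[ j ] k ≤ j × TreeDepth (S - r) j) →
                   TreeDepth S (suc k)
    disconnected : ∀ {S k} → ¬ Connected S →
                   (∃[ K ] IsComponent S K × TreeDepth K k) →
                   (∀ K → IsComponent S K → ∃[ j ] k ≥ j × TreeDepth K j) →
                   TreeDepth S k

private
  variable
    n : ℕ

  x∉p-x : (p : Subset n) (x : Fin n) → x ∉ p - x
  x∉p-x (inside  ∷ p) zero ()
  x∉p-x (outside ∷ p) zero ()
  x∉p-x (s ∷ p) (suc x) (there x∈) = x∉p-x p x x∈

  Nonempty⇒0<∣p∣ : {p : Subset n} → Nonempty p → 0 < ∣ p ∣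
  Nonempty⇒0<∣p∣ {p = p} (x , x∈p) =
    subst (_≤ ∣ p ∣) (∣⁅x⁆∣≡1 x)
      (p⊆q⇒∣p∣≤∣q∣ λ y∈ → subst (_∈ p) (sym (x∈⁅y⁆⇒x≡y x y∈)) x∈p)

  1<∣p∣⇒Nonempty[p-x] : {p : Subset n} → 1 < ∣ p ∣ → ∀ x → Nonempty (p - x)
  1<∣p∣⇒Nonempty[p-x] {p = p} 1<∣p∣ x with nonempty? (p - x)
  ... | yes ne = ne
  ... | no ¬ne = contradiction
    (subst (∣ p ∣ ≤_) (∣⁅x⁆∣≡1 x) (p⊆q⇒∣p∣≤∣q∣ p⊆⁅x⁆)) (<⇒≱ 1<∣p∣)
    where
    p⊆⁅x⁆ : p ⊆ ⁅ x ⁆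
    p⊆⁅x⁆ {y} y∈p with y ≟ᶠ x
    ... | yes refl = x∈⁅x⁆ x
    ... | no  y≢x  = ⊥-elim (¬ne (y , x∈p∧x≢y⇒x∈p-y y∈p y≢x))

  module Extremum (_≲_ : Rel ℕ 0ℓ) (rfl : Reflexive _≲_) (trns : Transitive _≲_)
                  (total : Total _≲_) where

    extremum : (S : Subset n) (P : Fin n → ℕ → Set) → Nonempty S →
               (∀ x → x ∈ S → ∃ (P x)) →
               ∃[ k ] (∃[ x ] x ∈ S × P x k) × (∀ x → x ∈ S → ∃[ j ] k ≲ j × P x j)
    extremum (outside ∷ S) P (suc x , there x∈S) f
      with extremum S (P ∘ suc) (x , x∈S) (λ y → f (suc y) ∘ there)
    ... | k , (y , y∈S , p) , g =
      k , (suc y , there y∈S , p) , λ { (suc z) (there z∈S) → g z z∈S }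
    extremum (inside ∷ S) P _ f with nonempty? S | f zero here
    ... | no ¬ne | i , p =
      i , (zero , here , p) ,
      λ { zero    here        → i , rfl , p
        ; (suc z) (there z∈S) → ⊥-elim (¬ne (z , z∈S)) }
    ... | yes ne | i , p with extremum S (P ∘ suc) ne (λ y → f (suc y) ∘ there)
    ...   | k , (y , y∈S , q) , g with total i k
    ...     | inj₁ i≲k = i , (zero , here , p) ,
      λ { zero    here        → i , rfl , p
        ; (suc z) (there z∈S) → let j , k≲j , r = g z z∈S in j , trns i≲k k≲j , r }
    ...     | inj₂ k≲i = k , (suc y , there y∈S , q) ,
      λ { zero    here        → i , k≲i , p
        ; (suc z) (there z∈S) → g z z∈S }

  module Min = Extremum _≤_ ≤-refl ≤-trans ≤-total
  module Max = Extremum _≥_ ≤-refl (λ p q → ≤-trans q p) (λ i j → swap (≤-total i j))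

module _ (G : Graph n) where
  open Graph G

  private
    Edge-mono : ∀ {S S′} → S ⊆ S′ → ∀ {x y} → Edge G S x y → Edge G S′ x y
    Edge-mono S⊆S′ (x∈ , y∈ , a) = S⊆S′ x∈ , S⊆S′ y∈ , a

    Walk-sym : ∀ {S x y} → Walk G S x y → Walk G S y x
    Walk-sym = reverse λ { (x∈ , y∈ , a) → y∈ , x∈ , symm a }

    Walk-∈ : ∀ {S x y} → x ∈ S → Walk G S x y → y ∈ S
    Walk-∈ x∈S ε                   = x∈S
    Walk-∈ _   ((_ , z∈S , _) ◅ w) = Walk-∈ z∈S w

    Exits : Subset n → Rel (Fin n) 0ℓ
    Exits S x y = x ≡ y ⊎ ∃[ z ] z ∈ S × Adj x z × Walk G (S - x) z y

    cut : ∀ {S y} x {u} → Walk G S u y → Walk G (S - x) u y ⊎ Exits S x y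
    cut x ε = inj₁ ε
    cut x {u} (_◅_ {j = w} (u∈S , w∈S , a) ws) with cut x ws
    ... | inj₂ e = inj₂ e
    ... | inj₁ ws′ with u ≟ᶠ x | w ≟ᶠ x
    ...   | yes refl | _ = inj₂ (inj₂ (w , w∈S , a , ws′))
    ...   | no u≢x | no w≢x =
      inj₁ ((x∈p∧x≢y⇒x∈p-y u∈S u≢x , x∈p∧x≢y⇒x∈p-y w∈S w≢x , a) ◅ ws′)
    cut {S} x _ | inj₁ ε | no _ | yes refl = inj₂ (inj₁ refl)
    cut {S} x _ | inj₁ ((x∈S-x , _) ◅ _) | no _ | yes refl = contradiction x∈S-x (x∉p-x S x)

    exits : ∀ {S x y} → Walk G S x y → Exits S x y
    exits ε = inj₁ refl
    exits {x = x} ((_ , z∈S , a) ◅ w) with cut x w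
    ... | inj₁ w′ = inj₂ (_ , z∈S , a , w′)
    ... | inj₂ e  = e

    walk?′ : ∀ S → Acc _<_ ∣ S ∣ → Decidable (Walk G S)
    walk?′ S (acc rs) x y with x ≟ᶠ y | x ∈? S
    ... | yes refl | _      = yes ε
    ... | no x≢y   | no x∉S = no λ { ε → x≢y refl ; ((x∈S , _) ◅ _) → x∉S x∈S }
    ... | no x≢y   | yes x∈S = map′ to from
      (any? λ z → z ∈? S ×-dec adj? x z ×-dec walk?′ (S - x) (rs (x∈p⇒∣p-x∣<∣p∣ x∈S)) z y)
      where
      to : (∃[ z ] z ∈ S × Adj x z × Walk G (S - x) z y) → Walk G S x y
      to (z , z∈S , a , w) =
        (x∈S , z∈S , a) ◅ Star-map (Edge-mono (p─q⊆p S ⁅ x ⁆)) w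
      from : Walk G S x y → ∃[ z ] z ∈ S × Adj x z × Walk G (S - x) z y
      from w with exits w
      ... | inj₁ x≡y = contradiction x≡y x≢y
      ... | inj₂ e   = e

  walk? : ∀ S → Decidable (Walk G S)
  walk? S = walk?′ S (<-wellFounded _)

  connected? : ∀ S → Dec (Connected G S)
  connected? S = all? λ x → all? λ y → x ∈? S →-dec (y ∈? S →-dec walk? S x y)

  component : Subset n → Fin n → Subset n
  component S x = tabulate λ y → does (walk? S x y)

  ∈-component : ∀ S x y → y ∈ component S x ⇔ Walk G S x y
  ∈-component S x y = mk⇔ to from
    where
    eq : lookup (component S x) y ≡ does (walk? S x y)
    eq = lookup∘tabulate (λ z → does (walk? S x z)) y
    to : y ∈ component S x → Walk G S x y
    to y∈ with walk? S x y | trans (sym eq) ([]=⇒lookup y∈)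
    ... | yes w | _  = w
    ... | no _  | ()
    from : Walk G S x y → y ∈ component S x
    from w = lookup⇒[]= y _ (trans eq (dec-true (walk? S x y) w))

  private
    component-unique : ∀ {S K} ((x , _) : IsComponent G S K) → K ≡ component S x
    component-unique {S} (x , _ , h) = ⊆-antisym
      (λ {y} y∈ → Equivalence.from (∈-component S x y) (Equivalence.to (h y) y∈))
      (λ {y} y∈ → Equivalence.from (h y) (Equivalence.to (∈-component S x y) y∈))

    component-⊂ : ∀ {S x} → ¬ Connected G S → x ∈ S → component S x ⊂ S
    component-⊂ {S} {x} ¬conn x∈S = ⊆S , proper
      where
      ⊆S : component S x ⊆ S
      ⊆S {y} y∈ = Walk-∈ x∈S (Equivalence.to (∈-component S x y) y∈)
      proper : ∃[ y ] y ∈ S × y ∉ component S x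
      proper with any? (λ y → y ∈? S ×-dec ¬? (y ∈? component S x))
      ... | yes p = p
      ... | no ¬p = ⊥-elim (¬conn λ y z y∈ z∈ → Walk-sym (walk y y∈) ◅◅ walk z z∈)
        where
        walk : ∀ y → y ∈ S → Walk G S x y
        walk y y∈S with y ∈? component S x
        ... | yes y∈ = Equivalence.to (∈-component S x y) y∈
        ... | no  y∉ = ⊥-elim (¬p (y , y∈S , y∉))

    treeDepth′ : ∀ S → Acc _<_ ∣ S ∣ → Nonempty S → ∃ (TreeDepth G S)
    treeDepth′ S (acc rs) ne with ∣ S ∣ ≟ 1 | connected? S
    ... | yes ∣S∣≡1 | _ = 1 , singleton ∣S∣≡1
    ... | no  ∣S∣≢1 | yes conn =
      let 1<∣S∣ = ≤∧≢⇒< (Nonempty⇒0<∣p∣ ne) (∣S∣≢1 ∘ sym)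
          k , r , bound = Min.extremum S (λ r → TreeDepth G (S - r)) ne λ r r∈S →
            treeDepth′ (S - r) (rs (x∈p⇒∣p-x∣<∣p∣ r∈S)) (1<∣p∣⇒Nonempty[p-x] 1<∣S∣ r)
      in suc k , connected 1<∣S∣ conn r bound
    ... | no _ | no ¬conn =
      let k , (x , x∈S , t) , bound = Max.extremum S (λ x → TreeDepth G (component S x)) ne λ x x∈S →
            treeDepth′ (component S x) (rs (p⊂q⇒∣p∣<∣q∣ (component-⊂ ¬conn x∈S)))
              (x , Equivalence.from (∈-component S x x) ε)
      in k , disconnected ¬conn (component S x , (x , x∈S , ∈-component S x) , t)
           λ K c@(y , y∈S , _) → let j , k≥j , u = bound y y∈S in
             j , k≥j , subst (λ L → TreeDepth G L j) (sym (component-unique c)) u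

  treeDepth-exists : ∀ S → Nonempty S → ∃ (TreeDepth G S)
  treeDepth-exists S = treeDepth′ S (<-wellFounded _)

  private
    ∣S∣≡1⇒Connected : ∀ {S} → ∣ S ∣ ≡ 1 → Connected G S
    ∣S∣≡1⇒Connected {S} ∣S∣≡1 x y x∈S y∈S with y ≟ᶠ x
    ... | yes refl = ε
    ... | no  y≢x  = contradiction (≤-reflexive ∣S∣≡1)
      (<⇒≱ (<-≤-trans (s<s (Nonempty⇒0<∣p∣ (y , x∈p∧x≢y⇒x∈p-y y∈S y≢x))) (x∈p⇒∣p-x∣<∣p∣ x∈S)))

  treeDepth-unique : ∀ {S j k} → TreeDepth G S j → TreeDepth G S k → j ≡ k
  treeDepth-unique (singleton _) (singleton _) = refl
  treeDepth-unique (singleton e) (connected 1<∣S∣ _ _ _) =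
    contradiction (≤-reflexive e) (<⇒≱ 1<∣S∣)
  treeDepth-unique (singleton e) (disconnected ¬c _ _) =
    contradiction (∣S∣≡1⇒Connected e) ¬c
  treeDepth-unique (connected 1<∣S∣ _ _ _) (singleton e) =
    contradiction (≤-reflexive e) (<⇒≱ 1<∣S∣)
  treeDepth-unique (connected _ _ (r , r∈S , t) f) (connected _ _ (s , s∈S , u) g)
    with g r r∈S | f s s∈S
  ... | i , k≤i , t′ | l , j≤l , u′
    with refl ← treeDepth-unique t t′ | refl ← treeDepth-unique u′ u =
    cong suc (≤-antisym j≤l k≤i)
  treeDepth-unique (connected _ c _ _) (disconnected ¬c _ _) = contradiction c ¬c
  treeDepth-unique (disconnected ¬c _ _) (singleton e) =
    contradiction (∣S∣≡1⇒Connected e) ¬c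
  treeDepth-unique (disconnected ¬c _ _) (connected _ c _ _) = contradiction c ¬c
  treeDepth-unique (disconnected _ (K , cK , t) f) (disconnected _ (L , cL , u) g)
    with g K cK | f L cL
  ... | i , i≤k , t′ | l , l≤j , u′
    with refl ← treeDepth-unique t t′ | refl ← treeDepth-unique u′ u =
    ≤-antisym i≤k l≤j

-- Only graphs with at least one vertex have a tree-depth.
td : Graph (suc n) → ℕ
td G = proj₁ (treeDepth-exists G ⊤ (zero , ∈⊤))

td-correct : (G : Graph (suc n)) → TreeDepth G ⊤ (td G)
td-correct G = proj₂ (treeDepth-exists G ⊤ (zero , ∈⊤))

record Signature : Set where
  field
    symbols : ℕ
    arity   : Fin symbols → ℕ

open Signature

-- Structures are non-empty and, up to isomorphism, live on Fin (suc order).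
-- Relations are Boolean-valued because classical relations on a finite set
-- are decidable.
record Structure (σ : Signature) : Set where
  field
    order : ℕ

  Universe : Set
  Universe = Fin (suc order)

  field
    interp : (R : Fin (symbols σ)) → Vec Universe (arity σ R) → Bool

  Holds : (R : Fin (symbols σ)) → Vec Universe (arity σ R) → Set
  Holds R v = T (interp R v)

private
  anyVec? : ∀ k {P : Vec (Fin n) k → Set} → (∀ v → Dec (P v)) → Dec (∃ P)
  anyVec? zero    P? = map′ (λ p → [] , p) (λ { ([] , p) → p }) (P? [])
  anyVec? (suc k) P? = map′ (λ { (x , v , p) → x ∷ v , p }) (λ { (x ∷ v , p) → x , v , p })
                            (any? λ x → anyVec? k λ v → P? (x ∷ v))

gaifman : ∀ {σ} (𝔄 : Structure σ) → Graph (suc (Structure.order 𝔄))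
gaifman {σ} 𝔄 = record
  { Adj    = λ x y → x ≢ y × (∃[ R ] ∃[ v ] Holds R v × x ∈ᵛ v × y ∈ᵛ v)
  ; adj?   = λ x y → ¬? (x ≟ᶠ y) ×-dec any? λ R → anyVec? (arity σ R) λ v →
               T? (interp R v) ×-dec x ∈ᵛ? v ×-dec y ∈ᵛ? v
  ; symm   = λ { (x≢y , R , v , h , x∈v , y∈v) → x≢y ∘ sym , R , v , h , y∈v , x∈v }
  ; irrefl = λ { x≡y (x≢y , _) → x≢y x≡y }
  }
  where
  open Structure 𝔄
  open DecMembership (_≟ᶠ_ {suc order}) renaming (_∈?_ to _∈ᵛ?_)

Fin[_,_] : (σ : Signature) → ℕ → Structure σ → Set
Fin[ σ , d ] 𝔄 = td (gaifman 𝔄) ≤ d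

data Logic : Set where
  FO MSO : Logic

infix  8 _≐_ _∈ˢ_
infixr 7 ¬ᶠ_ ∃ᶠ_ ∀ᶠ_ ∃ˢ_ ∀ˢ_
infixr 6 _∧ᶠ_
infixr 5 _∨ᶠ_

-- De Bruijn indices: k free element variables and m free set variables.
-- FO formulae cannot bind set variables, so FO sentences mention none.
data Formula (σ : Signature) : Logic → ℕ → ℕ → Set where
  rel   : ∀ {L k m} (R : Fin (symbols σ)) → Vec (Fin k) (arity σ R) → Formula σ L k m
  _≐_   : ∀ {L k m} → Fin k → Fin k → Formula σ L k m
  _∈ˢ_  : ∀ {L k m} → Fin k → Fin m → Formula σ L k m
  ¬ᶠ_   : ∀ {L k m} → Formula σ L k m → Formula σ L k m
  _∧ᶠ_  : ∀ {L k m} → Formula σ L k m → Formula σ L k m → Formula σ L k m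
  _∨ᶠ_  : ∀ {L k m} → Formula σ L k m → Formula σ L k m → Formula σ L k m
  ∃ᶠ_   : ∀ {L k m} → Formula σ L (suc k) m → Formula σ L k m
  ∀ᶠ_   : ∀ {L k m} → Formula σ L (suc k) m → Formula σ L k m
  ∃ˢ_   : ∀ {k m} → Formula σ MSO k (suc m) → Formula σ MSO k m
  ∀ˢ_   : ∀ {k m} → Formula σ MSO k (suc m) → Formula σ MSO k m

Sentence : Logic → Signature → Set
Sentence L σ = Formula σ L 0 0

module _ {σ : Signature} (𝔄 : Structure σ) where
  open Structure 𝔄

  Sat : ∀ {L k m} → Formula σ L k m → Vec Universe k → Vec (Subset (suc order)) m → Set
  Sat (rel R xs) ρ Ξ = Holds R (map (lookup ρ) xs)
  Sat (x ≐ y)    ρ Ξ = lookup ρ x ≡ lookup ρ y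
  Sat (x ∈ˢ X)   ρ Ξ = lookup ρ x ∈ lookup Ξ X
  Sat (¬ᶠ φ)     ρ Ξ = ¬ Sat φ ρ Ξ
  Sat (φ ∧ᶠ ψ)   ρ Ξ = Sat φ ρ Ξ × Sat ψ ρ Ξ
  Sat (φ ∨ᶠ ψ)   ρ Ξ = Sat φ ρ Ξ ⊎ Sat ψ ρ Ξ
  Sat (∃ᶠ φ)     ρ Ξ = ∃[ a ] Sat φ (a ∷ ρ) Ξ
  Sat (∀ᶠ φ)     ρ Ξ = ∀ a → Sat φ (a ∷ ρ) Ξ
  Sat (∃ˢ φ)     ρ Ξ = ∃[ S ] Sat φ ρ (S ∷ Ξ)
  Sat (∀ˢ φ)     ρ Ξ = ∀ S → Sat φ ρ (S ∷ Ξ)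

infix 4 _⊨_

_⊨_ : ∀ {σ L} → Structure σ → Sentence L σ → Set
𝔄 ⊨ φ = Sat 𝔄 φ [] []

module _ {σ : Signature} where

  qr : ∀ {L k m} → Formula σ L k m → ℕ
  qr (rel R xs) = 0
  qr (x ≐ y)    = 0
  qr (x ∈ˢ X)   = 0
  qr (¬ᶠ φ)     = qr φ
  qr (φ ∧ᶠ ψ)   = qr φ ⊔ qr ψ
  qr (φ ∨ᶠ ψ)   = qr φ ⊔ qr ψ
  qr (∃ᶠ φ)     = suc (qr φ)
  qr (∀ᶠ φ)     = suc (qr φ)
  qr (∃ˢ φ)     = suc (qr φ)
  qr (∀ˢ φ)     = suc (qr φ)

  -- The number of symbols of the named (not de Bruijn) formula, without
  -- parentheses and commas, each occurrence of a variable counting as one symbol.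
  size : ∀ {L k m} → Formula σ L k m → ℕ
  size (rel R xs) = 1 + arity σ R
  size (x ≐ y)    = 3
  size (x ∈ˢ X)   = 3
  size (¬ᶠ φ)     = 1 + size φ
  size (φ ∧ᶠ ψ)   = 1 + size φ + size ψ
  size (φ ∨ᶠ ψ)   = 1 + size φ + size ψ
  size (∃ᶠ φ)     = 2 + size φ
  size (∀ᶠ φ)     = 2 + size φ
  size (∃ˢ φ)     = 2 + size φ
  size (∀ˢ φ)     = 2 + size φ

  nnf  : ∀ {L k m} → Formula σ L k m → Formula σ L k m
  nnf¬ : ∀ {L k m} → Formula σ L k m → Formula σ L k m

  nnf (rel R xs) = rel R xs
  nnf (x ≐ y)    = x ≐ y
  nnf (x ∈ˢ X)   = x ∈ˢ X
  nnf (¬ᶠ φ)     = nnf¬ φ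
  nnf (φ ∧ᶠ ψ)   = nnf φ ∧ᶠ nnf ψ
  nnf (φ ∨ᶠ ψ)   = nnf φ ∨ᶠ nnf ψ
  nnf (∃ᶠ φ)     = ∃ᶠ nnf φ
  nnf (∀ᶠ φ)     = ∀ᶠ nnf φ
  nnf (∃ˢ φ)     = ∃ˢ nnf φ
  nnf (∀ˢ φ)     = ∀ˢ nnf φ

  nnf¬ (rel R xs) = ¬ᶠ rel R xs
  nnf¬ (x ≐ y)    = ¬ᶠ (x ≐ y)
  nnf¬ (x ∈ˢ X)   = ¬ᶠ (x ∈ˢ X)
  nnf¬ (¬ᶠ φ)     = nnf φ
  nnf¬ (φ ∧ᶠ ψ)   = nnf¬ φ ∨ᶠ nnf¬ ψ
  nnf¬ (φ ∨ᶠ ψ)   = nnf¬ φ ∧ᶠ nnf¬ ψ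
  nnf¬ (∃ᶠ φ)     = ∀ᶠ nnf¬ φ
  nnf¬ (∀ᶠ φ)     = ∃ᶠ nnf¬ φ
  nnf¬ (∃ˢ φ)     = ∀ˢ nnf¬ φ
  nnf¬ (∀ˢ φ)     = ∃ˢ nnf¬ φ

data Quantifier : Set where
  ex all : Quantifier

change : Maybe Quantifier → Quantifier → ℕ
change (just ex)  all = 1
change (just all) ex  = 1
change _          _   = 0

module _ {σ : Signature} where

  -- The maximal number of alternations on a path from the root; the first
  -- argument is the last quantifier seen above the formula, if any. Only
  -- meaningful for formulae in negation normal form.
  alternations : ∀ {L k m} → Maybe Quantifier → Formula σ L k m → ℕ
  alternations q (rel R xs) = 0
  alternations q (x ≐ y)    = 0
  alternations q (x ∈ˢ X)   = 0
  alternations q (¬ᶠ φ)     = alternations q φ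
  alternations q (φ ∧ᶠ ψ)   = alternations q φ ⊔ alternations q ψ
  alternations q (φ ∨ᶠ ψ)   = alternations q φ ⊔ alternations q ψ
  alternations q (∃ᶠ φ)     = change q ex  + alternations (just ex)  φ
  alternations q (∀ᶠ φ)     = change q all + alternations (just all) φ
  alternations q (∃ˢ φ)     = change q ex  + alternations (just ex)  φ
  alternations q (∀ˢ φ)     = change q all + alternations (just all) φ

  qad : ∀ {L k m} → Formula σ L k m → ℕ
  qad φ = alternations nothing (nnf φ)

_-exp : ℕ → ℕ → ℕ
(zero -exp)  n = n
(suc d -exp) n = 2 ^ (d -exp) n

_-EXP : ℕ → (ℕ → ℕ) → Set
(d -EXP) f = ∃[ c ] (∀ n → c < n → f n ≤ (d -exp) (n ^ c))

{-# OPTIONS --safe #-}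
-- Removing a root from every component, d times in turn, turns a structure of tree-depth
-- d into a forest with d levels, whose nodes are labelled by the atomic types of the
-- paths that lead to them. The code of a forest tells, up to a threshold, how many of
-- its trees have each code. If the thresholds for rank q + 1 exceed those for rank q by
-- a factor that bounds the number of codes of trees with one more set marked, then, by
-- the pigeonhole principle, every marking of a forest can be copied to any other forest
-- with the same code for rank q + 1, so that the codes for rank q agree again. Hence, as
-- in an Ehrenfeucht-Fraïssé game, the code for rank q determines the MSO theory of rank
-- q; an element quantifier marks a single node.
--
-- The number of codes of unmarked forests with d levels is d-fold exponential in q. Each
-- code is described by a first-order formula. As a component may have several suitable
-- roots, it is classified by the least code that one of them yields; to count the
-- components of each class takes two alternations per level.
module Submission where

open import Defs
open import Data.Bool.Base using (Bool; true; false; if_then_else_; T)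
open import Data.Bool.Properties using (T?; T-≡)
open import Data.Empty using (⊥-elim)
open import Data.Fin.Base using (Fin; zero; suc; toℕ; fromℕ<; combine; quotient; remainder; funToFin; finToFun; _↑ˡ_; _↑ʳ_)
open import Data.Fin.Properties using (any?; all?; toℕ-fromℕ<; toℕ-injective; toℕ<n; remQuot-combine; combine-remQuot; combine-injective; funToFin-finToFin; finToFun-funToFin; ∀-cons) renaming (_≟_ to _≟ᶠ_; 0≢1+n to 0≢1+i; suc-injective to sucᶠ-injective)
open import Data.Fin.Subset using (Subset; _⊆_; _-_; _─_; ⁅_⁆; ∣_∣) renaming (_∈_ to _∈ₛ_; _∉_ to _∉ₛ_; ⊤ to ⊤ₛ)
open import Data.Fin.Subset.Properties using (x∈p⇒∣p-x∣<∣p∣; p─q─q≡p─q; p─q⊆p; x∈p∧x≢y⇒x∈p-y; x∈p∧x∉q⇒x∈p─q; ∣⁅x⁆∣≡1; p⊆q⇒∣p∣≤∣q∣; x∈⁅y⁆⇒x≡y; ∈⊤; ⊆⊤) renaming (_∈?_ to _∈ₛ?_)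
open import Data.List.Base using (List; []; _∷_; _++_; length; map; replicate; allFin)
open import Data.List.Membership.Propositional using (_∈_; find)
open import Data.List.Membership.Propositional.Properties using (∈-allFin; ∈-∃++)
open import Data.List.Properties using (length-map; map-∘; map-++; map-replicate; length-++-sucʳ)
import Data.List.Relation.Unary.All as All
open All using (All; []; _∷_)
open import Data.List.Relation.Unary.All.Properties using (¬Any⇒All¬)
open import Data.List.Relation.Unary.AllPairs using (AllPairs; []; _∷_)
import Data.List.Relation.Unary.Any as Any
open Any using (here; there)
open import Data.Maybe.Base using (just; nothing)
open import Data.Nat.Base using (ℕ; zero; suc; _+_; _*_; _^_; _⊓_; _∸_; _≤_; _<_; z≤n; s≤s; z<s; s≤s⁻¹; >-nonZero)
open import Data.Nat.Properties hiding (_≟_; _≤?_; _<?_)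
open import Data.Nat.Properties using () renaming (_≟_ to _≟ℕ_; _<?_ to _<ℕ?_)
open import Data.Product.Base using (∃; ∃-syntax; Σ; Σ-syntax; _×_; _,_; proj₁; proj₂)
open import Data.Product.Function.NonDependent.Propositional using (_×-⇔_)
open import Data.Sum.Base using (_⊎_; inj₁; inj₂; [_,_]′)
open import Data.Sum.Function.Propositional using (_⊎-⇔_)
import Data.Vec.Base as Vec
open Vec using (Vec; []; _∷_; lookup)
open import Data.Vec.Membership.Propositional using () renaming (_∈_ to _∈ᵛ_)
open import Data.Vec.Membership.Propositional.Properties using (∈-lookup)
open import Data.Vec.Properties using (lookup-map; lookup∘tabulate; lookup⇒[]=; []=⇒lookup; lookup-++ˡ; lookup-++ʳ; map-lookup-allFin; toList-map) renaming (map-∘ to Vec-map-∘)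
import Data.Vec.Relation.Unary.Any as Anyᵛ
open import Data.Vec.Relation.Unary.Any.Properties using (lookup-index)
open import Function.Base using (_∘_; id; case_of_)
open import Function.Bundles using (_⇔_; mk⇔; Equivalence)
open import Function.Construct.Composition using () renaming (equivalence to ⇔-trans)
open import Function.Related.TypeIsomorphisms using (¬-cong-⇔)
open import Relation.Binary.Construct.Closure.ReflexiveTransitive using (ε; _◅_; _◅◅_; reverse) renaming (map to Star-map)
open import Relation.Binary.PropositionalEquality using (_≡_; _≢_; _≗_; refl; sym; trans; cong; cong₂; subst; module ≡-Reasoning)
open import Relation.Nullary using (¬_; Dec; yes; no; does; contradiction)
open import Relation.Nullary.Decidable using (map′; _×-dec_; _⊎-dec_; _→-dec_; ¬?; decidable-stable; dec-true; dec-false)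
open Signature

-- Lists with equal capped counts

-- A structure satisfies at least one description, and each description that it satisfies is the
-- code of one of its elimination forests. A formula then holds in the structure iff it holds, with
-- forest semantics, in a fixed representative of that code. So the translation is the disjunction
-- of the descriptions whose representatives satisfy the formula, which is decidable.
--
-- Connectivity is the obstacle to a first-order description. Bounded tree-depth bounds the length
-- of shortest walks by a constant, so that connectivity, and with it membership in the part below a
-- path, is an existential formula.
--
-- The sharp exponent rests on an asymmetry. The thresholds count codes of marked trees, and each
-- quantifier doubles the labels; so the threshold for trees with d levels below the root is (d +
-- 1)-fold exponential, one more than the number of unmarked codes with d levels. But the number of
-- codes with d + 1 levels is a power in which this threshold occurs only in the base; the exponent
-- is the number of unmarked tree codes.

hit : ∀ {M} → Fin M → Fin M → ℕ
hit c x = if does (c ≟ᶠ x) then 1 else 0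

hit-refl : ∀ {M} (c : Fin M) → hit c c ≡ 1
hit-refl c rewrite dec-true (c ≟ᶠ c) refl = refl

hit-≢ : ∀ {M} {c x : Fin M} → c ≢ x → hit c x ≡ 0
hit-≢ {c = c} {x} c≢x rewrite dec-false (c ≟ᶠ x) c≢x = refl

occ : ∀ {M} → Fin M → List (Fin M) → ℕ
occ c []       = 0
occ c (x ∷ xs) = hit c x + occ c xs

occ-insert : ∀ {M} (c : Fin M) as {x bs} → occ c (as ++ x ∷ bs) ≡ hit c x + occ c (as ++ bs)
occ-insert c []            = refl
occ-insert c (a ∷ as) {x} {bs} = begin
  hit c a + occ c (as ++ x ∷ bs)         ≡⟨ cong (hit c a +_) (occ-insert c as) ⟩
  hit c a + (hit c x + occ c (as ++ bs)) ≡⟨ +-assoc (hit c a) _ _ ⟨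
  hit c a + hit c x + occ c (as ++ bs)   ≡⟨ cong (_+ occ c (as ++ bs)) (+-comm (hit c a) _) ⟩
  hit c x + hit c a + occ c (as ++ bs)   ≡⟨ +-assoc (hit c x) _ _ ⟩
  hit c x + (hit c a + occ c (as ++ bs)) ∎
  where open ≡-Reasoning

occ-map-insert : ∀ {X : Set} {M} (k : X → Fin M) c as {x bs} →
                 occ c (map k (as ++ x ∷ bs)) ≡ hit c (k x) + occ c (map k (as ++ bs))
occ-map-insert k c as {x} {bs} = begin
  occ c (map k (as ++ x ∷ bs))               ≡⟨ cong (occ c) (map-++ k as _) ⟩
  occ c (map k as ++ k x ∷ map k bs)         ≡⟨ occ-insert c (map k as) ⟩
  hit c (k x) + occ c (map k as ++ map k bs) ≡⟨ cong (λ l → hit c (k x) + occ c l) (map-++ k as bs) ⟨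
  hit c (k x) + occ c (map k (as ++ bs))     ∎
  where open ≡-Reasoning

below : ∀ {M} → List (Fin (suc M)) → List (Fin M)
below []           = []
below (zero ∷ xs)  = below xs
below (suc x ∷ xs) = x ∷ below xs

length-below : ∀ {M} (xs : List (Fin (suc M))) → length xs ≡ occ zero xs + length (below xs)
length-below []           = refl
length-below (zero ∷ xs)  = cong suc (length-below xs)
length-below (suc x ∷ xs) = trans (cong suc (length-below xs)) (sym (+-suc _ _))

occ-below : ∀ {M} (b : Fin M) xs → occ b (below xs) ≡ occ (suc b) xs
occ-below b []           = refl
occ-below b (zero ∷ xs)  = occ-below b xs
occ-below b (suc x ∷ xs) = cong (hit b x +_) (occ-below b xs)

-- Induction on the number of values: the occurrences of `zero` are split off, and `below` renames
-- the other entries.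
length-bound : ∀ {M} t (xs : List (Fin M)) → (∀ b → occ b xs ≤ t) → length xs ≤ M * t
length-bound {zero}  t []       _ = z≤n
length-bound {zero}  t (() ∷ _)
length-bound {suc M} t xs       h = subst (_≤ t + M * t) (sym (length-below xs))
  (+-mono-≤ (h zero) (length-bound t (below xs)
    (λ b → subst (_≤ t) (sym (occ-below b xs)) (h (suc b)))))

frequent : ∀ {M} t (xs : List (Fin M)) → M * t < length xs → ∃[ b ] t < occ b xs
frequent t xs lt with any? (λ b → t <ℕ? occ b xs)
... | yes p = p
... | no ¬p = contradiction (length-bound t xs (λ b → ≮⇒≥ (λ q → ¬p (b , q)))) (<⇒≱ lt)

⊓-≡⇒ : ∀ {T} m n → m ⊓ T ≡ n ⊓ T → m ≡ n ⊎ (T ≤ m × T ≤ n)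
⊓-≡⇒ {T} m n eq with ≤-total T m | ≤-total T n
... | inj₁ T≤m | inj₁ T≤n = inj₂ (T≤m , T≤n)
... | inj₂ m≤T | inj₂ n≤T = inj₁ (trans (sym (m≤n⇒m⊓n≡m m≤T)) (trans eq (m≤n⇒m⊓n≡m n≤T)))
... | inj₁ T≤m | inj₂ n≤T = inj₂ (T≤m , ≤-reflexive
  (trans (sym (m≥n⇒m⊓n≡n T≤m)) (trans eq (m≤n⇒m⊓n≡m n≤T))))
... | inj₂ m≤T | inj₁ T≤n = inj₂ (≤-reflexive
  (trans (sym (m≥n⇒m⊓n≡n T≤n)) (trans (sym eq) (m≤n⇒m⊓n≡m m≤T))) , T≤n)

⊓-both : ∀ {t m n} → t ≤ m → t ≤ n → m ⊓ t ≡ n ⊓ t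
⊓-both t≤m t≤n = trans (m≥n⇒m⊓n≡n t≤m) (sym (m≥n⇒m⊓n≡n t≤n))

-- The elements of a list have a class k and a colour κ. As a class with at least
-- T > M′ t elements contains a colour occurring more than t times, its size can
-- be changed by adding or removing one element of that colour, without any effect
-- on the colour counts capped at t.
module Recolour {X : Set} {M M′ : ℕ} (k : X → Fin M) (κ : X → Fin M′) (t T : ℕ) (M′t<T : M′ * t < T) where

  colours : Fin M → List X → List (Fin M′)
  colours c []       = []
  colours c (x ∷ xs) = if does (c ≟ᶠ k x) then κ x ∷ colours c xs else colours c xs

  length-colours : ∀ c xs → length (colours c xs) ≡ occ c (map k xs)
  length-colours c []       = refl
  length-colours c (x ∷ xs) with does (c ≟ᶠ k x)
  ... | true  = cong suc (length-colours c xs)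
  ... | false = length-colours c xs

  occ-colours : ∀ c b xs → occ b (colours c xs) ≤ occ b (map κ xs)
  occ-colours c b []       = z≤n
  occ-colours c b (x ∷ xs) with does (c ≟ᶠ k x)
  ... | true  = +-monoʳ-≤ (hit b (κ x)) (occ-colours c b xs)
  ... | false = ≤-trans (occ-colours c b xs) (m≤n+m _ (hit b (κ x)))

  locate : ∀ c b xs → 0 < occ b (colours c xs) → ∃[ x ] x ∈ xs × k x ≡ c × κ x ≡ b
  locate c b (x ∷ xs) pos with c ≟ᶠ k x
  ... | no _ = let y , y∈ , eqs = locate c b xs pos in y , there y∈ , eqs
  ... | yes c≡kx with b ≟ᶠ κ x
  ...   | yes b≡κx = x , here refl , sym c≡kx , sym b≡κx
  ...   | no _ = let y , y∈ , eqs = locate c b xs pos in y , there y∈ , eqs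

  popular : ∀ c xs → T ≤ occ c (map k xs) → ∃[ x ] x ∈ xs × k x ≡ c × t < occ (κ x) (map κ xs)
  popular c xs T≤
    with b , t<occ ← frequent t (colours c xs)
           (<-≤-trans M′t<T (subst (T ≤_) (sym (length-colours c xs)) T≤))
    with x , x∈ , kx≡c , refl ← locate c b xs (≤-<-trans z≤n t<occ) =
    x , x∈ , kx≡c , <-≤-trans t<occ (occ-colours c _ xs)

  record Resized (c : Fin M) (m : ℕ) (xs : List X) : Set where
    field
      list     : List X
      size≡    : occ c (map k list) ≡ m
      others   : ∀ c′ → c′ ≢ c → occ c′ (map k list) ≡ occ c′ (map k xs)
      coloured : ∀ b → occ b (map κ list) ⊓ t ≡ occ b (map κ xs) ⊓ t
  open Resized

  unchanged : ∀ {c m xs} → occ c (map k xs) ≡ m → Resized c m xs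
  unchanged {xs = xs} eq = record
    { list = xs ; size≡ = eq ; others = λ _ _ → refl ; coloured = λ _ → refl }

  then : ∀ {c m m′ xs} (r : Resized c m xs) → Resized c m′ (list r) → Resized c m′ xs
  then r s = record
    { list     = list s
    ; size≡    = size≡ s
    ; others   = λ c′ c′≢c → trans (others s c′ c′≢c) (others r c′ c′≢c)
    ; coloured = λ b → trans (coloured s b) (coloured r b) }

  grow : ∀ {c m xs} → occ c (map k xs) ≡ m → T ≤ m → Resized c (suc m) xs
  grow {c} {m} {xs} refl T≤ with x , x∈ , refl , t< ← popular c xs T≤ = record
    { list     = x ∷ xs
    ; size≡    = cong (_+ m) (hit-refl (k x))
    ; others   = λ c′ c′≢c → cong (_+ occ c′ (map k xs)) (hit-≢ c′≢c)
    ; coloured = coloured′ }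
    where
    coloured′ : ∀ b → (hit b (κ x) + occ b (map κ xs)) ⊓ t ≡ occ b (map κ xs) ⊓ t
    coloured′ b with b ≟ᶠ κ x
    ... | yes refl = ⊓-both (≤-trans (<⇒≤ t<) (n≤1+n _)) (<⇒≤ t<)
    ... | no _     = refl

  shrink : ∀ {c m xs} → occ c (map k xs) ≡ suc m → T ≤ suc m → Resized c m xs
  shrink {c} {m} {xs} eq T≤
    with x , x∈ , refl , t< ← popular c xs (subst (T ≤_) (sym eq) T≤)
    with as , bs , refl ← ∈-∃++ x∈ = record
    { list     = as ++ bs
    ; size≡    = suc-injective (trans
                   (trans (cong (_+ occ (k x) (map k (as ++ bs))) (sym (hit-refl (k x))))
                          (sym (occ-map-insert k (k x) as))) eq)
    ; others   = λ c′ c′≢c → sym (trans (occ-map-insert k c′ as)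
                   (cong (_+ occ c′ (map k (as ++ bs))) (hit-≢ c′≢c)))
    ; coloured = coloured′ }
    where
    coloured′ : ∀ b → occ b (map κ (as ++ bs)) ⊓ t ≡ occ b (map κ (as ++ x ∷ bs)) ⊓ t
    coloured′ b rewrite occ-map-insert κ b as {x} {bs} with b ≟ᶠ κ x
    ... | no _     = refl
    -- The colour occurred more than `t` times, so at least `t` occurrences survive the removal.
    ... | yes refl = ⊓-both (s≤s⁻¹ t<′) (<⇒≤ t<′)
      where
      t<′ : t < suc (occ (κ x) (map κ (as ++ bs)))
      t<′ = subst (t <_) (trans (occ-map-insert κ (κ x) as) (cong (_+ occ (κ x) (map κ (as ++ bs))) (hit-refl (κ x)))) t<

  growBy : ∀ {c m xs} j → occ c (map k xs) ≡ m → T ≤ m → Resized c (j + m) xs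
  growBy zero    eq T≤ = unchanged eq
  growBy {m = m} (suc j) eq T≤ =
    let r = growBy j eq T≤ in then r (grow (size≡ r) (≤-trans T≤ (m≤n+m m j)))

  shrinkBy : ∀ {c m xs} j → occ c (map k xs) ≡ j + m → T ≤ m → Resized c m xs
  shrinkBy zero    eq T≤ = unchanged eq
  shrinkBy {m = m} (suc j) eq T≤ =
    let r = shrink eq (≤-trans T≤ (m≤n+m m (suc j))) in then r (shrinkBy j (size≡ r) T≤)

  resize : ∀ {c xs} m → occ c (map k xs) ⊓ T ≡ m ⊓ T → Resized c m xs
  resize {c} {xs} m eq with ⊓-≡⇒ (occ c (map k xs)) m eq
  ... | inj₁ n≡m = unchanged n≡m
  ... | inj₂ (T≤n , T≤m) with ≤-total m (occ c (map k xs))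
  ...   | inj₁ m≤n = shrinkBy _ (sym (m∸n+n≡m m≤n)) T≤m
  ...   | inj₂ n≤m = subst (λ j → Resized c j xs) (m∸n+n≡m n≤m) (growBy (m ∸ occ c (map k xs)) refl T≤n)

  -- The classes are corrected one at a time. Correcting one leaves the sizes of the others alone,
  -- and the capped equality is kept as the hypothesis for the classes still to come.
  resizeAll : ∀ xs (h : Fin M → ℕ) → (∀ c → occ c (map k xs) ⊓ T ≡ h c ⊓ T) → ∀ cs →
    ∃[ xs′ ] (∀ c → c ∈ cs → occ c (map k xs′) ≡ h c) ×
             (∀ c → occ c (map k xs′) ⊓ T ≡ h c ⊓ T) ×
             (∀ b → occ b (map κ xs′) ⊓ t ≡ occ b (map κ xs) ⊓ t)
  resizeAll xs h eq []       = xs , (λ _ ()) , eq , λ _ → refl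
  resizeAll xs h eq (c ∷ cs) =
    let ys , exact , capped , col = resizeAll xs h eq cs
        r = resize (h c) (capped c)
    in list r
     , (λ { _ (here refl) → size≡ r ; c′ (there c′∈) → exact′ ys exact r c′ c′∈ })
     , capped′ ys capped r
     , λ b → trans (coloured r b) (col b)
    where
    exact′ : ∀ ys → (∀ c → c ∈ cs → occ c (map k ys) ≡ h c) → (r : Resized c (h c) ys) →
             ∀ c′ → c′ ∈ cs → occ c′ (map k (list r)) ≡ h c′
    exact′ ys exact r c′ c′∈ with c′ ≟ᶠ c
    ... | yes refl = size≡ r
    ... | no  c′≢c = trans (others r c′ c′≢c) (exact c′ c′∈)
    capped′ : ∀ ys → (∀ c → occ c (map k ys) ⊓ T ≡ h c ⊓ T) → (r : Resized c (h c) ys) →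
              ∀ c′ → occ c′ (map k (list r)) ⊓ T ≡ h c′ ⊓ T
    capped′ ys capped r c′ with c′ ≟ᶠ c
    ... | yes refl = cong (_⊓ T) (size≡ r)
    ... | no  c′≢c = trans (cong (_⊓ T) (others r c′ c′≢c)) (capped c′)

occ-find : ∀ {X : Set} {M} (k : X → Fin M) c xs → 0 < occ c (map k xs) → ∃[ x ] x ∈ xs × k x ≡ c
occ-find k c (x ∷ xs) pos with c ≟ᶠ k x
... | yes c≡kx = x , here refl , sym c≡kx
... | no _ = let y , y∈ , eq = occ-find k c xs pos in y , there y∈ , eq

-- With equal class sizes, each `y` can be matched with its own element `x` of the same class; `tr`
-- then replaces `x` by an element over `y` that has the colour of `x`.
align : ∀ {X Y : Set} {M M′} (k : X → Fin M) (κ : X → Fin M′) (k′ : Y → Fin M) (e : X → Y) →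
  (∀ x y → k x ≡ k′ y → ∃[ x′ ] e x′ ≡ y × κ x′ ≡ κ x) →
  ∀ ys xs → (∀ c → occ c (map k xs) ≡ occ c (map k′ ys)) →
  ∃[ xs′ ] map e xs′ ≡ ys × (∀ b → occ b (map κ xs′) ≡ occ b (map κ xs))
align k κ k′ e tr [] []       eq = [] , refl , λ _ → refl
align k κ k′ e tr [] (x ∷ xs) eq with eq (k x)
... | p rewrite hit-refl (k x) with () ← p
align k κ k′ e tr (y ∷ ys) xs eq
  with x , x∈ , kx≡ ← occ-find k (k′ y) xs (subst (0 <_) (sym (eq (k′ y)))
         (subst (λ h → 0 < h + occ (k′ y) (map k′ ys)) (sym (hit-refl (k′ y))) z<s))
  with as , bs , refl ← ∈-∃++ x∈
  with x′ , ex′≡ , κx′≡ ← tr x y kx≡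
  with xs′ , exs′≡ , occs ← align k κ k′ e tr ys (as ++ bs) (λ c →
         +-cancelˡ-≡ (hit c (k x)) _ _ (trans (sym (occ-map-insert k c as))
           (trans (eq c) (cong (λ z → hit c z + occ c (map k′ ys)) (sym kx≡))))) =
  x′ ∷ xs′ , cong₂ _∷_ ex′≡ exs′≡ , λ b →
    trans (cong₂ (λ z n → hit b z + n) κx′≡ (occs b)) (sym (occ-map-insert κ b as))

-- Class sizes that agree up to `T` are first made equal by `resizeAll`, without changing the colour
-- counts capped at `t`; then `align` applies.
recolour : ∀ {X Y : Set} {M M′} (k : X → Fin M) (κ : X → Fin M′) (k′ : Y → Fin M) (e : X → Y) →
  (∀ x y → k x ≡ k′ y → ∃[ x′ ] e x′ ≡ y × κ x′ ≡ κ x) →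
  ∀ t T → M′ * t < T → ∀ xs ys → (∀ c → occ c (map k xs) ⊓ T ≡ occ c (map k′ ys) ⊓ T) →
  ∃[ xs′ ] map e xs′ ≡ ys × (∀ b → occ b (map κ xs′) ⊓ t ≡ occ b (map κ xs) ⊓ t)
recolour {M = M} k κ k′ e tr t T lt xs ys eq =
  let zs , exact , _ , col = Recolour.resizeAll k κ t T lt xs (λ c → occ c (map k′ ys)) eq (allFin M)
      xs′ , e≡ , occs = align k κ k′ e tr ys zs (λ c → exact c (∈-allFin c))
  in xs′ , e≡ , λ b → trans (cong (_⊓ t) (occs b)) (col b)

-- Forests and their codes

-- First-child/next-sibling form: node a g f is a tree with root a and children g,
-- followed by the trees of f. Trees have at most d levels.
data Forest (A : Set) : ℕ → Set where
  []   : ∀ {d} → Forest A d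
  node : ∀ {d} → A → Forest A d → Forest A (suc d) → Forest A (suc d)

mapF : ∀ {A B : Set} {d} → (A → B) → Forest A d → Forest B d
mapF h []           = []
mapF h (node a g f) = node (h a) (mapF h g) (mapF h f)

mapF-∘ : ∀ {A B C : Set} (h : B → C) (h′ : A → B) {d} (f : Forest A d) →
         mapF h (mapF h′ f) ≡ mapF (h ∘ h′) f
mapF-∘ h h′ []           = refl
mapF-∘ h h′ (node a g f) = cong₂ (node _) (mapF-∘ h h′ g) (mapF-∘ h h′ f)

mapF-cong : ∀ {A B : Set} {h h′ : A → B} → h ≗ h′ → ∀ {d} (f : Forest A d) → mapF h f ≡ mapF h′ f
mapF-cong eq []           = refl
mapF-cong eq (node a g f) rewrite eq a = cong₂ (node _) (mapF-cong eq g) (mapF-cong eq f)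

Tree : Set → ℕ → Set
Tree A d = A × Forest A d

trees : ∀ {A d} → Forest A (suc d) → List (Tree A d)
trees []           = []
trees (node a g f) = (a , g) ∷ trees f

plant : ∀ {A d} → List (Tree A d) → Forest A (suc d)
plant []             = []
plant ((a , g) ∷ ts) = node a g (plant ts)

trees-plant : ∀ {A d} (ts : List (Tree A d)) → trees (plant ts) ≡ ts
trees-plant []       = refl
trees-plant (t ∷ ts) = cong (t ∷_) (trees-plant ts)

plant-trees : ∀ {A d} (f : Forest A (suc d)) → plant (trees f) ≡ f
plant-trees []           = refl
plant-trees (node a g f) = cong (node a g) (plant-trees f)

mapT : ∀ {A B : Set} {d} → (A → B) → Tree A d → Tree B d
mapT h (a , g) = h a , mapF h g

mapF-plant : ∀ {A B : Set} {d} (h : A → B) (ts : List (Tree A d)) → mapF h (plant ts) ≡ plant (map (mapT h) ts)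
mapF-plant h []       = refl
mapF-plant h (t ∷ ts) = cong (node _ _) (mapF-plant h ts)

trees-mapF : ∀ {A B : Set} {d} (h : A → B) (f : Forest A (suc d)) → trees (mapF h f) ≡ map (mapT h) (trees f)
trees-mapF h []           = refl
trees-mapF h (node a g f) = cong (_ ∷_) (trees-mapF h f)

-- Counts the functions from tree codes to capped counts; a tree code is a label paired with a code
-- that has one level less.
#codes : ℕ → (ℕ → ℕ) → ℕ → ℕ
#codes n t zero    = 1
#codes n t (suc d) = suc (t d) ^ (n * #codes n t d)

cap : (t k : ℕ) → Fin (suc t)
cap t k = fromℕ< (s≤s (m⊓n≤n k t))

toℕ-cap : ∀ t k → toℕ (cap t k) ≡ k ⊓ t
toℕ-cap t k = toℕ-fromℕ< (s≤s (m⊓n≤n k t))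

cap-cong : ∀ {t k k′} → k ⊓ t ≡ k′ ⊓ t → cap t k ≡ cap t k′
cap-cong {t} {k} {k′} eq = toℕ-injective (trans (toℕ-cap t k) (trans eq (sym (toℕ-cap t k′))))

funToFin-cong : ∀ {m n} {h h′ : Fin m → Fin n} → h ≗ h′ → funToFin h ≡ funToFin h′
funToFin-cong {zero}  eq = refl
funToFin-cong {suc m} eq = cong₂ combine (eq zero) (funToFin-cong (eq ∘ suc))

-- t d caps the counts of the trees with at most d levels below their roots.
code  : ∀ {n} (t : ℕ → ℕ) {d} → Forest (Fin n) d → Fin (#codes n t d)
codes : ∀ {n} (t : ℕ → ℕ) {d} → Forest (Fin n) (suc d) → List (Fin (n * #codes n t d))

code t {zero}  f = zero
code t {suc d} f = funToFin (λ c → cap (t d) (occ c (codes t f)))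

codes t []           = []
codes t (node a g f) = combine a (code t g) ∷ codes t f

tcode : ∀ {n} (t : ℕ → ℕ) {d} → Tree (Fin n) d → Fin (n * #codes n t d)
tcode t (a , g) = combine a (code t g)

codes-trees : ∀ {n} t {d} (f : Forest (Fin n) (suc d)) → codes t f ≡ map (tcode t) (trees f)
codes-trees t []           = refl
codes-trees t (node a g f) = cong (_ ∷_) (codes-trees t f)

code⇒occ : ∀ {n} {t : ℕ → ℕ} {d} {f : Forest (Fin n) (suc d)} {h : Fin (n * #codes n t d) → ℕ} →
           code t f ≡ funToFin (λ c → cap (t d) (h c)) → ∀ c → occ c (codes t f) ⊓ t d ≡ h c ⊓ t d
code⇒occ {t = t} {d = d} {f} {h} eq c = begin
  occ c (codes t f) ⊓ t d                                           ≡⟨ toℕ-cap (t d) _ ⟨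
  toℕ (cap (t d) (occ c (codes t f)))                               ≡⟨ cong toℕ (finToFun-funToFin (λ c → cap (t d) (occ c (codes t f))) c) ⟨
  toℕ (finToFun (code t f) c)                                       ≡⟨ cong (λ z → toℕ (finToFun z c)) eq ⟩
  toℕ (finToFun (funToFin (λ c → cap (t d) (h c))) c)               ≡⟨ cong toℕ (finToFun-funToFin (λ c → cap (t d) (h c)) c) ⟩
  toℕ (cap (t d) (h c))                                             ≡⟨ toℕ-cap (t d) (h c) ⟩
  h c ⊓ t d                                                         ∎
  where open ≡-Reasoning

code-cong : ∀ {n} {t : ℕ → ℕ} {d} {f : Forest (Fin n) (suc d)} {h : Fin (n * #codes n t d) → ℕ} →
            (∀ c → occ c (codes t f) ⊓ t d ≡ h c ⊓ t d) → code t f ≡ funToFin (λ c → cap (t d) (h c))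
code-cong eq = funToFin-cong (λ c → cap-cong (eq c))

-- A marked label is a pair of a label and a bit, numbered in `Fin (n * 2)`; the bit tells whether
-- the node belongs to the newest set.
unmark : ∀ n → Fin (n * 2) → Fin n
unmark n = quotient 2

erase : ∀ n {d} → Forest (Fin (n * 2)) d → Forest (Fin n) d
erase n = mapF (unmark n)

bit : Bool → Fin 2
bit false = zero
bit true  = suc zero

isOne : Fin 2 → Bool
isOne zero    = false
isOne (suc _) = true

isOne-bit : ∀ b → isOne (bit b) ≡ b
isOne-bit false = refl
isOne-bit true  = refl

bit-isOne : ∀ i → bit (isOne i) ≡ i
bit-isOne zero       = refl
bit-isOne (suc zero) = refl

mark : ∀ {n} → Fin n → Bool → Fin (n * 2)
mark a b = combine a (bit b)

marked : ∀ n → Fin (n * 2) → Bool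
marked n a = isOne (remainder {n} 2 a)

unmark-mark : ∀ {n} (a : Fin n) b → unmark n (mark a b) ≡ a
unmark-mark a b = cong proj₁ (remQuot-combine a (bit b))

marked-mark : ∀ {n} (a : Fin n) b → marked n (mark a b) ≡ b
marked-mark a b = trans (cong (isOne ∘ proj₂) (remQuot-combine a (bit b))) (isOne-bit b)

mark-unmark : ∀ n (a : Fin (n * 2)) → mark (unmark n a) (marked n a) ≡ a
mark-unmark n a = trans (cong (combine (unmark n a)) (bit-isOne _)) (combine-remQuot {n} 2 a)

-- The hypothesis of the pigeonhole argument at each level. Here `n` is the number of marked labels,
-- so that `n * #codes n t′ d` is the number of colours.
Bounds : ℕ → (t′ t : ℕ → ℕ) → Set
Bounds n t′ t = ∀ d → n * #codes n t′ d * t′ d < t d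

-- Induction on the levels. The class of a tree of `f′` is the code of its erasure for `t`, its
-- colour is its own code for `t′`. The induction hypothesis copies the marks of one tree to another
-- of the same class, and `recolour` does so for the whole list.
transfer : ∀ {n d} {t t′ : ℕ → ℕ} → Bounds (n * 2) t′ t →
  (f′ : Forest (Fin (n * 2)) d) (g : Forest (Fin n) d) → code t (erase n f′) ≡ code t g →
  ∃[ g′ ] erase n g′ ≡ g × code t′ g′ ≡ code t′ f′
transfer {d = zero}  bounds [] [] _ = [] , refl , refl
transfer {n} {suc d} {t} {t′} bounds f′ g eq =
  plant xs , erase≡ , trans (code-cong {t = t′} {f = plant xs} λ c → begin
      occ c (codes t′ (plant xs)) ⊓ t′ d         ≡⟨ cong (λ l → occ c l ⊓ t′ d) (codes-trees t′ (plant xs)) ⟩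
      occ c (map (tcode t′) (trees (plant xs))) ⊓ t′ d ≡⟨ cong (λ l → occ c (map (tcode t′) l) ⊓ t′ d) (trees-plant xs) ⟩
      occ c (map (tcode t′) xs) ⊓ t′ d           ≡⟨ occs c ⟩
      occ c (map (tcode t′) (trees f′)) ⊓ t′ d   ≡⟨ cong (λ l → occ c l ⊓ t′ d) (codes-trees t′ f′) ⟨
      occ c (codes t′ f′) ⊓ t′ d                 ∎) refl
  where
  open ≡-Reasoning
  tr : ∀ (x : Tree (Fin (n * 2)) d) (y : Tree (Fin n) d) → tcode t (mapT (unmark n) x) ≡ tcode t y →
       ∃[ x′ ] mapT (unmark n) x′ ≡ y × tcode t′ x′ ≡ tcode t′ x
  tr (a , x) (b , y) eq′ =
    let a≡ , x≡ = combine-injective (unmark n a) (code t (erase n x)) b (code t y) eq′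
        x′ , e≡ , c≡ = transfer bounds x y x≡
    in (a , x′) , cong₂ _,_ a≡ e≡ , cong (combine a) c≡
  capped : ∀ c → occ c (map (tcode t ∘ mapT (unmark n)) (trees f′)) ⊓ t d ≡ occ c (map (tcode t) (trees g)) ⊓ t d
  capped c = begin
    occ c (map (tcode t ∘ mapT (unmark n)) (trees f′)) ⊓ t d        ≡⟨ cong (λ l → occ c l ⊓ t d) (map-∘ (trees f′)) ⟩
    occ c (map (tcode t) (map (mapT (unmark n)) (trees f′))) ⊓ t d  ≡⟨ cong (λ l → occ c (map (tcode t) l) ⊓ t d) (trees-mapF (unmark n) f′) ⟨
    occ c (map (tcode t) (trees (erase n f′))) ⊓ t d              ≡⟨ cong (λ l → occ c l ⊓ t d) (codes-trees t (erase n f′)) ⟨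
    occ c (codes t (erase n f′)) ⊓ t d                            ≡⟨ code⇒occ {n} {t} {f = erase n f′} {h = λ c → occ c (codes t g)} eq c ⟩
    occ c (codes t g) ⊓ t d                                     ≡⟨ cong (λ l → occ c l ⊓ t d) (codes-trees t g) ⟩
    occ c (map (tcode t) (trees g)) ⊓ t d                       ∎
  rec = recolour (tcode t ∘ mapT (unmark n)) (tcode t′) (tcode t) (mapT (unmark n)) tr (t′ d) (t d) (bounds d)
                 (trees f′) (trees g) capped
  xs = proj₁ rec
  occs = proj₂ (proj₂ rec)
  erase≡ : erase n (plant xs) ≡ g
  erase≡ = trans (mapF-plant (unmark n) xs) (trans (cong plant (proj₁ (proj₂ rec))) (plant-trees g))

-- Representatives of codes

spread : ∀ {X : Set} {M} → (Fin M → ℕ) → (Fin M → X) → List X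
spread {M = zero}  h x = []
spread {M = suc M} h x = replicate (h zero) (x zero) ++ spread (h ∘ suc) (x ∘ suc)

map-spread : ∀ {X Y : Set} (k : X → Y) {M} h (x : Fin M → X) → map k (spread h x) ≡ spread h (k ∘ x)
map-spread k {zero}  h x = refl
map-spread k {suc M} h x = trans (map-++ k (replicate (h zero) (x zero)) _)
  (cong₂ _++_ (map-replicate k (h zero) (x zero)) (map-spread k (h ∘ suc) (x ∘ suc)))

spread-cong : ∀ {X : Set} {M} h {x y : Fin M → X} → x ≗ y → spread h x ≡ spread h y
spread-cong {M = zero}  h eq = refl
spread-cong {M = suc M} h eq = cong₂ (λ a l → replicate (h zero) a ++ l) (eq zero) (spread-cong (h ∘ suc) (eq ∘ suc))

occ-++ : ∀ {M} (c : Fin M) xs ys → occ c (xs ++ ys) ≡ occ c xs + occ c ys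
occ-++ c []       ys = refl
occ-++ c (x ∷ xs) ys = trans (cong (hit c x +_) (occ-++ c xs ys)) (sym (+-assoc (hit c x) _ _))

occ-replicate : ∀ {M} (c : Fin M) j → occ c (replicate j c) ≡ j
occ-replicate c zero    = refl
occ-replicate c (suc j) = cong₂ _+_ (hit-refl c) (occ-replicate c j)

occ-replicate-≢ : ∀ {M} {c x : Fin M} → c ≢ x → ∀ j → occ c (replicate j x) ≡ 0
occ-replicate-≢ c≢x zero    = refl
occ-replicate-≢ c≢x (suc j) = cong₂ _+_ (hit-≢ c≢x) (occ-replicate-≢ c≢x j)

occ-spread-∉ : ∀ {K M} (c : Fin K) h (x : Fin M → Fin K) → (∀ i → c ≢ x i) → occ c (spread h x) ≡ 0
occ-spread-∉ {M = zero}  c h x ∉ = refl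
occ-spread-∉ {M = suc M} c h x ∉ = trans (occ-++ c (replicate (h zero) (x zero)) _)
  (cong₂ _+_ (occ-replicate-≢ (∉ zero) (h zero)) (occ-spread-∉ c (h ∘ suc) (x ∘ suc) (∉ ∘ suc)))

occ-spread : ∀ {K M} h (x : Fin M → Fin K) → (∀ {i j} → x i ≡ x j → i ≡ j) → ∀ i → occ (x i) (spread h x) ≡ h i
occ-spread {M = suc M} h x inj zero = trans (occ-++ (x zero) (replicate (h zero) (x zero)) _)
  (trans (cong₂ _+_ (occ-replicate (x zero) (h zero))
    (occ-spread-∉ (x zero) (h ∘ suc) (x ∘ suc) (λ i eq → 0≢1+i (inj eq)))) (+-identityʳ _))
occ-spread {M = suc M} h x inj (suc i) = trans (occ-++ (x (suc i)) (replicate (h zero) (x zero)) _)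
  (cong₂ _+_ (occ-replicate-≢ (λ eq → 0≢1+i (sym (inj eq))) (h zero))
    (occ-spread (h ∘ suc) (x ∘ suc) (λ eq → sucᶠ-injective (inj eq)) i))

-- Provides a forest for every code, so that a formula can be evaluated on the code alone. Each tree
-- code is used exactly as often as its capped count says.
rep  : ∀ n t d → Fin (#codes n t d) → Forest (Fin n) d
repT : ∀ n t d → Fin (n * #codes n t d) → Tree (Fin n) d

rep n t zero    τ = []
rep n t (suc d) τ = plant (spread (λ c → toℕ (finToFun {suc (t d)} τ c)) (repT n t d))

repT n t d c = quotient {n} (#codes n t d) c , rep n t d (remainder {n} (#codes n t d) c)

code-rep   : ∀ n t d τ → code t (rep n t d τ) ≡ τ
tcode-repT : ∀ n t d c → tcode t (repT n t d c) ≡ c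

code-rep n t zero zero = refl
code-rep n t (suc d) τ = trans
  (funToFin-cong λ c → toℕ-injective (begin
    toℕ (cap (t d) (occ c (codes t f)))  ≡⟨ toℕ-cap (t d) (occ c (codes t f)) ⟩
    occ c (codes t f) ⊓ t d              ≡⟨ cong (_⊓ t d) (counts c) ⟩
    h c ⊓ t d                            ≡⟨ m≤n⇒m⊓n≡m (s≤s⁻¹ (toℕ<n (finToFun {suc (t d)} τ c))) ⟩
    h c                                  ∎))
  (funToFin-finToFin {n * #codes n t d} {suc (t d)} τ)
  where
  open ≡-Reasoning
  f : Forest (Fin n) (suc d)
  f = rep n t (suc d) τ
  h : Fin (n * #codes n t d) → ℕ
  h c = toℕ (finToFun {suc (t d)} τ c)
  counts : ∀ c → occ c (codes t f) ≡ h c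
  counts c = begin
    occ c (codes t f)                                        ≡⟨ cong (occ c) (codes-trees t f) ⟩
    occ c (map (tcode {n} t) (trees f))                      ≡⟨ cong (occ c ∘ map (tcode {n} t)) (trees-plant (spread h (repT n t d))) ⟩
    occ c (map (tcode {n} t) (spread h (repT n t d)))        ≡⟨ cong (occ c) (map-spread (tcode {n} t) h (repT n t d)) ⟩
    occ c (spread h (tcode {n} t ∘ repT n t d))              ≡⟨ cong (occ c) (spread-cong h (tcode-repT n t d)) ⟩
    occ c (spread h id)                                      ≡⟨ occ-spread h id id c ⟩
    h c                                                      ∎
tcode-repT n t d c = trans
  (cong (combine (quotient {n} (#codes n t d) c)) (code-rep n t d (remainder {n} (#codes n t d) c)))
  (combine-remQuot {n} (#codes n t d) c)

-- Properties of forests that codes preserve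

data AnyPath {A : Set} (Q : A → List A → Set) : ∀ {d} → List A → Forest A d → Set where
  root  : ∀ {d ρ a f} {g : Forest A d} → Q a ρ → AnyPath Q ρ (node a g f)
  child : ∀ {d ρ a f} {g : Forest A d} → AnyPath Q (a ∷ ρ) g → AnyPath Q ρ (node a g f)
  next  : ∀ {d ρ a f} {g : Forest A d} → AnyPath Q ρ f → AnyPath Q ρ (node a g f)

anyPath? : ∀ {A : Set} {Q : A → List A → Set} → (∀ a ρ → Dec (Q a ρ)) →
           ∀ {d} ρ (f : Forest A d) → Dec (AnyPath Q ρ f)
anyPath? Q? ρ []           = no λ ()
anyPath? Q? ρ (node a g f) = map′
  (λ { (inj₁ q) → root q ; (inj₂ (inj₁ p)) → child p ; (inj₂ (inj₂ p)) → next p })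
  (λ { (root q) → inj₁ q ; (child p) → inj₂ (inj₁ p) ; (next p) → inj₂ (inj₂ p) })
  (Q? a ρ ⊎-dec (anyPath? Q? (a ∷ ρ) g ⊎-dec anyPath? Q? ρ f))

AnyPath-map⁺ : ∀ {A B : Set} {Q : A → List A → Set} {Q′ : B → List B → Set} (h : A → B) →
  (∀ {a ρ} → Q a ρ → Q′ (h a) (map h ρ)) →
  ∀ {d ρ} {f : Forest A d} → AnyPath Q ρ f → AnyPath Q′ (map h ρ) (mapF h f)
AnyPath-map⁺ h imp (root q)  = root (imp q)
AnyPath-map⁺ h imp (child p) = child (AnyPath-map⁺ h imp p)
AnyPath-map⁺ h imp (next p)  = next (AnyPath-map⁺ h imp p)

module _ {A : Set} {Q : A → List A → Set} where

  AnyPath⇒trees : ∀ {d ρ} {f : Forest A (suc d)} → AnyPath Q ρ f →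
    ∃[ a ] ∃[ g ] (a , g) ∈ trees f × (Q a ρ ⊎ AnyPath Q (a ∷ ρ) g)
  AnyPath⇒trees (root q)  = _ , _ , here refl , inj₁ q
  AnyPath⇒trees (child p) = _ , _ , here refl , inj₂ p
  AnyPath⇒trees (next p)  = let a , g , ∈f , r = AnyPath⇒trees p in a , g , there ∈f , r

  trees⇒AnyPath : ∀ {d ρ a g} (f : Forest A (suc d)) → (a , g) ∈ trees f → Q a ρ ⊎ AnyPath Q (a ∷ ρ) g → AnyPath Q ρ f
  trees⇒AnyPath (node a g f) (here refl) (inj₁ q) = root q
  trees⇒AnyPath (node a g f) (here refl) (inj₂ p) = child p
  trees⇒AnyPath (node a g f) (there ∈f)  r        = next (trees⇒AnyPath f ∈f r)

0<occ : ∀ {X : Set} {M} (k : X → Fin M) {x xs} → x ∈ xs → 0 < occ (k x) (map k xs)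
0<occ k {x} (here refl) rewrite hit-refl (k x) = z<s
0<occ k {x} {y ∷ _} (there x∈) = ≤-trans (0<occ k x∈) (m≤n+m _ (hit (k x) (k y)))

module _ {n : ℕ} {t : ℕ → ℕ} where

  occ-transfer : ∀ {d} {f g : Forest (Fin n) (suc d)} → code t f ≡ code t g → ∀ c {j} → j ≤ t d →
                 j ≤ occ c (map (tcode t) (trees f)) → j ≤ occ c (map (tcode t) (trees g))
  occ-transfer {d} {f} {g} eq c {j} j≤t j≤ = subst (λ l → j ≤ occ c l) (codes-trees t g)
    (≤-trans (⊓-glb j≤′ j≤t) (≤-trans (≤-reflexive (code⇒occ {t = t} {f = f} {h = λ c → occ c (codes t g)} eq c)) (m⊓n≤m _ _)))
    where
    j≤′ : j ≤ occ c (codes t f)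
    j≤′ = subst (λ l → j ≤ occ c l) (sym (codes-trees t f)) j≤

  -- A positive cap suffices: a tree code that occurs in `f` also occurs in `g`, and the path is
  -- continued below the tree found there. This settles the atoms, as each is witnessed on a single
  -- path.
  AnyPath-code : (∀ d → 0 < t d) → ∀ {d Q ρ} (f g : Forest (Fin n) d) → code t f ≡ code t g →
                 AnyPath Q ρ f → AnyPath Q ρ g
  AnyPath-code 0<t {suc d} {Q} {ρ} f g eq p
    with a , x , x∈ , r ← AnyPath⇒trees p
    with (b , y) , y∈ , eq′ ← occ-find (tcode t) (combine a (code t x)) (trees g)
           (occ-transfer {f = f} {g} eq _ (0<t d) (0<occ (tcode t) x∈))
    with refl , c≡ ← combine-injective b (code t y) a (code t x) eq′ =
    trees⇒AnyPath g y∈ ([ inj₁ , inj₂ ∘ AnyPath-code 0<t x y (sym c≡) ]′ r)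

total : ∀ {X : Set} → (X → ℕ) → List X → ℕ
total w []       = 0
total w (x ∷ xs) = w x + total w xs

total-insert : ∀ {X : Set} (w : X → ℕ) as {x bs} → total w (as ++ x ∷ bs) ≡ w x + total w (as ++ bs)
total-insert w []            = refl
total-insert w (a ∷ as) {x} {bs} = begin
  w a + total w (as ++ x ∷ bs)      ≡⟨ cong (w a +_) (total-insert w as) ⟩
  w a + (w x + total w (as ++ bs))  ≡⟨ +-assoc (w a) _ _ ⟨
  w a + w x + total w (as ++ bs)    ≡⟨ cong (_+ total w (as ++ bs)) (+-comm (w a) _) ⟩
  w x + w a + total w (as ++ bs)    ≡⟨ +-assoc (w x) _ _ ⟩
  w x + (w a + total w (as ++ bs))  ∎
  where open ≡-Reasoning

0<total⇒∈ : ∀ {X : Set} (w : X → ℕ) xs → 0 < total w xs → ∃[ x ] x ∈ xs × 0 < w x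
0<total⇒∈ w (x ∷ xs) pos with w x in eq
... | suc j = x , here refl , subst (0 <_) (sym eq) z<s
... | zero  = let y , y∈ , 0<wy = 0<total⇒∈ w xs pos in y , there y∈ , 0<wy

∈⇒≤total : ∀ {X : Set} (w : X → ℕ) {x xs} → x ∈ xs → w x ≤ total w xs
∈⇒≤total w (here refl)       = m≤m+n _ _
∈⇒≤total w (there {x = y} x∈) = ≤-trans (∈⇒≤total w x∈) (m≤n+m _ (w y))

module _ {X : Set} {M : ℕ} (k : X → Fin M) (w : X → ℕ)
         (inv : ∀ x y → k x ≡ k y → ∀ j → j ≤ 2 → j ≤ w x → j ≤ w y) where

  _≼[_]_ : List X → ℕ → List X → Set
  xs ≼[ i ] ys = ∀ c j → j ≤ i → j ≤ occ c (map k xs) → j ≤ occ c (map k ys)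

  total-transfer₁ : ∀ xs ys → xs ≼[ 1 ] ys → 1 ≤ total w xs → 1 ≤ total w ys
  total-transfer₁ xs ys le 1≤
    with x , x∈ , 0<wx ← 0<total⇒∈ w xs 1≤
    with y , y∈ , eq ← occ-find k (k x) ys (le (k x) 1 ≤-refl (0<occ k x∈)) =
    ≤-trans (inv x y (sym eq) 1 (s≤s z≤n) 0<wx) (∈⇒≤total w y∈)

  -- The weight 2 comes from one element or from two. In the second case `y`, the partner of `x`, is
  -- removed from `ys`; if the other element is in the class of `x`, the class has two occurrences,
  -- so that one is left for it.
  total-transfer₂ : ∀ xs ys → xs ≼[ 2 ] ys → 2 ≤ total w xs → 2 ≤ total w ys
  total-transfer₂ (x ∷ xs) ys le 2≤
    with y , y∈ , eq ← occ-find k (k x) ys (le (k x) 1 (s≤s z≤n) (0<occ k {x} {x ∷ xs} (here refl)))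
    with as , bs , refl ← ∈-∃++ y∈
    with w x in wx
  ... | zero = total-transfer₂ xs ys (λ c j j≤2 j≤ → le c j j≤2 (≤-trans j≤ (m≤n+m _ (hit c (k x))))) 2≤
  ... | suc (suc _) = ≤-trans (inv x y (sym eq) 2 ≤-refl (subst (2 ≤_) (sym wx) (s≤s (s≤s z≤n)))) (∈⇒≤total w y∈)
  ... | suc zero = subst (2 ≤_) (sym (total-insert w as))
        (+-mono-≤ (inv x y (sym eq) 1 (s≤s z≤n) (≤-reflexive (sym wx)))
                  (total-transfer₁ xs (as ++ bs) le′ (s≤s⁻¹ 2≤)))
    where
    le′ : xs ≼[ 1 ] (as ++ bs)
    le′ c zero    _ _  = z≤n
    le′ c (suc j) (s≤s z≤n) 1≤ with le c (hit c (k x) + 1)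
    ... | le″ rewrite occ-map-insert k c as {y} {bs} | eq =
      +-cancelˡ-≤ (hit c (k x)) _ _ (le″ (+-monoˡ-≤ 1 hit≤1) (+-monoʳ-≤ (hit c (k x)) 1≤))
      where
      hit≤1 : hit c (k x) ≤ 1
      hit≤1 with does (c ≟ᶠ k x)
      ... | true  = ≤-refl
      ... | false = z≤n

𝟙 : Bool → ℕ
𝟙 b = if b then 1 else 0

#nodes : ∀ {A : Set} {d} → (A → Bool) → Forest A d → ℕ
#nodes p []           = 0
#nodes p (node a g f) = 𝟙 (p a) + #nodes p g + #nodes p f

#nodesT : ∀ {A : Set} {d} → (A → Bool) → Tree A d → ℕ
#nodesT p (a , g) = 𝟙 (p a) + #nodes p g

#nodes-trees : ∀ {A : Set} {d} p (f : Forest A (suc d)) → #nodes p f ≡ total (#nodesT p) (trees f)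
#nodes-trees p []           = refl
#nodes-trees p (node a g f) = cong (_ +_) (#nodes-trees p f)

module _ {n : ℕ} {t : ℕ → ℕ} (2≤t : ∀ d → 2 ≤ t d) (p : Fin n → Bool) where

  -- The counts 0, 1 and at least 2 are told apart as no cap is below 2. Singleton marks are thus
  -- recognised, as element quantifiers require.
  #nodes-transfer : ∀ {d} (f g : Forest (Fin n) d) → code t f ≡ code t g →
                    ∀ j → j ≤ 2 → j ≤ #nodes p f → j ≤ #nodes p g
  #nodes-transfer {zero}  [] [] _ j _ j≤ = j≤
  #nodes-transfer {suc d} f g eq j j≤2 j≤
    rewrite #nodes-trees p f | #nodes-trees p g = by j j≤2 j≤
    where
    inv : ∀ (x y : Tree (Fin n) d) → tcode t x ≡ tcode t y → ∀ j → j ≤ 2 → j ≤ #nodesT p x → j ≤ #nodesT p y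
    inv (a , x) (b , y) eq′ j j≤2 j≤
      with refl , c≡ ← combine-injective a (code t x) b (code t y) eq′ with p a
    ... | false = #nodes-transfer x y c≡ j j≤2 j≤
    inv (a , x) (b , y) eq′ zero    j≤2 j≤ | true = z≤n
    inv (a , x) (b , y) eq′ (suc j) j≤2 j≤ | true =
      s≤s (#nodes-transfer x y c≡ j (≤-trans (n≤1+n j) j≤2) (s≤s⁻¹ j≤))
    le : ∀ c j → j ≤ 2 → j ≤ occ c (map (tcode t) (trees f)) → j ≤ occ c (map (tcode t) (trees g))
    le c j j≤2 = occ-transfer {f = f} {g} eq c (≤-trans j≤2 (2≤t d))
    by : ∀ j → j ≤ 2 → j ≤ total (#nodesT p) (trees f) → j ≤ total (#nodesT p) (trees g)
    by zero          _ _  = z≤n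
    by (suc zero)    _ j≤ = total-transfer₁ (tcode t) (#nodesT p) inv (trees f) (trees g)
                              (λ c j j≤1 → le c j (≤-trans j≤1 (s≤s z≤n))) j≤
    by (suc (suc zero)) _ j≤ = total-transfer₂ (tcode t) (#nodesT p) inv (trees f) (trees g) le j≤
    by (suc (suc (suc _))) (s≤s (s≤s ())) _

  #nodes≡1-transfer : ∀ {d} (f g : Forest (Fin n) d) → code t f ≡ code t g → #nodes p f ≡ 1 → #nodes p g ≡ 1
  #nodes≡1-transfer f g eq one = ≤-antisym
    (≮⇒≥ λ 2≤ → contradiction (subst (2 ≤_) one (#nodes-transfer g f (sym eq) 2 ≤-refl 2≤)) λ { (s≤s ()) })
    (#nodes-transfer f g eq 1 (s≤s z≤n) (≤-reflexive (sym one)))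

-- MSO on labelled forests


-- The default matters: in the atomic types, a position beyond the end of the path denotes the
-- labelled node itself, so that one set of positions fits paths of all lengths.
nth : ∀ {A : Set} → A → List A → ℕ → A
nth a []       i       = a
nth a (x ∷ xs) zero    = x
nth a (x ∷ xs) (suc i) = nth a xs i

nth-map : ∀ {A B : Set} (h : A → B) a xs i → nth (h a) (map h xs) i ≡ h (nth a xs i)
nth-map h a []       i       = refl
nth-map h a (x ∷ xs) zero    = refl
nth-map h a (x ∷ xs) (suc i) = nth-map h a xs i

∃vec? : ∀ k {n} {P : Vec (Fin n) k → Set} → (∀ v → Dec (P v)) → Dec (∃ P)
∃vec? zero    P? = map′ (λ p → [] , p) (λ { ([] , p) → p }) (P? [])
∃vec? (suc k) P? = map′ (λ { (x , v , p) → x ∷ v , p }) (λ { (x ∷ v , p) → x , v , p })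
                        (any? λ x → ∃vec? k λ v → P? (x ∷ v))

module _ {n : ℕ} where

  ∃mark? : ∀ {d} {P : Forest (Fin (n * 2)) d → Set} → (∀ f′ → Dec (P f′)) →
           (f : Forest (Fin n) d) → Dec (∃[ f′ ] erase n f′ ≡ f × P f′)
  ∃mark? P? [] = map′ (λ p → [] , refl , p) (λ { ([] , _ , p) → p }) (P? [])
  ∃mark? {P = P} P? (node a g f) = map′
    [ to false , to true ]′ from (with? false ⊎-dec with? true)
    where
    With : Bool → Set
    With b = ∃[ g′ ] erase n g′ ≡ g × (∃[ f′ ] erase n f′ ≡ f × P (node (mark a b) g′ f′))
    with? : ∀ b → Dec (With b)
    with? b = ∃mark? (λ g′ → ∃mark? (λ f′ → P? (node (mark a b) g′ f′)) f) g
    to : ∀ b → With b → ∃[ f′ ] erase n f′ ≡ node a g f × P f′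
    to b (g′ , refl , f′ , refl , p) =
      node (mark a b) g′ f′ , cong (λ z → node z (erase n g′) (erase n f′)) (unmark-mark a b) , p
    from : (∃[ f′ ] erase n f′ ≡ node a g f × P f′) → With false ⊎ With true
    from (node a′ g′ f′ , refl , p) with marked n a′ in eq
    ... | false = inj₁ (g′ , refl , f′ , refl , subst (λ z → P (node z g′ f′))
                    (sym (trans (cong (mark (unmark n a′)) (sym eq)) (mark-unmark n a′))) p)
    ... | true  = inj₂ (g′ , refl , f′ , refl , subst (λ z → P (node z g′ f′))
                    (sym (trans (cong (mark (unmark n a′)) (sym eq)) (mark-unmark n a′))) p)

  ∀mark? : ∀ {d} {P : Forest (Fin (n * 2)) d → Set} → (∀ f′ → Dec (P f′)) →
           (f : Forest (Fin n) d) → Dec (∀ f′ → erase n f′ ≡ f → P f′)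
  ∀mark? P? f with ∃mark? (λ f′ → ¬? (P? f′)) f
  ... | yes (f′ , eq , ¬p) = no λ h → ¬p (h f′ eq)
  ... | no  ¬∃             = yes λ f′ eq → decidable-stable (P? f′) λ ¬p → ¬∃ (f′ , eq , ¬p)

module _ (σ : Signature) (D : ℕ) where

  -- An atomic type tells which atoms hold of the nodes on a path that ends at the
  -- labelled node; the nodes are numbered from the end of the path.
  Atoms : Set
  Atoms = (R : Fin (symbols σ)) → Vec (Fin D) (arity σ R) → Bool

  -- An assignment is stored in the labels of the forest. A variable is therefore a predicate on
  -- labels: whether they carry its mark.
  record Meaning (k m n : ℕ) : Set where
    constructor ⟪_,_,_⟫
    field
      atoms : Fin n → Atoms
      elem  : Vec (Fin n → Bool) k
      set   : Vec (Fin n → Bool) m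
  open Meaning

  bindElem : ∀ {k m n} → Meaning k m n → Meaning (suc k) m (n * 2)
  bindElem {n = n} ⟪ A , E , S ⟫ =
    ⟪ A ∘ unmark n , marked n ∷ Vec.map (_∘ unmark n) E , Vec.map (_∘ unmark n) S ⟫

  bindSet : ∀ {k m n} → Meaning k m n → Meaning k (suc m) (n * 2)
  bindSet {n = n} ⟪ A , E , S ⟫ =
    ⟪ A ∘ unmark n , Vec.map (_∘ unmark n) E , marked n ∷ Vec.map (_∘ unmark n) S ⟫

  RelAt : ∀ {k m n} → Meaning k m n → (R : Fin (symbols σ)) → Vec (Fin k) (arity σ R) → Fin n → List (Fin n) → Set
  RelAt Γ R xs a ρ = ∃[ e ] T (atoms Γ a R e) ×
    (∀ i → T (lookup (elem Γ) (lookup xs i) (nth a (a ∷ ρ) (toℕ (lookup e i)))))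

  -- Quantifiers range over the markings of the forest; an element is a set with one node. Truth
  -- thus depends on the labelled forest and on the meaning of its labels only.
  FSat : ∀ {L k m n d} → Formula σ L k m → Forest (Fin n) d → Meaning k m n → Set
  FSat (rel R xs) f Γ = AnyPath (RelAt Γ R xs) [] f
  FSat (x ≐ y)  f Γ = AnyPath (λ a _ → T (lookup (elem Γ) x a) × T (lookup (elem Γ) y a)) [] f
  FSat (x ∈ˢ X) f Γ = AnyPath (λ a _ → T (lookup (elem Γ) x a) × T (lookup (set Γ) X a)) [] f
  FSat (¬ᶠ φ)   f Γ = ¬ FSat φ f Γ
  FSat (φ ∧ᶠ ψ) f Γ = FSat φ f Γ × FSat ψ f Γ
  FSat (φ ∨ᶠ ψ) f Γ = FSat φ f Γ ⊎ FSat ψ f Γ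
  FSat {n = n} (∃ᶠ φ) f Γ = ∃[ f′ ] erase n f′ ≡ f × #nodes (marked n) f′ ≡ 1 × FSat φ f′ (bindElem Γ)
  FSat {n = n} (∀ᶠ φ) f Γ = ∀ f′ → erase n f′ ≡ f → #nodes (marked n) f′ ≡ 1 → FSat φ f′ (bindElem Γ)
  FSat {n = n} (∃ˢ φ) f Γ = ∃[ f′ ] erase n f′ ≡ f × FSat φ f′ (bindSet Γ)
  FSat {n = n} (∀ˢ φ) f Γ = ∀ f′ → erase n f′ ≡ f → FSat φ f′ (bindSet Γ)

  fsat? : ∀ {L k m n d} (φ : Formula σ L k m) (f : Forest (Fin n) d) Γ → Dec (FSat φ f Γ)
  fsat? (rel R xs) f Γ = anyPath? (λ a ρ → ∃vec? (arity σ R) λ e → T? _ ×-dec all? λ i → T? _) [] f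
  fsat? (x ≐ y)  f Γ = anyPath? (λ a _ → T? _ ×-dec T? _) [] f
  fsat? (x ∈ˢ X) f Γ = anyPath? (λ a _ → T? _ ×-dec T? _) [] f
  fsat? (¬ᶠ φ)   f Γ = ¬? (fsat? φ f Γ)
  fsat? (φ ∧ᶠ ψ) f Γ = fsat? φ f Γ ×-dec fsat? ψ f Γ
  fsat? (φ ∨ᶠ ψ) f Γ = fsat? φ f Γ ⊎-dec fsat? ψ f Γ
  fsat? {n = n} (∃ᶠ φ) f Γ = ∃mark? (λ f′ → #nodes (marked n) f′ ≟ℕ 1 ×-dec fsat? φ f′ (bindElem Γ)) f
  fsat? {n = n} (∀ᶠ φ) f Γ = ∀mark? (λ f′ → #nodes (marked n) f′ ≟ℕ 1 →-dec fsat? φ f′ (bindElem Γ)) f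
  fsat? (∃ˢ φ) f Γ = ∃mark? (λ f′ → fsat? φ f′ (bindSet Γ)) f
  fsat? (∀ˢ φ) f Γ = ∀mark? (λ f′ → fsat? φ f′ (bindSet Γ)) f

-- thr q n bounds the counts of the codes that determine the theory of quantifier
-- rank q of a forest with n labels. The constant 2 makes it possible to recognise
-- the markings of a single node.
thr : ℕ → ℕ → ℕ → ℕ
thr zero    n d = 2
thr (suc q) n d = 2 + n * 2 * #codes (n * 2) (thr q (n * 2)) d * thr q (n * 2) d

thr-bounds : ∀ q n → Bounds (n * 2) (thr q (n * 2)) (thr (suc q) n)
thr-bounds q n d = n≤1+n _

2≤thr : ∀ q n d → 2 ≤ thr q n d
2≤thr zero    n d = ≤-refl
2≤thr (suc q) n d = s≤s (s≤s z≤n)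

module _ {σ : Signature} {D : ℕ} where

  -- Each quantifier spends one rank: `transfer` copies the marking and leaves equal codes for `q`.
  -- Negations and universal quantifiers use the hypothesis in the opposite direction.
  FSat-code : ∀ q {L k m n d} (φ : Formula σ L k m) → qr φ ≤ q → {f g : Forest (Fin n) d} (Γ : Meaning σ D k m n) →
              code (thr q n) f ≡ code (thr q n) g → FSat σ D φ f Γ → FSat σ D φ g Γ
  FSat-code q {n = n} (rel R xs) le {f} {g} Γ eq = AnyPath-code (λ d → <⇒≤ (2≤thr q n d)) f g eq
  FSat-code q {n = n} (x ≐ y)    le {f} {g} Γ eq = AnyPath-code (λ d → <⇒≤ (2≤thr q n d)) f g eq
  FSat-code q {n = n} (x ∈ˢ X)   le {f} {g} Γ eq = AnyPath-code (λ d → <⇒≤ (2≤thr q n d)) f g eq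
  FSat-code q (¬ᶠ φ) le Γ eq ¬s s = ¬s (FSat-code q φ le Γ (sym eq) s)
  FSat-code q (φ ∧ᶠ ψ) le Γ eq (s , s′) =
    FSat-code q φ (≤-trans (m≤m⊔n _ _) le) Γ eq s , FSat-code q ψ (≤-trans (m≤n⊔m (qr φ) _) le) Γ eq s′
  FSat-code q (φ ∨ᶠ ψ) le Γ eq (inj₁ s) = inj₁ (FSat-code q φ (≤-trans (m≤m⊔n _ _) le) Γ eq s)
  FSat-code q (φ ∨ᶠ ψ) le Γ eq (inj₂ s) = inj₂ (FSat-code q ψ (≤-trans (m≤n⊔m (qr φ) _) le) Γ eq s)
  FSat-code (suc q) {n = n} (∃ᶠ φ) (s≤s le) {f} {g} Γ eq (f′ , refl , one , s) =
    let g′ , e , eq′ = transfer (thr-bounds q n) f′ g eq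
    in g′ , e , #nodes≡1-transfer (2≤thr q (n * 2)) (marked n) f′ g′ (sym eq′) one
     , FSat-code q φ le (bindElem σ D Γ) (sym eq′) s
  FSat-code (suc q) {n = n} (∀ᶠ φ) (s≤s le) {f} {g} Γ eq h g′ refl one =
    let f′ , e , eq′ = transfer (thr-bounds q n) g′ f (sym eq)
    in FSat-code q φ le (bindElem σ D Γ) eq′
         (h f′ e (#nodes≡1-transfer (2≤thr q (n * 2)) (marked n) g′ f′ (sym eq′) one))
  FSat-code (suc q) {n = n} (∃ˢ φ) (s≤s le) {f} {g} Γ eq (f′ , refl , s) =
    let g′ , e , eq′ = transfer (thr-bounds q n) f′ g eq
    in g′ , e , FSat-code q φ le (bindSet σ D Γ) (sym eq′) s
  FSat-code (suc q) {n = n} (∀ˢ φ) (s≤s le) {f} {g} Γ eq h g′ refl =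
    let f′ , e , eq′ = transfer (thr-bounds q n) g′ f (sym eq)
    in FSat-code q φ le (bindSet σ D Γ) eq′ (h f′ e)

-- Tree-depth

module _ {n : ℕ} where

  x∈p-y⇒x≢y : ∀ {p : Subset n} {x y} → x ∈ₛ p - y → x ≢ y
  -- Removing an element lowers the size, but removing `y` a second time changes nothing.
  x∈p-y⇒x≢y {p} {x} {y} x∈ refl = contradiction (x∈p⇒∣p-x∣<∣p∣ x∈) (≤⇒≯ (≤-reflexive
    (cong ∣_∣ (sym (p─q─q≡p─q p ⁅ y ⁆)))))

  p-x⊆p : ∀ {p : Subset n} {x} → p - x ⊆ p
  p-x⊆p {p} {x} = p─q⊆p p ⁅ x ⁆

  -‿mono : ∀ {p q : Subset n} {x} → p ⊆ q → p - x ⊆ q - x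
  -‿mono p⊆q y∈ = x∈p∧x≢y⇒x∈p-y (p⊆q (p-x⊆p y∈)) (x∈p-y⇒x≢y y∈)

  ∣p∣≡1⇒≡ : ∀ {p : Subset n} {x y} → ∣ p ∣ ≡ 1 → x ∈ₛ p → y ∈ₛ p → y ≡ x
  ∣p∣≡1⇒≡ {p} {x} {y} ∣p∣≡1 x∈p y∈p with y ≟ᶠ x
  ... | yes y≡x = y≡x
  ... | no  y≢x = contradiction (≤-<-trans 1≤ (x∈p⇒∣p-x∣<∣p∣ x∈p)) (≤⇒≯ (≤-reflexive ∣p∣≡1))
    where
    1≤ : 1 ≤ ∣ p - x ∣
    1≤ = subst (_≤ ∣ p - x ∣) (∣⁅x⁆∣≡1 y) (p⊆q⇒∣p∣≤∣q∣ λ z∈ →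
           subst (_∈ₛ p - x) (sym (x∈⁅y⁆⇒x≡y y z∈)) (x∈p∧x≢y⇒x∈p-y y∈p y≢x))

module _ {n : ℕ} (G : Graph n) where
  open Graph G

  -- Abstract, so that the implicit arguments S and x can be inferred from comp S x.
  abstract
    comp : Subset n → Fin n → Subset n
    comp = component G

    ∈comp : ∀ S x y → y ∈ₛ comp S x ⇔ Walk G S x y
    ∈comp = ∈-component G

  ∈comp⁺ : ∀ {S x y} → Walk G S x y → y ∈ₛ comp S x
  ∈comp⁺ {S} {x} {y} = Equivalence.from (∈comp S x y)

  ∈comp⁻ : ∀ {S x y} → y ∈ₛ comp S x → Walk G S x y
  ∈comp⁻ {S} {x} {y} = Equivalence.to (∈comp S x y)

  edge-mono : ∀ {S S′} → S ⊆ S′ → ∀ {x y} → Edge G S x y → Edge G S′ x y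
  edge-mono S⊆S′ (x∈ , y∈ , a) = S⊆S′ x∈ , S⊆S′ y∈ , a

  walk-mono : ∀ {S S′} → S ⊆ S′ → ∀ {x y} → Walk G S x y → Walk G S′ x y
  walk-mono S⊆S′ = Star-map (edge-mono S⊆S′)

  edge-sym : ∀ {S x y} → Edge G S x y → Edge G S y x
  edge-sym (x∈ , y∈ , a) = y∈ , x∈ , symm a

  walk-sym : ∀ {S x y} → Walk G S x y → Walk G S y x
  walk-sym = reverse edge-sym

  walk-∈ : ∀ {S x y} → x ∈ₛ S → Walk G S x y → y ∈ₛ S
  walk-∈ x∈S ε                   = x∈S
  walk-∈ _   ((_ , z∈S , _) ◅ w) = walk-∈ z∈S w

  comp⊆ : ∀ {S x} → x ∈ₛ S → comp S x ⊆ S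
  comp⊆ x∈S y∈ = walk-∈ x∈S (∈comp⁻ y∈)

  walk-comp : ∀ {S x y} → Walk G S x y → Walk G (comp S x) x y
  walk-comp {S} {x} = go ε
    where
    go : ∀ {u y} → Walk G S x u → Walk G S u y → Walk G (comp S x) u y
    go v ε       = ε
    go v (e@(_ , _ , a) ◅ w) = (∈comp⁺ v , ∈comp⁺ (v ◅◅ (e ◅ ε)) , a) ◅ go (v ◅◅ (e ◅ ε)) w

  -- Low d S says that every component of G[S] has an elimination tree with at
  -- most d levels; Low 0 S, that S is empty.
  Low : ℕ → Subset n → Set
  Low zero    S = ∀ x → x ∉ₛ S
  Low (suc d) S = ∀ x → x ∈ₛ S → ∃[ r ] r ∈ₛ comp S x × Low d (comp S x - r)

  low-∅ : ∀ d {S} → (∀ x → x ∉ₛ S) → Low d S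
  low-∅ zero    empty      = empty
  low-∅ (suc d) empty x x∈ = contradiction x∈ (empty x)

  -- If the old root is missing from the smaller component, any vertex may become its root, here
  -- `x`: the component lies within the old one minus the old root.
  low-⊆ : ∀ d {S S′} → S′ ⊆ S → Low d S → Low d S′
  low-⊆ zero    S′⊆S low x x∈ = low x (S′⊆S x∈)
  low-⊆ (suc d) {S} {S′} S′⊆S low x x∈ with r , r∈ , lowr ← low x (S′⊆S x∈) | r ∈ₛ? comp S′ x
  ... | yes r∈′ = r , r∈′ , low-⊆ d (-‿mono λ y∈ → ∈comp⁺ (walk-mono S′⊆S (∈comp⁻ y∈))) lowr
  ... | no  r∉′ = x , ∈comp⁺ ε , low-⊆ d (λ y∈ → x∈p∧x≢y⇒x∈p-y
          (∈comp⁺ (walk-mono S′⊆S (∈comp⁻ (p-x⊆p y∈)))) λ { refl → r∉′ (p-x⊆p y∈) }) lowr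

  -- Induction on the derivation. A connected set has one root for all `x`; in a disconnected one,
  -- the root found within the component of `x` serves, as walks from `x` stay in that component.
  treeDepth⇒low : ∀ {S k d} → TreeDepth G S k → k ≤ d → Low d S
  treeDepth⇒low {d = suc d} (singleton ∣S∣≡1) _ x x∈ =
    x , ∈comp⁺ ε , low-∅ d λ y y∈ → x∈p-y⇒x≢y y∈ (∣p∣≡1⇒≡ ∣S∣≡1 x∈ (comp⊆ x∈ (p-x⊆p y∈)))
  treeDepth⇒low {d = suc d} (connected _ conn (r , r∈ , t) _) (s≤s k≤d) x x∈ =
    r , ∈comp⁺ (conn x r x∈ r∈) , low-⊆ d (-‿mono (comp⊆ x∈)) (treeDepth⇒low t k≤d)
  -- Impossible: the component of `x` would have tree-depth 0 and hence be empty.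
  treeDepth⇒low {S} {d = zero} (disconnected _ _ bound) k≤d x x∈
    with j , j≤k , t ← bound (comp S x) (x , x∈ , ∈comp S x) =
    treeDepth⇒low t (≤-trans j≤k k≤d) x (∈comp⁺ ε)
  treeDepth⇒low {S} {d = suc d} (disconnected _ _ bound) k≤d x x∈
    with j , j≤k , t ← bound (comp S x) (x , x∈ , ∈comp S x)
    with r , r∈ , low ← treeDepth⇒low {d = suc d} t (≤-trans j≤k k≤d) x (∈comp⁺ ε) =
    r , ∈comp⁺ (walk-mono (comp⊆ x∈) (∈comp⁻ r∈)) , low-⊆ d (-‿mono λ y∈ → ∈comp⁺ (walk-comp (∈comp⁻ y∈))) low

  -- Recursion on the length bound, in step with the formula `walkF` that expresses it.
  BoundedWalk : Subset n → ℕ → Fin n → Fin n → Set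
  BoundedWalk S zero    x y = x ≡ y
  BoundedWalk S (suc l) x y = x ≡ y ⊎ ∃[ z ] Edge G S x z × BoundedWalk S l z y

  boundedWalk⇒walk : ∀ {S} l {x y} → BoundedWalk S l x y → Walk G S x y
  boundedWalk⇒walk zero    refl               = ε
  boundedWalk⇒walk (suc l) (inj₁ refl)        = ε
  boundedWalk⇒walk (suc l) (inj₂ (z , e , w)) = e ◅ boundedWalk⇒walk l w

  boundedWalk-≤ : ∀ {S l l′ x y} → l ≤ l′ → BoundedWalk S l x y → BoundedWalk S l′ x y
  boundedWalk-≤ {l = zero} {zero}   _ w = w
  boundedWalk-≤ {l = zero} {suc l′} _ w = inj₁ w
  boundedWalk-≤ {l = suc l} (s≤s le) (inj₁ eq)          = inj₁ eq
  boundedWalk-≤ {l = suc l} (s≤s le) (inj₂ (z , e , w)) = inj₂ (z , e , boundedWalk-≤ le w)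

  boundedWalk-⊆ : ∀ {S S′} → S ⊆ S′ → ∀ l {x y} → BoundedWalk S l x y → BoundedWalk S′ l x y
  boundedWalk-⊆ sub zero    w                  = w
  boundedWalk-⊆ sub (suc l) (inj₁ eq)          = inj₁ eq
  boundedWalk-⊆ sub (suc l) (inj₂ (z , e , w)) = inj₂ (z , edge-mono sub e , boundedWalk-⊆ sub l w)

  boundedWalk-++ : ∀ {S} l {l′ x y z} → BoundedWalk S l x y → BoundedWalk S l′ y z → BoundedWalk S (l + l′) x z
  boundedWalk-++ zero    refl               w′ = w′
  boundedWalk-++ (suc l) {l′} (inj₁ refl)   w′ = boundedWalk-≤ (m≤n+m l′ (suc l)) w′
  boundedWalk-++ (suc l) (inj₂ (z , e , w)) w′ = inj₂ (z , e , boundedWalk-++ l w w′)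

  Near : Subset n → Fin n → Fin n → Set
  Near S r u = u ≡ r ⊎ ∃[ z ] Walk G (S - r) u z × Edge G S z r

  -- The stretches of a walk before its first and after its last visit to `r` avoid `r`, apart from
  -- one edge each.
  split : ∀ {S x y} r → Walk G S x y → Walk G (S - r) x y ⊎ (Near S r x × Near S r y)
  split r ε = inj₁ ε
  split {S} {x} r (_◅_ {j = w} e@(x∈ , w∈ , a) ws) with x ≟ᶠ r | w ≟ᶠ r | split r ws
  ... | yes x≡r  | _        | inj₂ (_ , ny) = inj₂ (inj₁ x≡r , ny)
  ... | yes refl | _        | inj₁ ws′      = inj₂ (inj₁ refl , inj₂ (w , walk-sym ws′ , edge-sym e))
  ... | no  _    | yes refl | inj₂ (_ , ny) = inj₂ (inj₂ (x , ε , e) , ny)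
  ... | no  _    | yes refl | inj₁ ε        = inj₂ (inj₂ (x , ε , e) , inj₁ refl)
  ... | no  _    | yes refl | inj₁ ((r∈ , _) ◅ _) = contradiction refl (x∈p-y⇒x≢y r∈)
  ... | no  x≢r  | no w≢r   | inj₁ ws′      =
        inj₁ ((x∈p∧x≢y⇒x∈p-y x∈ x≢r , x∈p∧x≢y⇒x∈p-y w∈ w≢r , a) ◅ ws′)
  ... | no  x≢r  | no w≢r   | inj₂ (inj₁ w≡r , _) = contradiction w≡r w≢r
  ... | no  x≢r  | no w≢r   | inj₂ (inj₂ (z , v , e′) , ny) =
        inj₂ (inj₂ (z , (x∈p∧x≢y⇒x∈p-y x∈ x≢r , x∈p∧x≢y⇒x∈p-y w∈ w≢r , a) ◅ v , e′) , ny)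

-- In a graph of tree-depth d, every walk can be shortened to one of length
-- walkBound d: outside its root, a component has walks of length walkBound (d - 1).
walkBound : ℕ → ℕ
walkBound zero    = 0
walkBound (suc d) = suc (walkBound d) + suc (walkBound d)

module _ {n : ℕ} (G : Graph n) where

  walk⇒boundedWalk : ∀ d {S x y} → Low G d S → Walk G S x y → BoundedWalk G S (walkBound d) x y
  walk⇒boundedWalk zero    low ε                  = refl
  walk⇒boundedWalk zero    low ((x∈ , _) ◅ _)     = contradiction x∈ (low _)
  walk⇒boundedWalk (suc d) low ε                  = inj₁ refl
  walk⇒boundedWalk (suc d) {S} {x} {y} low w@((x∈ , _) ◅ _) with r , r∈ , low′ ← low x x∈ =
    boundedWalk-⊆ G (comp⊆ G x∈) (walkBound (suc d)) (by (split G r (walk-comp G w)))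
    where
    K = comp G S x
    l = walkBound d
    toRoot : ∀ {u} → Near G K r u → BoundedWalk G K (suc l) u r
    toRoot     (inj₁ refl) = inj₁ refl
    toRoot {u} (inj₂ (z , v , e)) = subst (λ j → BoundedWalk G K j u r) (+-comm l 1)
      (boundedWalk-++ G l (boundedWalk-⊆ G p-x⊆p l (walk⇒boundedWalk d low′ v)) (inj₂ (r , e , refl)))
    fromRoot : ∀ {u} → Near G K r u → BoundedWalk G K (suc l) r u
    fromRoot (inj₁ refl) = inj₁ refl
    fromRoot (inj₂ (z , v , e)) =
      inj₂ (z , edge-sym G e , boundedWalk-⊆ G p-x⊆p l (walk⇒boundedWalk d low′ (walk-sym G v)))
    by : Walk G (K - r) x y ⊎ (Near G K r x × Near G K r y) → BoundedWalk G K (suc l + suc l) x y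
    by (inj₁ v)         = boundedWalk-≤ G (≤-trans (n≤1+n l) (m≤m+n (suc l) (suc l)))
                            (boundedWalk-⊆ G p-x⊆p l (walk⇒boundedWalk d low′ v))
    by (inj₂ (nx , ny)) = boundedWalk-++ G (suc l) (toRoot nx) (fromRoot ny)

-- Elimination forests of structures

x∈p─q⇒x∉q : ∀ {n} (p q : Subset n) {x} → x ∈ₛ p ─ q → x ∉ₛ q
x∈p─q⇒x∉q (_ ∷ p) (true ∷ q) {zero} () Vec.here
x∈p─q⇒x∉q (_ ∷ p) (_ ∷ q) {suc x} (Vec.there x∈) (Vec.there x∈q) = x∈p─q⇒x∉q p q x∈ x∈q

T-does : ∀ {P : Set} (P? : Dec P) → T (does P?) ⇔ P
T-does (yes p) = mk⇔ (λ _ → p) _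
T-does (no ¬p) = mk⇔ (λ ()) ¬p

#nodes-mapF : ∀ {A B : Set} (p : B → Bool) (h : A → B) {d} (f : Forest A d) → #nodes p (mapF h f) ≡ #nodes (p ∘ h) f
#nodes-mapF p h []           = refl
#nodes-mapF p h (node a g f) = cong₂ (λ i j → 𝟙 (p (h a)) + i + j) (#nodes-mapF p h g) (#nodes-mapF p h f)

#nodes-cong : ∀ {A : Set} {p q : A → Bool} → p ≗ q → ∀ {d} (f : Forest A d) → #nodes p f ≡ #nodes q f
#nodes-cong eq []           = refl
#nodes-cong eq (node a g f) = cong₂ _+_ (cong₂ _+_ (cong 𝟙 (eq a)) (#nodes-cong eq g)) (#nodes-cong eq f)

AnyPath-map⁻ : ∀ {A B : Set} {Q : B → List B → Set} (h : A → B) {d ρ} (f : Forest A d) →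
  AnyPath Q (map h ρ) (mapF h f) → AnyPath (λ a ρ → Q (h a) (map h ρ)) ρ f
AnyPath-map⁻ h (node a g f) (root q)  = root q
AnyPath-map⁻ h (node a g f) (child p) = child (AnyPath-map⁻ h g p)
AnyPath-map⁻ h (node a g f) (next p)  = next (AnyPath-map⁻ h f p)

nth-∈ : ∀ {A : Set} (a : A) {x xs} → x ∈ xs → ∃[ i ] i < length xs × nth a xs i ≡ x
nth-∈ a (here refl) = 0 , z<s , refl
nth-∈ a (there x∈)  = let i , i< , eq = nth-∈ a x∈ in suc i , s≤s i< , eq

node-injective : ∀ {A : Set} {d} {a a′ : A} {g g′ : Forest A d} {f f′} →
                 node a g f ≡ node a′ g′ f′ → a ≡ a′ × g ≡ g′ × f ≡ f′
node-injective refl = refl , refl , refl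
node-cong : ∀ {A : Set} {d} {a a′ : A} {g g′ : Forest A d} {f f′} →
            a ≡ a′ → g ≡ g′ → f ≡ f′ → node a g f ≡ node a′ g′ f′
node-cong refl refl refl = refl

module _ {σ : Signature} (𝔄 : Structure σ) {D ℓ : ℕ} (dec : Fin ℓ → Atoms σ D) where
  open Structure 𝔄
  private
    G = gaifman 𝔄
    V = Universe
  open Graph G using (Adj; symm)

  Labels : Fin ℓ → V → List V → Set
  Labels c v ρ = ∀ R e → dec c R e ≡ interp R (Vec.map (λ i → nth v (v ∷ ρ) (toℕ i)) e)

  Node : Set
  Node = V × Fin ℓ

  -- An elimination forest of 𝔄[S] below the path ρ; K is the union of some
  -- components of 𝔄[S].
  data Elim : ∀ {d} → List V → Subset (suc order) → Forest Node d → Set where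
    empty : ∀ {d ρ S} → (∀ x → x ∉ₛ S) → Elim {d} ρ S []
    tree  : ∀ {d ρ S r c f} {g : Forest Node d} K → r ∈ₛ K → K ⊆ S →
            (∀ {x y} → x ∈ₛ K → y ∈ₛ S → Adj x y → y ∈ₛ K) → Labels c r ρ →
            Elim (r ∷ ρ) (K - r) g → Elim ρ (S ─ K) f → Elim ρ S (node (r , c) g f)

  private variable
    d : ℕ
    S : Subset (suc order)
    ρ : List V

  mapF-agree : ∀ {B : Set} {f : Forest Node d} → Elim ρ S f → (h h′ : Node → B) →
               (∀ v c → v ∈ₛ S → h (v , c) ≡ h′ (v , c)) → mapF h f ≡ mapF h′ f
  mapF-agree (empty _) h h′ agree = refl
  mapF-agree {S = S} (tree {r = r} {c} K r∈ K⊆ _ _ eg ef) h h′ agree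
    rewrite agree r c (K⊆ r∈) = cong₂ (node _)
      (mapF-agree eg h h′ (λ v c v∈ → agree v c (K⊆ (p-x⊆p v∈))))
      (mapF-agree ef h h′ (λ v c v∈ → agree v c (p─q⊆p S K v∈)))

  -- Root, children and following trees use disjoint sets of vertices, so their marks combine to one
  -- function `s`. Every marking of the forest thus comes from a set of vertices.
  realise : ∀ {n} {f : Forest Node d} → Elim ρ S f → (lab : Node → Fin n) (f′ : Forest (Fin (n * 2)) d) →
            erase n f′ ≡ mapF lab f → Σ[ s ∈ (V → Bool) ] mapF (λ w → mark (lab w) (s (proj₁ w))) f ≡ f′
  realise (empty _) lab [] eq = (λ _ → false) , refl
  realise {n = n} (tree {S = S} {r} {c} {f} {g} K r∈ K⊆ _ _ eg ef) lab (node a′ g′ f′) eq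
    with ea , eg′ , ef′ ← node-injective eq
    with s₁ , eq₁ ← realise eg lab g′ eg′ | s₂ , eq₂ ← realise ef lab f′ ef′ =
    s , node-cong
      (trans (cong₂ mark (sym ea) s-r) (mark-unmark n a′))
      (trans (mapF-agree eg _ _ λ v c v∈ → cong (mark (lab (v , c))) (s-g v v∈)) eq₁)
      (trans (mapF-agree ef _ _ λ v c v∈ → cong (mark (lab (v , c))) (s-f v v∈)) eq₂)
    where
    s : V → Bool
    s v = if does (v ≟ᶠ r) then marked n a′ else if does (v ∈ₛ? K) then s₁ v else s₂ v
    s-r : s r ≡ marked n a′
    s-r rewrite dec-true (r ≟ᶠ r) refl = refl
    s-g : ∀ v → v ∈ₛ K - r → s v ≡ s₁ v
    s-g v v∈ rewrite dec-false (v ≟ᶠ r) (x∈p-y⇒x≢y v∈) | dec-true (v ∈ₛ? K) (p-x⊆p v∈) = refl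
    s-f : ∀ v → v ∈ₛ S ─ K → s v ≡ s₂ v
    s-f v v∈ rewrite dec-false (v ≟ᶠ r) (λ { refl → x∈p─q⇒x∉q S K v∈ r∈ })
                   | dec-false (v ∈ₛ? K) (x∈p─q⇒x∉q S K v∈) = refl

  module _ (p : V → Bool) where

    #nodes≡0 : ∀ {f : Forest Node d} → Elim ρ S f → (∀ v → v ∈ₛ S → ¬ T (p v)) → #nodes (p ∘ proj₁) f ≡ 0
    #nodes≡0 (empty _) none = refl
    #nodes≡0 (tree {S = S} {r = r} K r∈ K⊆ _ _ eg ef) none with p r in eq
    ... | true  = contradiction (subst T (sym eq) _) (none r (K⊆ r∈))
    ... | false rewrite #nodes≡0 eg (λ v v∈ → none v (K⊆ (p-x⊆p v∈))) =
                  #nodes≡0 ef (λ v v∈ → none v (p─q⊆p S K v∈))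

    -- A vertex is carried by a single node, and the parts of the forest that avoid it contribute 0.
    -- With the converse `#nodes≡1⇒`, the markings of one node are exactly the elements.
    #nodes≡1 : ∀ {f : Forest Node d} → Elim ρ S f → ∀ a → a ∈ₛ S → (∀ v → v ∈ₛ S → T (p v) ⇔ v ≡ a) →
               #nodes (p ∘ proj₁) f ≡ 1
    #nodes≡1 (empty none) a a∈ only = contradiction a∈ (none a)
    #nodes≡1 (tree {S = S} {r = r} K r∈ K⊆ _ _ eg ef) a a∈ only with a ≟ᶠ r
    ... | yes refl
      rewrite #nodes≡0 eg (λ v v∈ t → x∈p-y⇒x≢y v∈ (Equivalence.to (only v (K⊆ (p-x⊆p v∈))) t))
            | #nodes≡0 ef (λ v v∈ t → x∈p─q⇒x∉q S K v∈ (subst (_∈ₛ K) (sym (Equivalence.to (only v (p─q⊆p S K v∈)) t)) r∈))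
      with p r | Equivalence.from (only r a∈) refl
    ... | true | _ = refl
    #nodes≡1 (tree {S = S} {r = r} K r∈ K⊆ _ _ eg ef) a a∈ only | no a≢r with p r in eq
    ... | true = contradiction (sym (Equivalence.to (only r (K⊆ r∈)) (subst T (sym eq) _))) a≢r
    ... | false with a ∈ₛ? K
    ...   | yes a∈K rewrite #nodes≡0 ef (λ v v∈ t → x∈p─q⇒x∉q S K v∈ (subst (_∈ₛ K) (sym (Equivalence.to (only v (p─q⊆p S K v∈)) t)) a∈K)) =
              trans (+-identityʳ _) (#nodes≡1 eg a (x∈p∧x≢y⇒x∈p-y a∈K a≢r) (λ v v∈ → only v (K⊆ (p-x⊆p v∈))))
    ...   | no  a∉K rewrite #nodes≡0 eg (λ v v∈ t → a∉K (subst (_∈ₛ K) (Equivalence.to (only v (K⊆ (p-x⊆p v∈))) t) (p-x⊆p v∈))) =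
              #nodes≡1 ef a (x∈p∧x∉q⇒x∈p─q a∈ a∉K) (λ v v∈ → only v (p─q⊆p S K v∈))

    #nodes≡0⇒ : ∀ {f : Forest Node d} → Elim ρ S f → #nodes (p ∘ proj₁) f ≡ 0 → ∀ v → v ∈ₛ S → ¬ T (p v)
    #nodes≡0⇒ (empty none) eq v v∈ t = none v v∈
    #nodes≡0⇒ (tree {S = S} {r = r} {g = g} K r∈ K⊆ _ _ eg ef) eq v v∈ t with v ≟ᶠ r | v ∈ₛ? K
    ... | no v≢r | yes v∈K = #nodes≡0⇒ eg (m+n≡0⇒n≡0 (𝟙 (p r)) (m+n≡0⇒m≡0 _ eq)) v (x∈p∧x≢y⇒x∈p-y v∈K v≢r) t
    ... | no v≢r | no  v∉K = #nodes≡0⇒ ef (m+n≡0⇒n≡0 (𝟙 (p r) + #nodes _ g) eq) v (x∈p∧x∉q⇒x∈p─q v∈ v∉K) t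
    ... | yes refl | _ with p r
    ...   | true with () ← eq

    #nodes≡1⇒ : ∀ {f : Forest Node d} → Elim ρ S f → #nodes (p ∘ proj₁) f ≡ 1 →
                ∃[ a ] a ∈ₛ S × (∀ v → v ∈ₛ S → T (p v) ⇔ v ≡ a)
    #nodes≡1⇒ (tree {S = S} {r = r} {f = f} {g = g} K r∈ K⊆ _ _ eg ef) eq with p r in eqr
    ... | true = r , K⊆ r∈ , λ v v∈ → mk⇔ (to v v∈) λ { refl → subst T (sym eqr) _ }
      where
      to : ∀ v → v ∈ₛ S → T (p v) → v ≡ r
      to v v∈ t with v ≟ᶠ r | v ∈ₛ? K
      ... | yes v≡r | _ = v≡r
      ... | no v≢r | yes v∈K = contradiction t (#nodes≡0⇒ eg (m+n≡0⇒m≡0 _ (suc-injective eq)) v (x∈p∧x≢y⇒x∈p-y v∈K v≢r))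
      ... | no v≢r | no  v∉K = contradiction t (#nodes≡0⇒ ef (m+n≡0⇒n≡0 (#nodes _ g) (suc-injective eq)) v (x∈p∧x∉q⇒x∈p─q v∈ v∉K))
    ... | false with #nodes (p ∘ proj₁) g in eqg
    ...   | zero = let a , a∈ , only = #nodes≡1⇒ ef eq in
              a , p─q⊆p S K a∈ , λ v v∈ → mk⇔ (to a only v v∈) λ { refl → Equivalence.from (only v a∈) refl }
      where
      to : ∀ a → (∀ v → v ∈ₛ S ─ K → T (p v) ⇔ v ≡ a) → ∀ v → v ∈ₛ S → T (p v) → v ≡ a
      to a only v v∈ t with v ≟ᶠ r | v ∈ₛ? K
      ... | yes refl | _ = ⊥-elim (subst T eqr t)
      ... | no v≢r | yes v∈K = contradiction t (#nodes≡0⇒ eg eqg v (x∈p∧x≢y⇒x∈p-y v∈K v≢r))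
      ... | no v≢r | no  v∉K = Equivalence.to (only v (x∈p∧x∉q⇒x∈p─q v∈ v∉K)) t
    ...   | suc zero = let a , a∈ , only = #nodes≡1⇒ eg eqg in
              a , K⊆ (p-x⊆p a∈) , λ v v∈ → mk⇔ (to a only v v∈) λ { refl → Equivalence.from (only v a∈) refl }
      where
      to : ∀ a → (∀ v → v ∈ₛ K - r → T (p v) ⇔ v ≡ a) → ∀ v → v ∈ₛ S → T (p v) → v ≡ a
      to a only v v∈ t with v ≟ᶠ r | v ∈ₛ? K
      ... | yes refl | _ = ⊥-elim (subst T eqr t)
      ... | no v≢r | yes v∈K = Equivalence.to (only v (x∈p∧x≢y⇒x∈p-y v∈K v≢r)) t
      ... | no v≢r | no  v∉K = contradiction t (#nodes≡0⇒ ef (suc-injective eq) v (x∈p∧x∉q⇒x∈p─q v∈ v∉K))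

  module _ {X : V → Set} (X? : ∀ v → Dec (X v)) (clique : ∀ {x y} → X x → X y → x ≡ y ⊎ Adj x y) where

    -- Adjacent elements of `S` are never separated by `K`, so a single tree contains all of the
    -- clique that is still below the path. The descent stops at a root that is the last such
    -- element; all the others are then above it.
    clique⇒path : ∀ {f : Forest Node d} {ρ′ : List Node} → Elim ρ S f → length ρ′ + d ≤ D →
      (∀ x → X x → x ∈ₛ S ⊎ x ∈ map proj₁ ρ′) → ∀ x₀ → X x₀ → x₀ ∈ₛ S →
      AnyPath (λ w ρ″ → X (proj₁ w) × length (w ∷ ρ″) ≤ D × (∀ x → X x → x ∈ map proj₁ (w ∷ ρ″))) ρ′ f
    clique⇒path (empty none) _ _ x₀ _ x₀∈ = contradiction x₀∈ (none x₀)
    clique⇒path {ρ′ = ρ′} (tree {d = d} {S = S} {r} {c} K r∈ K⊆ closed _ eg ef) len cover x₀ Xx₀ x₀∈ with x₀ ∈ₛ? K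
    ... | no x₀∉K = next (clique⇒path ef len cover′ x₀ Xx₀ (x∈p∧x∉q⇒x∈p─q x₀∈ x₀∉K))
      where
      cover′ : ∀ x → X x → x ∈ₛ S ─ K ⊎ x ∈ map proj₁ ρ′
      cover′ x Xx with cover x Xx | x ∈ₛ? K
      ... | inj₂ x∈ρ | _ = inj₂ x∈ρ
      ... | inj₁ x∈S | no  x∉K = inj₁ (x∈p∧x∉q⇒x∈p─q x∈S x∉K)
      ... | inj₁ x∈S | yes x∈K with clique Xx Xx₀
      ...   | inj₁ refl = contradiction x∈K x₀∉K
      ...   | inj₂ adj  = contradiction (closed x∈K x₀∈ adj) x₀∉K
    ... | yes x₀∈K with any? (λ x → X? x ×-dec x ∈ₛ? S ×-dec ¬? (x ≟ᶠ r))
    ...   | no ¬∃ = root (Xr , ≤-trans (s≤s (m≤m+n (length ρ′) d)) (≤-trans (≤-reflexive (sym (+-suc _ d))) len) , cover′)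
      where
      Xr : X r
      Xr with x₀ ≟ᶠ r
      ... | yes refl = Xx₀
      ... | no x₀≢r  = contradiction (x₀ , Xx₀ , x₀∈ , x₀≢r) ¬∃
      cover′ : ∀ x → X x → x ∈ r ∷ map proj₁ ρ′
      cover′ x Xx with cover x Xx | x ≟ᶠ r
      ... | _        | yes refl = here refl
      ... | inj₂ x∈ρ | no _     = there x∈ρ
      ... | inj₁ x∈S | no x≢r   = contradiction (x , Xx , x∈S , x≢r) ¬∃
    ...   | yes (x₁ , Xx₁ , x₁∈S , x₁≢r) =
      child (clique⇒path eg (≤-trans (≤-reflexive (sym (+-suc _ d))) len) cover′ x₁ Xx₁ (x∈p∧x≢y⇒x∈p-y (inK x₁ Xx₁ x₁∈S) x₁≢r))
      where
      inK : ∀ x → X x → x ∈ₛ S → x ∈ₛ K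
      inK x Xx x∈S with clique Xx₀ Xx
      ... | inj₁ refl = x₀∈K
      ... | inj₂ adj  = closed x₀∈K x∈S adj
      cover′ : ∀ x → X x → x ∈ₛ K - r ⊎ x ∈ r ∷ map proj₁ ρ′
      cover′ x Xx with cover x Xx | x ≟ᶠ r
      ... | _        | yes refl = inj₂ (here refl)
      ... | inj₂ x∈ρ | no _     = inj₂ (there x∈ρ)
      ... | inj₁ x∈S | no x≢r   = inj₁ (x∈p∧x≢y⇒x∈p-y (inK x Xx x∈S) x≢r)

  path-witness : ∀ {Q : Node → List Node → Set} {f : Forest Node d} {ρ′} → Elim (map proj₁ ρ′) S f → AnyPath Q ρ′ f →
    ∃[ w ] ∃[ ρ″ ] Q w ρ″ × Labels (proj₂ w) (proj₁ w) (map proj₁ ρ″)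
  path-witness (tree _ _ _ _ lbl _ _)  (root q)  = _ , _ , q , lbl
  path-witness (tree _ _ _ _ _ eg _)   (child p) = path-witness eg p
  path-witness (tree _ _ _ _ _ _ ef)   (next p)  = path-witness ef p

  strengthen : ∀ {Q : Node → List Node → Set} {f : Forest Node d} {ρ′} → Elim (map proj₁ ρ′) S f → AnyPath Q ρ′ f →
    AnyPath (λ w ρ″ → Q w ρ″ × Labels (proj₂ w) (proj₁ w) (map proj₁ ρ″)) ρ′ f
  strengthen (tree _ _ _ _ lbl _ _)  (root q)  = root (q , lbl)
  strengthen (tree _ _ _ _ _ eg _)   (child p) = child (strengthen eg p)
  strengthen (tree _ _ _ _ _ _ ef)   (next p)  = next (strengthen ef p)

lookup-ext : ∀ {A : Set} {n} {xs ys : Vec A n} → (∀ i → lookup xs i ≡ lookup ys i) → xs ≡ ys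
lookup-ext {xs = []}     {[]}     eq = refl
lookup-ext {xs = x ∷ xs} {y ∷ ys} eq = cong₂ _∷_ (eq zero) (lookup-ext (eq ∘ suc))

∃tabulate : ∀ {A : Set} {n} {P : Fin n → A → Set} → (∀ i → ∃ (P i)) → ∃[ v ] (∀ i → P i (lookup v i))
∃tabulate {n = zero}  h = [] , λ ()
∃tabulate {n = suc n} h =
  let a , p = h zero ; v , ps = ∃tabulate (h ∘ suc) in a ∷ v , ∀-cons p ps

AnyPath-imp : ∀ {A : Set} {Q Q′ : A → List A → Set} → (∀ {a ρ} → Q a ρ → Q′ a ρ) →
              ∀ {d ρ} {f : Forest A d} → AnyPath Q ρ f → AnyPath Q′ ρ f
AnyPath-imp imp (root q)  = root (imp q)
AnyPath-imp imp (child p) = child (AnyPath-imp imp p)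
AnyPath-imp imp (next p)  = next (AnyPath-imp imp p)

T⇔∈tabulate : ∀ {n} (s : Fin n → Bool) v → T (s v) ⇔ v ∈ₛ Vec.tabulate s
T⇔∈tabulate s v = mk⇔
  (λ t → lookup⇒[]= v _ (trans (lookup∘tabulate s v) (Equivalence.to T-≡ t)))
  (λ v∈ → subst T (sym (trans (sym (lookup∘tabulate s v)) ([]=⇒lookup v∈))) _)

module _ {σ : Signature} (𝔄 : Structure σ) {D ℓ : ℕ} (dec : Fin ℓ → Atoms σ D)
         {f : Forest (Node 𝔄 dec) D} (elim : Elim 𝔄 dec [] ⊤ₛ f) where
  open Structure 𝔄
  open Graph (gaifman 𝔄) using (Adj)
  private V = Universe
  open Meaning

  -- Ties an assignment in the structure to a marking of the forest; `lab` collects the marks made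
  -- so far.
  record Faithful {k m n} (ρ : Vec V k) (Ξ : Vec (Subset (suc order)) m) (lab : Node 𝔄 dec → Fin n)
                  (Γ : Meaning σ D k m n) : Set where
    field
      atoms≡ : ∀ w R e → atoms Γ (lab w) R e ≡ dec (proj₂ w) R e
      elem⇔  : ∀ w i → T (lookup (elem Γ) i (lab w)) ⇔ proj₁ w ≡ lookup ρ i
      set⇔   : ∀ w i → T (lookup (set Γ) i (lab w)) ⇔ proj₁ w ∈ₛ lookup Ξ i
  open Faithful

  private variable
    k m n : ℕ
    ρ : Vec V k
    Ξ : Vec (Subset (suc order)) m
    lab : Node 𝔄 dec → Fin n
    Γ : Meaning σ D k m n

  withMark : (Node 𝔄 dec → Fin n) → (V → Bool) → Node 𝔄 dec → Fin (n * 2)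
  withMark lab s w = mark (lab w) (s (proj₁ w))

  private
    old : (xs : Vec (Fin n → Bool) m) → ∀ lab s w i {P : Set} → T (lookup xs i (lab w)) ⇔ P →
          T (lookup (Vec.map (_∘ unmark n) xs) i (withMark lab s w)) ⇔ P
    old {n = n} xs lab s w i h
      rewrite lookup-map i (_∘ unmark n) xs | unmark-mark (lab w) (s (proj₁ w)) = h

  faithful-elem : Faithful ρ Ξ lab Γ → ∀ s a → (∀ v → T (s v) ⇔ v ≡ a) →
                  Faithful (a ∷ ρ) Ξ (withMark lab s) (bindElem σ D Γ)
  faithful-elem {lab = lab} {Γ = Γ} F s a s⇔ = record
    { atoms≡ = λ w R e → trans (cong (λ z → atoms Γ z R e) (unmark-mark (lab w) (s (proj₁ w)))) (atoms≡ F w R e)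
    ; elem⇔  = λ { w zero    → subst (λ b → T b ⇔ _) (sym (marked-mark (lab w) (s (proj₁ w)))) (s⇔ (proj₁ w))
                 ; w (suc i) → old (elem Γ) lab s w i (elem⇔ F w i) }
    ; set⇔   = λ w i → old (set Γ) lab s w i (set⇔ F w i) }

  faithful-set : Faithful ρ Ξ lab Γ → ∀ s S → (∀ v → T (s v) ⇔ v ∈ₛ S) →
                 Faithful ρ (S ∷ Ξ) (withMark lab s) (bindSet σ D Γ)
  faithful-set {lab = lab} {Γ = Γ} F s S s⇔ = record
    { atoms≡ = λ w R e → trans (cong (λ z → atoms Γ z R e) (unmark-mark (lab w) (s (proj₁ w)))) (atoms≡ F w R e)
    ; elem⇔  = λ w i → old (elem Γ) lab s w i (elem⇔ F w i)
    ; set⇔   = λ { w zero    → subst (λ b → T b ⇔ _) (sym (marked-mark (lab w) (s (proj₁ w)))) (s⇔ (proj₁ w))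
                 ; w (suc i) → old (set Γ) lab s w i (set⇔ F w i) } }

  erase-withMark : ∀ (lab : Node 𝔄 dec → Fin n) s → erase n (mapF (withMark lab s) f) ≡ mapF lab f
  erase-withMark {n} lab s = trans (mapF-∘ (unmark n) (withMark lab s) f)
    (mapF-cong (λ w → unmark-mark (lab w) (s (proj₁ w))) f)

  #marked : ∀ (lab : Node 𝔄 dec → Fin n) s → #nodes (marked n) (mapF (withMark lab s) f) ≡ #nodes (s ∘ proj₁) f
  #marked {n} lab s = trans (#nodes-mapF (marked n) (withMark lab s) f)
    (#nodes-cong (λ w → marked-mark (lab w) (s (proj₁ w))) f)

  root-path : ∀ v → AnyPath (λ w _ → proj₁ w ≡ v) [] f
  root-path v = AnyPath-imp (λ (w≡v , _) → w≡v)
    (clique⇒path 𝔄 dec (_≟ᶠ v) (λ { refl refl → inj₁ refl }) elim ≤-refl (λ x _ → inj₁ ∈⊤) v refl ∈⊤)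

  -- A tuple in a relation is a clique of the Gaifman graph, so it lies on one path.
  tuple-path : ∀ R (v : Vec V (arity σ R)) → Holds R v →
    AnyPath (λ w ρ → length (w ∷ ρ) ≤ D × (∀ i → lookup v i ∈ map proj₁ (w ∷ ρ))) [] f
  tuple-path R v h with any? (λ x → any? λ i → lookup v i ≟ᶠ x)
  ... | yes (x₀ , i₀ , eq) = AnyPath-imp (λ (_ , len , cover) → len , λ i → cover _ (i , refl))
    (clique⇒path 𝔄 dec (λ x → any? λ i → lookup v i ≟ᶠ x) clique elim ≤-refl (λ x _ → inj₁ ∈⊤) x₀ (i₀ , eq) ∈⊤)
    where
    clique : ∀ {x y} → ∃[ i ] lookup v i ≡ x → ∃[ j ] lookup v j ≡ y → x ≡ y ⊎ Adj x y
    clique {x} {y} (i , refl) (j , refl) with x ≟ᶠ y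
    ... | yes x≡y = inj₁ x≡y
    ... | no  x≢y = inj₂ (x≢y , R , v , h , ∈-lookup i v , ∈-lookup j v)
  -- Arity 0: a tuple without entries is on every path, and as the universe is not empty, the path
  -- to `zero` will do.
  ... | no ¬∃ = AnyPath-imp (λ (_ , len , _) → len , λ i → contradiction (_ , i , refl) ¬∃)
    (clique⇒path 𝔄 dec (_≟ᶠ zero) (λ { refl refl → inj₁ refl }) elim ≤-refl (λ x _ → inj₁ ∈⊤) zero refl ∈⊤)

  -- A related tuple lies on one path, and the atomic type of its last node records the relation at
  -- the positions of the entries. Conversely, a mark determines the element that carries it.
  rel⇔ : Faithful ρ Ξ lab Γ → ∀ R xs → Holds R (Vec.map (lookup ρ) xs) ⇔ AnyPath (RelAt σ D Γ R xs) [] (mapF lab f)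
  rel⇔ {ρ = ρ} {lab = lab} {Γ = Γ} F R xs = mk⇔ to from
    where
    v : Vec V (arity σ R)
    v = Vec.map (lookup ρ) xs
    to : Holds R v → AnyPath (RelAt σ D Γ R xs) [] (mapF lab f)
    to h = AnyPath-map⁺ lab at (strengthen 𝔄 dec elim (tuple-path R v h))
      where
      at : ∀ {w ρ′} → ((length (w ∷ ρ′) ≤ D × (∀ i → lookup v i ∈ map proj₁ (w ∷ ρ′))) ×
                       Labels 𝔄 dec (proj₂ w) (proj₁ w) (map proj₁ ρ′)) → RelAt σ D Γ R xs (lab w) (map lab ρ′)
      at {w} {ρ′} ((len , cover) , lbl) =
        e , subst T (sym (trans (atoms≡ F w R e) (trans (lbl R e) (cong (interp R) v≡)))) h , marks
        where
        index : ∀ i → ∃[ j ] nth (proj₁ w) (map proj₁ (w ∷ ρ′)) (toℕ {D} j) ≡ lookup v i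
        index i with j , j< , eq ← nth-∈ (proj₁ w) (cover i) =
          let j<D = <-≤-trans j< (≤-trans (≤-reflexive (length-map proj₁ (w ∷ ρ′))) len)
          in fromℕ< j<D , trans (cong (nth (proj₁ w) (map proj₁ (w ∷ ρ′))) (toℕ-fromℕ< j<D)) eq
        e : Vec (Fin D) (arity σ R)
        e = proj₁ (∃tabulate index)
        e-ok : ∀ i → nth (proj₁ w) (map proj₁ (w ∷ ρ′)) (toℕ (lookup e i)) ≡ lookup v i
        e-ok = proj₂ (∃tabulate index)
        v≡ : Vec.map (λ j → nth (proj₁ w) (map proj₁ (w ∷ ρ′)) (toℕ j)) e ≡ v
        v≡ = lookup-ext λ i → trans (lookup-map i _ e) (e-ok i)
        marks : ∀ i → T (lookup (elem Γ) (lookup xs i) (nth (lab w) (map lab (w ∷ ρ′)) (toℕ (lookup e i))))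
        marks i rewrite nth-map lab w (w ∷ ρ′) (toℕ (lookup e i)) = Equivalence.from (elem⇔ F _ (lookup xs i))
          (trans (sym (nth-map proj₁ w (w ∷ ρ′) (toℕ (lookup e i)))) (trans (e-ok i) (lookup-map i (lookup ρ) xs)))
    from : AnyPath (RelAt σ D Γ R xs) [] (mapF lab f) → Holds R v
    from p with w , ρ′ , (e , h , marks) , lbl ← path-witness 𝔄 dec elim (AnyPath-map⁻ lab f p) =
      subst T (trans (atoms≡ F w R e) (trans (lbl R e) (cong (interp R) v≡))) h
      where
      v≡ : Vec.map (λ j → nth (proj₁ w) (map proj₁ (w ∷ ρ′)) (toℕ j)) e ≡ v
      v≡ = lookup-ext λ i → begin
        lookup (Vec.map (λ j → nth (proj₁ w) (map proj₁ (w ∷ ρ′)) (toℕ j)) e) i ≡⟨ lookup-map i _ e ⟩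
        nth (proj₁ w) (map proj₁ (w ∷ ρ′)) (toℕ (lookup e i))                   ≡⟨ nth-map proj₁ w (w ∷ ρ′) (toℕ (lookup e i)) ⟩
        proj₁ (nth w (w ∷ ρ′) (toℕ (lookup e i)))                               ≡⟨ Equivalence.to (elem⇔ F _ (lookup xs i))
             (subst (λ a → T (lookup (elem Γ) (lookup xs i) a)) (nth-map lab w (w ∷ ρ′) (toℕ (lookup e i))) (marks i)) ⟩
        lookup ρ (lookup xs i)                                                  ≡⟨ lookup-map i (lookup ρ) xs ⟨
        lookup v i                                                              ∎
        where open ≡-Reasoning

  -- A set yields a marking by `withMark`, and every marking arises in this way by `realise`; so the
  -- quantifiers on both sides have the same range.
  Sat⇔FSat : ∀ {L k m n} (φ : Formula σ L k m) {ρ : Vec V k} {Ξ} {lab : Node 𝔄 dec → Fin n} {Γ} →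
             Faithful ρ Ξ lab Γ → Sat 𝔄 φ ρ Ξ ⇔ FSat σ D φ (mapF lab f) Γ
  Sat⇔FSat (rel R xs) F = rel⇔ F R xs
  Sat⇔FSat (x ≐ y) {ρ = ρ} {lab = lab} {Γ = Γ} F = mk⇔
    (λ eq → AnyPath-map⁺ lab (λ { {w} w≡ → Equivalence.from (elem⇔ F w x) w≡ ,
                                           Equivalence.from (elem⇔ F w y) (trans w≡ eq) }) (root-path (lookup ρ x)))
    λ p → let w , _ , (tx , ty) , _ = path-witness 𝔄 dec elim (AnyPath-map⁻ lab f p)
          in trans (sym (Equivalence.to (elem⇔ F w x) tx)) (Equivalence.to (elem⇔ F w y) ty)
  Sat⇔FSat (x ∈ˢ X) {ρ = ρ} {Ξ = Ξ} {lab = lab} {Γ = Γ} F = mk⇔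
    (λ x∈ → AnyPath-map⁺ lab (λ { {w} w≡ → Equivalence.from (elem⇔ F w x) w≡ ,
                                           Equivalence.from (set⇔ F w X) (subst (_∈ₛ lookup Ξ X) (sym w≡) x∈) }) (root-path (lookup ρ x)))
    λ p → let w , _ , (tx , tX) , _ = path-witness 𝔄 dec elim (AnyPath-map⁻ lab f p)
          in subst (_∈ₛ lookup Ξ X) (Equivalence.to (elem⇔ F w x) tx) (Equivalence.to (set⇔ F w X) tX)
  Sat⇔FSat (¬ᶠ φ) F = let h = Sat⇔FSat φ F in mk⇔ (λ ¬s → ¬s ∘ Equivalence.from h) (λ ¬s → ¬s ∘ Equivalence.to h)
  Sat⇔FSat (φ ∧ᶠ ψ) F = let h = Sat⇔FSat φ F ; h′ = Sat⇔FSat ψ F in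
    mk⇔ (λ (s , s′) → Equivalence.to h s , Equivalence.to h′ s′)
        (λ (s , s′) → Equivalence.from h s , Equivalence.from h′ s′)
  Sat⇔FSat (φ ∨ᶠ ψ) F = let h = Sat⇔FSat φ F ; h′ = Sat⇔FSat ψ F in
    mk⇔ [ inj₁ ∘ Equivalence.to h , inj₂ ∘ Equivalence.to h′ ]′
        [ inj₁ ∘ Equivalence.from h , inj₂ ∘ Equivalence.from h′ ]′
  Sat⇔FSat {n = n} (∃ᶠ φ) {lab = lab} {Γ = Γ} F = mk⇔
    (λ (a , sat) → let s = λ v → does (v ≟ᶠ a) ; s⇔ = λ v → T-does (v ≟ᶠ a) in
      mapF (withMark lab s) f , erase-withMark lab s
      , trans (#marked lab s) (#nodes≡1 𝔄 dec s elim a ∈⊤ (λ v _ → s⇔ v))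
      , Equivalence.to (Sat⇔FSat φ (faithful-elem F s a s⇔)) sat)
    λ (f′ , e , one , sat) → from f′ e one sat
    where
    from : ∀ f′ → erase n f′ ≡ mapF lab f → #nodes (marked n) f′ ≡ 1 → FSat σ D φ f′ (bindElem σ D Γ) → _
    from f′ e one sat with s , refl ← realise 𝔄 dec elim lab f′ e
      with a , _ , s⇔ ← #nodes≡1⇒ 𝔄 dec s elim (trans (sym (#marked lab s)) one) =
      a , Equivalence.from (Sat⇔FSat φ (faithful-elem F s a (λ v → s⇔ v ∈⊤))) sat
  Sat⇔FSat {n = n} (∀ᶠ φ) {ρ = ρ} {Ξ = Ξ} {lab = lab} {Γ = Γ} F = mk⇔ to
    λ h a → let s = λ v → does (v ≟ᶠ a) ; s⇔ = λ v → T-does (v ≟ᶠ a) in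
      Equivalence.from (Sat⇔FSat φ (faithful-elem F s a s⇔))
        (h _ (erase-withMark lab s) (trans (#marked lab s) (#nodes≡1 𝔄 dec s elim a ∈⊤ (λ v _ → s⇔ v))))
    where
    to : (∀ a → Sat 𝔄 φ (a ∷ ρ) Ξ) → ∀ f′ → erase n f′ ≡ mapF lab f → #nodes (marked n) f′ ≡ 1 → FSat σ D φ f′ (bindElem σ D Γ)
    to h f′ e one with s , refl ← realise 𝔄 dec elim lab f′ e
      with a , _ , s⇔ ← #nodes≡1⇒ 𝔄 dec s elim (trans (sym (#marked lab s)) one) =
      Equivalence.to (Sat⇔FSat φ (faithful-elem F s a (λ v → s⇔ v ∈⊤))) (h a)
  Sat⇔FSat {n = n} (∃ˢ φ) {ρ = ρ} {Ξ = Ξ} {lab = lab} {Γ = Γ} F = mk⇔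
    (λ (S , sat) → let s = λ v → does (v ∈ₛ? S) in
      mapF (withMark lab s) f , erase-withMark lab s
      , Equivalence.to (Sat⇔FSat φ (faithful-set F s S (λ v → T-does (v ∈ₛ? S)))) sat)
    λ (f′ , e , sat) → from f′ e sat
    where
    from : ∀ f′ → erase n f′ ≡ mapF lab f → FSat σ D φ f′ (bindSet σ D Γ) → ∃[ S ] Sat 𝔄 φ ρ (S ∷ Ξ)
    from f′ e sat with s , refl ← realise 𝔄 dec elim lab f′ e =
      Vec.tabulate s , Equivalence.from (Sat⇔FSat φ (faithful-set F s (Vec.tabulate s) (T⇔∈tabulate s))) sat
  Sat⇔FSat {n = n} (∀ˢ φ) {ρ = ρ} {Ξ = Ξ} {lab = lab} {Γ = Γ} F = mk⇔ to
    λ h S → let s = λ v → does (v ∈ₛ? S) in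
      Equivalence.from (Sat⇔FSat φ (faithful-set F s S (λ v → T-does (v ∈ₛ? S)))) (h _ (erase-withMark lab s))
    where
    to : (∀ S → Sat 𝔄 φ ρ (S ∷ Ξ)) → ∀ f′ → erase n f′ ≡ mapF lab f → FSat σ D φ f′ (bindSet σ D Γ)
    to h f′ e with s , refl ← realise 𝔄 dec elim lab f′ e =
      Equivalence.to (Sat⇔FSat φ (faithful-set F s (Vec.tabulate s) (T⇔∈tabulate s))) (h _)

-- First-order descriptions of codes

-- Numbers all Boolean functions on `I` up to pointwise equality. Atomic types thereby become labels
-- in a finite set whose size depends only on `σ` and `D`.
record Table (I : Set) : Set where
  field
    #rows : ℕ
    row   : Fin #rows → I → Bool
    full  : ∀ (h : I → Bool) → ∃[ c ] (∀ i → row c i ≡ h i)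
open Table

vecTable : ∀ D a → Table (Vec (Fin D) a)
vecTable D zero    = record
  { #rows = 2
  ; row   = λ c _ → isOne c
  ; full  = λ h → bit (h []) , λ { [] → isOne-bit (h []) } }
vecTable D (suc a) = record
  { #rows = #rows t ^ D
  ; row   = λ { c (i ∷ v) → row t (finToFun c i) v }
  ; full  = λ h → funToFin (c h) , λ { (i ∷ v) →
      trans (cong (λ z → row t z v) (finToFun-funToFin (c h) i)) (proj₂ (full t (λ v → h (i ∷ v))) v) } }
  where
  t : Table (Vec (Fin D) a)
  t = vecTable D a
  c : (Vec (Fin D) (suc a) → Bool) → Fin D → Fin (#rows t)
  c h i = proj₁ (full t (λ v → h (i ∷ v)))

sumTable : ∀ s {I : Fin s → Set} → (∀ i → Table (I i)) → Table (Σ (Fin s) I)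
sumTable zero    ts = record { #rows = 1 ; row = λ { _ (() , _) } ; full = λ h → zero , λ { (() , _) } }
sumTable (suc s) {I} ts = record { #rows = #rows t * #rows u ; row = rows ; full = full′ }
  where
  t : Table (I zero)
  t = ts zero
  u : Table (Σ (Fin s) (I ∘ suc))
  u = sumTable s (ts ∘ suc)
  rows : Fin (#rows t * #rows u) → Σ (Fin (suc s)) I → Bool
  rows c (zero , i)  = row t (quotient {#rows t} (#rows u) c) i
  rows c (suc j , i) = row u (remainder {#rows t} (#rows u) c) (j , i)
  full′ : ∀ (h : Σ (Fin (suc s)) I → Bool) → ∃[ c ] (∀ i → rows c i ≡ h i)
  full′ h with c , eq ← full t (λ i → h (zero , i)) | c′ , eq′ ← full u (λ (j , i) → h (suc j , i)) =
    combine c c′ , λ where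
      (zero , i)  → trans (cong (λ z → row t (proj₁ z) i) (remQuot-combine c c′)) (eq i)
      (suc j , i) → trans (cong (λ z → row u (proj₂ z) (j , i)) (remQuot-combine c c′)) (eq′ (j , i))

module _ (σ : Signature) (D : ℕ) where

  atomTable : Table (Σ (Fin (symbols σ)) λ R → Vec (Fin D) (arity σ R))
  atomTable = sumTable (symbols σ) (λ R → vecTable D (arity σ R))

  #atoms : ℕ
  #atoms = #rows atomTable

  atomsOf : Fin #atoms → Atoms σ D
  atomsOf c R e = row atomTable c (R , e)

module Describe (σ : Signature) (D : ℕ) where

  Fo : ℕ → Set
  Fo v = Formula σ FO v 0

  private variable
    v k i : ℕ

  ℓ : ℕ
  ℓ = #atoms σ D

  -- The syntax has no truth constants. Both are existential, so that they cost no alternation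
  -- inside existential formulas; `⊤ᶠ` is true because structures are not empty.
  ⊤ᶠ ⊥ᶠ : Fo v
  ⊤ᶠ = ∃ᶠ (zero ≐ zero)
  ⊥ᶠ = ∃ᶠ (¬ᶠ (zero ≐ zero))

  ⋀ ⋁ : ∀ n → (Fin n → Fo v) → Fo v
  ⋀ zero    φ = ⊤ᶠ
  ⋀ (suc n) φ = φ zero ∧ᶠ ⋀ n (φ ∘ suc)
  ⋁ zero    φ = ⊥ᶠ
  ⋁ (suc n) φ = φ zero ∨ᶠ ⋁ n (φ ∘ suc)

  ⋀ᵛ : ∀ a → (Vec (Fin D) a → Fo v) → Fo v
  ⋀ᵛ zero    φ = φ []
  ⋀ᵛ (suc a) φ = ⋀ D λ i → ⋀ᵛ a λ e → φ (i ∷ e)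

  ∃* : ∀ a → Fo (a + v) → Fo v
  ∃* zero    φ = φ
  ∃* (suc a) φ = ∃* a (∃ᶠ φ)

  guard : Bool → Fo v → Fo v
  guard b φ = if b then φ else ⊤ᶠ

  literal : Bool → Fo v → Fo v
  literal b φ = if b then φ else ¬ᶠ φ

  commonTupleF : ∀ R → Fin v → Fin v → Fo v
  commonTupleF {v} R x y = ∃* a (rel R (Vec.tabulate (_↑ˡ v)) ∧ᶠ
    ⋁ a (λ i → (i ↑ˡ v) ≐ (a ↑ʳ x)) ∧ᶠ ⋁ a (λ i → (i ↑ˡ v) ≐ (a ↑ʳ y)))
    where
    a : ℕ
    a = arity σ R

  adjF : Fin v → Fin v → Fo v
  adjF x y = ¬ᶠ (x ≐ y) ∧ᶠ ⋁ (symbols σ) (λ R → commonTupleF R x y)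

  ↑ : Vec (Fin v) k → Vec (Fin (suc v)) k
  ↑ = Vec.map suc

  -- The vector lists the roots of a path, the last one first. Below it lies the component of the
  -- last root within the part below the other roots, without that root.
  insideF : ∀ k → Vec (Fin v) k → Fin v → Fo v
  walkF   : ∀ k → ℕ → Vec (Fin v) k → Fin v → Fin v → Fo v

  insideF zero    []       y = y ≐ y
  insideF (suc k) (r ∷ rs) y = walkF k (walkBound D) rs r y ∧ᶠ ¬ᶠ (y ≐ r)

  walkF k zero    rs x y = x ≐ y
  walkF k (suc l) rs x y = x ≐ y ∨ᶠ ∃ᶠ ((insideF k (↑ rs) (suc x) ∧ᶠ insideF k (↑ rs) zero ∧ᶠ adjF (suc x) zero)
                                        ∧ᶠ walkF k l (↑ rs) zero (suc y))

  connF : Vec (Fin v) k → Fin v → Fin v → Fo v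
  connF {k = k} = walkF k (walkBound D)

  labelF : Fin ℓ → Fin v → Vec (Fin v) k → Fo v
  labelF c r rs = ⋀ (symbols σ) λ R → ⋀ᵛ (arity σ R) λ e →
    literal (atomsOf σ D c R e) (rel R (Vec.map (λ i → nth r (r ∷ Vec.toList rs) (toℕ i)) e))

module DescribeTypes (σ : Signature) (D : ℕ) (t : ℕ → ℕ) where
  open Describe σ D public

  private variable
    v k i : ℕ

  #types : ℕ → ℕ
  #types = #codes ℓ t

  -- typeF d rs τ says that the structure below the path rs has code τ; rootF d c rs x,
  -- that some root of the component of x leads to the tree code c; firstF, that c is
  -- the least such code; atLeastF d c j rs zs, that j components other than those of
  -- zs have the least code c.
  typeF    : ∀ d → Vec (Fin v) k → Fin (#types d) → Fo v
  rootF    : ∀ d → Fin (ℓ * #types d) → Vec (Fin v) k → Fin v → Fo v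
  firstF   : ∀ d → Fin (ℓ * #types d) → Vec (Fin v) k → Fin v → Fo v
  atLeastF : ∀ d → Fin (ℓ * #types d) → ℕ → Vec (Fin v) k → Vec (Fin v) i → Fo v
  countF   : ∀ d → Fin (ℓ * #types d) → Fin (suc (t d)) → Vec (Fin v) k → Fo v

  typeF {k = k} zero    rs τ = ¬ᶠ ∃ᶠ insideF k (↑ rs) zero
  typeF {k = k} (suc d) rs τ =
    -- No component lacks a suitable root; otherwise the counts alone would overlook the components
    -- that cannot be eliminated in time.
    ¬ᶠ ∃ᶠ (insideF k (↑ rs) zero ∧ᶠ ⋀ (ℓ * #types d) (λ c → ¬ᶠ rootF d c (↑ rs) zero)) ∧ᶠ
    ⋀ (ℓ * #types d) (λ c → countF d c (finToFun {suc (t d)} τ c) rs)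

  rootF d c rs x = ∃ᶠ (connF (↑ rs) (suc x) zero ∧ᶠ labelF (quotient {ℓ} (#types d) c) zero (↑ rs) ∧ᶠ
                       typeF d (zero ∷ ↑ rs) (remainder {ℓ} (#types d) c))

  firstF d c rs x = rootF d c rs x ∧ᶠ
    ⋀ (ℓ * #types d) λ c′ → guard (does (toℕ c′ <ℕ? toℕ c)) (¬ᶠ rootF d c′ rs x)

  atLeastF d c zero    rs zs = ⊤ᶠ
  atLeastF {k = k} {i} d c (suc j) rs zs = ∃ᶠ (insideF k (↑ rs) zero ∧ᶠ firstF d c (↑ rs) zero ∧ᶠ
    ⋀ i (λ m → ¬ᶠ connF (↑ rs) zero (lookup (↑ zs) m)) ∧ᶠ atLeastF d c j (↑ rs) (zero ∷ ↑ zs))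

  countF d c m rs = atLeastF d c (toℕ m) rs [] ∧ᶠ
    -- A count equal to the cap also stands for all larger ones, so only smaller counts get an upper
    -- bound.
    guard (does (toℕ m <ℕ? t d)) (¬ᶠ atLeastF d c (suc (toℕ m)) rs [])

-- Satisfaction of the descriptions

∃-⇔ : ∀ {I : Set} {A B : I → Set} → (∀ i → A i ⇔ B i) → ∃ A ⇔ ∃ B
∃-⇔ f = mk⇔ (λ (i , a) → i , Equivalence.to (f i) a) (λ (i , b) → i , Equivalence.from (f i) b)

∀-⇔ : ∀ {I : Set} {A B : I → Set} → (∀ i → A i ⇔ B i) → (∀ i → A i) ⇔ (∀ i → B i)
∀-⇔ f = mk⇔ (λ h i → Equivalence.to (f i) (h i)) (λ h i → Equivalence.from (f i) (h i))

≡-⇔ : ∀ {A : Set} {a a′ b b′ : A} → a ≡ a′ → b ≡ b′ → (a ≡ b) ⇔ (a′ ≡ b′)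
≡-⇔ refl refl = mk⇔ id id

T⇔true≡ : ∀ b → T b ⇔ true ≡ b
T⇔true≡ true  = mk⇔ (λ _ → refl) _
T⇔true≡ false = mk⇔ (λ ()) (λ ())

¬T⇔false≡ : ∀ b → (¬ T b) ⇔ false ≡ b
¬T⇔false≡ true  = mk⇔ (λ ¬t → contradiction _ ¬t) (λ ())
¬T⇔false≡ false = mk⇔ (λ _ → refl) (λ _ ())

∈ᵛ-⇔ : ∀ {A : Set} {n} {x : A} {xs : Vec A n} → (∃[ i ] lookup xs i ≡ x) ⇔ x ∈ᵛ xs
∈ᵛ-⇔ {xs = xs} = mk⇔ (λ { (i , refl) → ∈-lookup i xs }) (λ x∈ → Anyᵛ.index x∈ , sym (lookup-index x∈))

module Semantics {σ : Signature} (D : ℕ) (t : ℕ → ℕ) (𝔄 : Structure σ) (low : Low (gaifman 𝔄) D ⊤ₛ) where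
  open DescribeTypes σ D t
  open Structure 𝔄
  private
    G = gaifman 𝔄
    V = Universe
  open Graph G using (Adj)

  below-path : ∀ {k} → Vec V k → Subset (suc order)
  below-path []      = ⊤ₛ
  below-path (r ∷ ρ) = comp G (below-path ρ) r - r

  Conn : ∀ {k} → Vec V k → V → V → Set
  Conn ρ = Walk G (below-path ρ)

  HasLabel : ∀ {k} → Fin ℓ → V → Vec V k → Set
  HasLabel c r ρ = Labels 𝔄 (atomsOf σ D) c r (Vec.toList ρ)

  -- These predicates copy the formulas clause by clause, down to the unfolded `⊤ᶠ` in `AtLeast`,
  -- with elements in place of variables; satisfaction is then a matter of congruence.
  HasType : ∀ {k} d → Vec V k → Fin (#types d) → Set
  Root    : ∀ {k} d → Fin (ℓ * #types d) → Vec V k → V → Set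
  First   : ∀ {k} d → Fin (ℓ * #types d) → Vec V k → V → Set
  AtLeast : ∀ {k i} d → Fin (ℓ * #types d) → ℕ → Vec V k → Vec V i → Set
  Count   : ∀ {k} d → Fin (ℓ * #types d) → Fin (suc (t d)) → Vec V k → Set

  HasType zero    ρ τ = ¬ (∃[ x ] x ∈ₛ below-path ρ)
  HasType (suc d) ρ τ = ¬ (∃[ x ] x ∈ₛ below-path ρ × (∀ c → ¬ Root d c ρ x)) ×
                        (∀ c → Count d c (finToFun {suc (t d)} τ c) ρ)

  Root d c ρ x = ∃[ r ] Conn ρ x r × HasLabel (quotient {ℓ} (#types d) c) r ρ ×
                        HasType d (r ∷ ρ) (remainder {ℓ} (#types d) c)

  First d c ρ x = Root d c ρ x × (∀ c′ → toℕ c′ < toℕ c → ¬ Root d c′ ρ x)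

  AtLeast d c zero    ρ zs = Σ[ x ∈ V ] x ≡ x
  AtLeast d c (suc j) ρ zs = ∃[ z ] z ∈ₛ below-path ρ × First d c ρ z ×
                                    (∀ m → ¬ Conn ρ z (lookup zs m)) × AtLeast d c j ρ (z ∷ zs)

  Count d c m ρ = AtLeast d c (toℕ m) ρ [] × (toℕ m < t d → ¬ AtLeast d c (suc (toℕ m)) ρ [])

  private variable
    v k i : ℕ
    env : Vec V v
    rs  : Vec (Fin v) k
    ρ   : Vec V k

  infix 4 _⊩_
  _⊩_ : Vec V v → Fo v → Set
  env ⊩ φ = Sat 𝔄 φ env []

  sat-⋀ : ∀ n (φ : Fin n → Fo v) → (env ⊩ ⋀ n φ) ⇔ (∀ i → env ⊩ φ i)
  sat-⋀ zero    φ = mk⇔ (λ _ ()) (λ _ → zero , refl)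
  sat-⋀ (suc n) φ = let h = sat-⋀ n (φ ∘ suc) in
    mk⇔ (λ (s , s′) → ∀-cons s (Equivalence.to h s′)) (λ s → s zero , Equivalence.from h (s ∘ suc))

  sat-⋁ : ∀ n (φ : Fin n → Fo v) → (env ⊩ ⋁ n φ) ⇔ (∃[ i ] env ⊩ φ i)
  sat-⋁ zero    φ = mk⇔ (λ (_ , x≢x) → contradiction refl x≢x) λ ()
  sat-⋁ (suc n) φ = let h = sat-⋁ n (φ ∘ suc) in mk⇔
    [ (zero ,_) , (λ s → let i , s′ = Equivalence.to h s in suc i , s′) ]′
    λ { (zero , s) → inj₁ s ; (suc i , s) → inj₂ (Equivalence.from h (i , s)) }

  sat-⋀ᵛ : ∀ a (φ : Vec (Fin D) a → Fo v) → (env ⊩ ⋀ᵛ a φ) ⇔ (∀ e → env ⊩ φ e)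
  sat-⋀ᵛ zero    φ = mk⇔ (λ { s [] → s }) (λ s → s [])
  sat-⋀ᵛ (suc a) φ = ⇔-trans (sat-⋀ D _) (⇔-trans (∀-⇔ λ i → sat-⋀ᵛ a (λ e → φ (i ∷ e)))
    (mk⇔ (λ { s (i ∷ e) → s i e }) (λ s i e → s (i ∷ e))))

  sat-∃* : ∀ a (φ : Fo (a + v)) → (env ⊩ ∃* a φ) ⇔ (∃[ us ] us Vec.++ env ⊩ φ)
  sat-∃* zero    φ = mk⇔ ([] ,_) (λ { ([] , s) → s })
  sat-∃* (suc a) φ = ⇔-trans (sat-∃* a (∃ᶠ φ))
    (mk⇔ (λ { (us , u , s) → u ∷ us , s }) (λ { (u ∷ us , s) → us , u , s }))

  sat-guard : ∀ {P : Set} (P? : Dec P) (φ : Fo v) → (env ⊩ guard (does P?) φ) ⇔ (P → env ⊩ φ)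
  sat-guard (yes p) φ = mk⇔ (λ s _ → s) (λ s → s p)
  sat-guard (no ¬p) φ = mk⇔ (λ _ p → contradiction p ¬p) (λ _ → zero , refl)

  sat-literal : ∀ b R (xs : Vec (Fin v) (arity σ R)) → (env ⊩ literal b (rel R xs)) ⇔ (b ≡ interp R (Vec.map (lookup env) xs))
  sat-literal true  R xs = T⇔true≡ _
  sat-literal false R xs = ¬T⇔false≡ _

  sat-adjF : ∀ (x y : Fin v) → (env ⊩ adjF x y) ⇔ Adj (lookup env x) (lookup env y)
  sat-adjF {v} {env} x y = mk⇔ id id ×-⇔ ⇔-trans (sat-⋁ (symbols σ) _) (∃-⇔ λ R →
    ⇔-trans (sat-∃* (arity σ R) _) (∃-⇔ λ us →
      mk⇔ (subst T (cong (interp R) (args R us))) (subst T (sym (cong (interp R) (args R us)))) ×-⇔ occurs R us x ×-⇔ occurs R us y))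
    where
    args : ∀ R (us : Vec V (arity σ R)) → Vec.map (lookup (us Vec.++ env)) (Vec.tabulate (_↑ˡ v)) ≡ us
    args R us = lookup-ext λ i → trans (lookup-map i _ (Vec.tabulate (_↑ˡ v)))
      (trans (cong (lookup (us Vec.++ env)) (lookup∘tabulate (_↑ˡ v) i)) (lookup-++ˡ us env i))
    occurs : ∀ R (us : Vec V (arity σ R)) x →
      (us Vec.++ env ⊩ ⋁ (arity σ R) (λ i → (i ↑ˡ v) ≐ (arity σ R ↑ʳ x))) ⇔ lookup env x ∈ᵛ us
    occurs R us x = ⇔-trans (sat-⋁ (arity σ R) _) (⇔-trans (∃-⇔ λ i → ≡-⇔ (lookup-++ˡ us env i) (lookup-++ʳ us env x)) ∈ᵛ-⇔)

  lift≡ : ∀ {z} → Vec.map (lookup env) rs ≡ ρ → Vec.map (lookup (z ∷ env)) (↑ rs) ≡ ρ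
  lift≡ {env = env} {rs = rs} {z = z} eq = trans (sym (Vec-map-∘ (lookup (z ∷ env)) suc rs)) eq

  sat-insideF : Vec.map (lookup env) rs ≡ ρ → ∀ y → (env ⊩ insideF k rs y) ⇔ lookup env y ∈ₛ below-path ρ
  sat-walkF   : Vec.map (lookup env) rs ≡ ρ → ∀ l x y →
                (env ⊩ walkF k l rs x y) ⇔ BoundedWalk G (below-path ρ) l (lookup env x) (lookup env y)
  -- The part below a path is a subset of the structure and inherits `Low` for `D`, so the one
  -- length `walkBound D` serves at all levels.
  sat-connF   : Vec.map (lookup env) rs ≡ ρ → ∀ x y → (env ⊩ connF rs x y) ⇔ Conn ρ (lookup env x) (lookup env y)

  sat-connF eq x y = ⇔-trans (sat-walkF eq (walkBound D) x y)
    (mk⇔ (boundedWalk⇒walk G (walkBound D)) (walk⇒boundedWalk G D (low-⊆ G D ⊆⊤ low)))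

  sat-insideF {rs = []}     {ρ = []}    eq   y = mk⇔ (λ _ → ∈⊤) (λ _ → refl)
  sat-insideF {rs = r ∷ rs} {ρ = _ ∷ ρ} refl y = ⇔-trans (sat-connF refl r y ×-⇔ mk⇔ id id)
    (mk⇔ (λ (w , y≢r) → x∈p∧x≢y⇒x∈p-y (∈comp⁺ G w) y≢r) (λ y∈ → ∈comp⁻ G (p-x⊆p y∈) , x∈p-y⇒x≢y y∈))

  sat-walkF eq zero    x y = mk⇔ id id
  sat-walkF {env = env} {rs = rs} eq (suc l) x y = mk⇔ id id ⊎-⇔ ∃-⇔ λ z →
    (sat-insideF (lift≡ {env = env} {rs = rs} eq) (suc x) ×-⇔ sat-insideF (lift≡ {env = env} {rs = rs} eq) zero ×-⇔ sat-adjF (suc x) zero)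
    ×-⇔ sat-walkF (lift≡ {env = env} {rs = rs} eq) l zero (suc y)

  sat-labelF : Vec.map (lookup env) rs ≡ ρ → ∀ c r → (env ⊩ labelF c r rs) ⇔ HasLabel c (lookup env r) ρ
  sat-labelF {env = env} {rs = rs} {ρ = ρ} eq c r = ⇔-trans (sat-⋀ (symbols σ) _) (∀-⇔ λ R → ⇔-trans (sat-⋀ᵛ (arity σ R) _) (∀-⇔ λ e →
    ⇔-trans (sat-literal (atomsOf σ D c R e) R _) (≡-⇔ refl (cong (interp R) (args R e)))))
    where
    args : ∀ R (e : Vec (Fin D) (arity σ R)) →
      Vec.map (lookup env) (Vec.map (λ i → nth r (r ∷ Vec.toList rs) (toℕ i)) e) ≡
      Vec.map (λ i → nth (lookup env r) (lookup env r ∷ Vec.toList ρ) (toℕ i)) e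
    args R e = lookup-ext λ i → begin
      lookup (Vec.map (lookup env) (Vec.map (λ i → nth r (r ∷ Vec.toList rs) (toℕ i)) e)) i
        ≡⟨ lookup-map i (lookup env) (Vec.map (λ i → nth r (r ∷ Vec.toList rs) (toℕ i)) e) ⟩
      lookup env (lookup (Vec.map (λ i → nth r (r ∷ Vec.toList rs) (toℕ i)) e) i)
        ≡⟨ cong (lookup env) (lookup-map i _ e) ⟩
      lookup env (nth r (r ∷ Vec.toList rs) (toℕ (lookup e i)))
        ≡⟨ nth-map (lookup env) r (r ∷ Vec.toList rs) (toℕ (lookup e i)) ⟨
      nth (lookup env r) (lookup env r ∷ map (lookup env) (Vec.toList rs)) (toℕ (lookup e i))
        ≡⟨ cong (λ l → nth (lookup env r) (lookup env r ∷ l) (toℕ (lookup e i)))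
             (trans (sym (toList-map (lookup env) rs)) (cong Vec.toList eq)) ⟩
      nth (lookup env r) (lookup env r ∷ Vec.toList ρ) (toℕ (lookup e i))
        ≡⟨ lookup-map i _ e ⟨
      lookup (Vec.map (λ i → nth (lookup env r) (lookup env r ∷ Vec.toList ρ) (toℕ i)) e) i ∎
      where open ≡-Reasoning

  sat-typeF : Vec.map (lookup env) rs ≡ ρ → ∀ d τ → (env ⊩ typeF d rs τ) ⇔ HasType d ρ τ
  sat-rootF : Vec.map (lookup env) rs ≡ ρ → ∀ d c x → (env ⊩ rootF d c rs x) ⇔ Root d c ρ (lookup env x)

  sat-firstF : Vec.map (lookup env) rs ≡ ρ → ∀ d c x → (env ⊩ firstF d c rs x) ⇔ First d c ρ (lookup env x)
  sat-firstF eq d c x = sat-rootF eq d c x ×-⇔ ⇔-trans (sat-⋀ (ℓ * #types d) _) (∀-⇔ λ c′ →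
    ⇔-trans (sat-guard (toℕ c′ <ℕ? toℕ c) _) (∀-⇔ λ _ → ¬-cong-⇔ (sat-rootF eq d c′ x)))

  sat-atLeastF : Vec.map (lookup env) rs ≡ ρ → ∀ d c j (zs : Vec (Fin v) i) →
                 (env ⊩ atLeastF d c j rs zs) ⇔ AtLeast d c j ρ (Vec.map (lookup env) zs)
  sat-atLeastF eq d c zero    zs = mk⇔ id id
  sat-atLeastF {env = env} {rs = rs} {ρ = ρ} eq d c (suc j) zs = ∃-⇔ λ z → let eq′ = lift≡ {env = env} {rs = rs} {z = z} eq in
    sat-insideF eq′ zero ×-⇔ sat-firstF eq′ d c zero ×-⇔
    ⇔-trans (sat-⋀ _ _) (∀-⇔ λ m → ¬-cong-⇔ (⇔-trans (sat-connF eq′ zero _) (conn m z))) ×-⇔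
    subst (λ us → (z ∷ env ⊩ atLeastF d c j (↑ rs) (zero ∷ ↑ zs)) ⇔ AtLeast d c j ρ (z ∷ us))
          (lift≡ {env = env} {rs = zs} {z = z} refl) (sat-atLeastF eq′ d c j (zero ∷ ↑ zs))
    where
    conn : ∀ m z → Conn ρ z (lookup (z ∷ env) (lookup (↑ zs) m)) ⇔ Conn ρ z (lookup (Vec.map (lookup env) zs) m)
    conn m z = subst (λ u → Conn ρ z (lookup (z ∷ env) (lookup (↑ zs) m)) ⇔ Conn ρ z u)
      (trans (cong (lookup (z ∷ env)) (lookup-map m suc zs)) (sym (lookup-map m (lookup env) zs))) (mk⇔ id id)

  sat-countF : Vec.map (lookup env) rs ≡ ρ → ∀ d c m → (env ⊩ countF d c m rs) ⇔ Count d c m ρ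
  sat-countF eq d c m = sat-atLeastF eq d c (toℕ m) [] ×-⇔
    ⇔-trans (sat-guard (toℕ m <ℕ? t d) _) (∀-⇔ λ _ → ¬-cong-⇔ (sat-atLeastF eq d c (suc (toℕ m)) []))

  sat-rootF {env = env} {rs = rs} eq d c x = ∃-⇔ λ r → let eq′ = lift≡ {env = env} {rs = rs} {z = r} eq in
    sat-connF eq′ (suc x) zero ×-⇔ sat-labelF eq′ _ zero ×-⇔ sat-typeF (cong (r ∷_) eq′) d _

  sat-typeF {env = env} {rs = rs} eq zero    τ = ¬-cong-⇔ (∃-⇔ λ x → sat-insideF (lift≡ {env = env} {rs = rs} eq) zero)
  sat-typeF {env = env} {rs = rs} eq (suc d) τ =
    ¬-cong-⇔ (∃-⇔ λ x → let eq′ = lift≡ {env = env} {rs = rs} {z = x} eq in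
      sat-insideF eq′ zero ×-⇔ ⇔-trans (sat-⋀ (ℓ * #types d) _) (∀-⇔ λ c → ¬-cong-⇔ (sat-rootF eq′ d c zero)))
    ×-⇔ ⇔-trans (sat-⋀ (ℓ * #types d) _) (∀-⇔ λ c → sat-countF eq d c _)

-- From descriptions to elimination forests and back

least : ∀ {n} {P : Fin n → Set} → (∀ i → Dec (P i)) → ∃ P → ∃[ i ] P i × (∀ j → toℕ j < toℕ i → ¬ P j)
least {suc n} {P} P? (i , p) with P? zero
... | yes p₀ = zero , p₀ , λ _ ()
least {suc n} P? (zero  , p) | no ¬p₀ = contradiction p ¬p₀
least {suc n} P? (suc i , p) | no ¬p₀ =
  let j , q , min = least (P? ∘ suc) (i , p) in suc j , q , λ { zero _ → ¬p₀ ; (suc j′) (s≤s lt) → min j′ lt }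

-- Climbs from 0 as long as the next value satisfies `P`, but not beyond `T`.
greatest : ∀ T {P : ℕ → Set} → (∀ j → Dec (P j)) → P 0 → ∃[ m ] P (toℕ {suc T} m) × (toℕ m < T → ¬ P (suc (toℕ m)))
greatest zero    P? p₀ = zero , p₀ , λ ()
greatest (suc T) P? p₀ with P? 1
... | no ¬p₁ = zero , p₀ , λ _ → ¬p₁
... | yes p₁ = let m , p , max = greatest T (P? ∘ suc) p₁ in suc m , p , λ { (s≤s lt) → max lt }

module _ {X : Set} {M : ℕ} where

  select : Fin M → List (X × Fin M) → List X
  select c []             = []
  select c ((x , c′) ∷ ps) = if does (c ≟ᶠ c′) then x ∷ select c ps else select c ps

  length-select : ∀ c ps → length (select c ps) ≡ occ c (map proj₂ ps)
  length-select c []             = refl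
  length-select c ((x , c′) ∷ ps) with does (c ≟ᶠ c′)
  ... | true  = cong suc (length-select c ps)
  ... | false = length-select c ps

  select⁺ : ∀ {c x ps} → (x , c) ∈ ps → x ∈ select c ps
  select⁺ {c} (here refl) rewrite dec-true (c ≟ᶠ c) refl = here refl
  select⁺ {c} {ps = (_ , c′) ∷ _} (there p∈) with does (c ≟ᶠ c′)
  ... | true  = there (select⁺ p∈)
  ... | false = select⁺ p∈

  select⁻ : ∀ {c x} ps → x ∈ select c ps → (x , c) ∈ ps
  select⁻ {c} ((x , c′) ∷ ps) x∈ with c ≟ᶠ c′
  select⁻ ((x , c) ∷ ps) (here refl) | yes refl = here refl
  select⁻ ((x , c) ∷ ps) (there x∈)  | yes refl = there (select⁻ ps x∈)
  ... | no _ = there (select⁻ ps x∈)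

  select-AllPairs : ∀ {R : X → X → Set} c {ps} → AllPairs (λ p q → R (proj₁ p) (proj₁ q)) ps → AllPairs R (select c ps)
  select-AllPairs c []       = []
  select-AllPairs c {(x , c′) ∷ ps} (r ∷ rs) with does (c ≟ᶠ c′)
  ... | false = select-AllPairs c rs
  ... | true  = All.tabulate (λ y∈ → All.lookup r (select⁻ ps y∈)) ∷ select-AllPairs c rs

cap-toℕ : ∀ {T} (i : Fin (suc T)) → cap T (toℕ i) ≡ i
cap-toℕ {T} i = toℕ-injective (trans (toℕ-cap T (toℕ i)) (m≤n⇒m⊓n≡m (s≤s⁻¹ (toℕ<n i))))

module _ {σ : Signature} (D : ℕ) (t : ℕ → ℕ) (𝔄 : Structure σ) (low : Low (gaifman 𝔄) D ⊤ₛ) where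
  open DescribeTypes σ D t
  open Semantics D t 𝔄 low
  open Structure 𝔄
  private
    G = gaifman 𝔄
    V = Universe
    dec = atomsOf σ D
    M : ℕ → ℕ
    M d = ℓ * #types d
    variable
      k i : ℕ

  sat? : ∀ {v} (φ : Fo v) (env : Vec V v) → Dec (Sat 𝔄 φ env [])
  sat? (rel R xs) env = T? _
  sat? (x ≐ y)  env = lookup env x ≟ᶠ lookup env y
  sat? (¬ᶠ φ)   env = ¬? (sat? φ env)
  sat? (φ ∧ᶠ ψ) env = sat? φ env ×-dec sat? ψ env
  sat? (φ ∨ᶠ ψ) env = sat? φ env ⊎-dec sat? ψ env
  sat? (∃ᶠ φ)   env = any? λ a → sat? φ (a ∷ env)
  sat? (∀ᶠ φ)   env = all? λ a → sat? φ (a ∷ env)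

  -- Inherited from the satisfaction of `rootF` in a finite structure, where the path itself serves
  -- as the environment.
  root? : ∀ d c (ρ : Vec V k) x → Dec (Root d c ρ x)
  root? {k} d c ρ x = map′ (Equivalence.to h) (Equivalence.from h) (sat? (rootF d c rs zero) (x ∷ ρ))
    where
    rs : Vec (Fin (suc k)) k
    rs = ↑ (Vec.allFin k)
    h : Sat 𝔄 (rootF d c rs zero) (x ∷ ρ) [] ⇔ Root d c ρ x
    h = sat-rootF {env = x ∷ ρ} {rs = rs} (lift≡ {env = ρ} {rs = Vec.allFin k} {z = x} (map-lookup-allFin ρ)) d c zero

  atLeast? : ∀ d c j (ρ : Vec V k) → Dec (AtLeast d c j ρ [])
  atLeast? {k} d c j ρ = map′ (Equivalence.to h) (Equivalence.from h) (sat? (atLeastF d c j (Vec.allFin k) []) ρ)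
    where
    h : Sat 𝔄 (atLeastF d c j (Vec.allFin k) []) ρ [] ⇔ AtLeast d c j ρ []
    h = sat-atLeastF {env = ρ} {rs = Vec.allFin k} (map-lookup-allFin ρ) d c j []

  module _ (d : ℕ) (ρ : Vec V k) where

    root-conn : ∀ {c x y} → Conn ρ x y → Root d c ρ y → Root d c ρ x
    root-conn w (r , w′ , rest) = r , w ◅◅ w′ , rest

    first-conn : ∀ {c x y} → Conn ρ x y → First d c ρ y → First d c ρ x
    first-conn w (rt , min) = root-conn w rt , λ c′ lt rt′ → min c′ lt (root-conn (walk-sym G w) rt′)

    first-unique : ∀ {c c′ x} → First d c ρ x → First d c′ ρ x → c ≡ c′
    first-unique (rt , min) (rt′ , min′) = toℕ-injective
      (≤-antisym (≮⇒≥ λ lt → min _ lt rt′) (≮⇒≥ λ lt → min′ _ lt rt))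

    -- Each witness is connected to an element of `ys`, which is then removed. Later witnesses are
    -- in other components, so they remain covered.
    atLeast⇒≤ : ∀ {c} j {zs : Vec V i} ys → AtLeast d c j ρ zs →
      (∀ z → z ∈ₛ below-path ρ → First d c ρ z → (∀ m → ¬ Conn ρ z (lookup zs m)) → ∃[ y ] y ∈ ys × Conn ρ z y) →
      j ≤ length ys
    atLeast⇒≤ zero    ys _ _ = z≤n
    atLeast⇒≤ {c = c} (suc j) {zs} ys (z , z∈ , fz , apart , rest) cover
      with y , y∈ , w ← cover z z∈ fz apart
      with as , bs , refl ← ∈-∃++ y∈ = ≤-trans (s≤s (atLeast⇒≤ j (as ++ bs) rest cover′)) (≤-reflexive (sym (length-++-sucʳ as y bs)))
      where
      remove : ∀ as {x y : V} {bs} → x ∈ as ++ y ∷ bs → x ≡ y ⊎ x ∈ as ++ bs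
      remove []       (here eq)   = inj₁ eq
      remove []       (there x∈)  = inj₂ x∈
      remove (_ ∷ as) (here eq)   = inj₂ (here eq)
      remove (_ ∷ as) (there x∈) with remove as x∈
      ... | inj₁ eq  = inj₁ eq
      ... | inj₂ x∈′ = inj₂ (there x∈′)
      cover′ : ∀ z′ → z′ ∈ₛ below-path ρ → First d c ρ z′ → (∀ m → ¬ Conn ρ z′ (lookup (z ∷ zs) m)) →
               ∃[ y ] y ∈ as ++ bs × Conn ρ z′ y
      cover′ z′ z′∈ fz′ apart′ with cover z′ z′∈ fz′ (apart′ ∘ suc)
      ... | y′ , y′∈ , w′ with remove as y′∈
      ...   | inj₁ refl = contradiction (w′ ◅◅ walk-sym G w) (apart′ zero)
      ...   | inj₂ y′∈′ = y′ , y′∈′ , w′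

    ≤⇒atLeast : ∀ {c} j {zs : Vec V i} ys → All (λ y → y ∈ₛ below-path ρ × First d c ρ y) ys →
      AllPairs (λ y y′ → ¬ Conn ρ y y′) ys → (∀ {y} → y ∈ ys → ∀ m → ¬ Conn ρ y (lookup zs m)) →
      j ≤ length ys → AtLeast d c j ρ zs
    ≤⇒atLeast zero    ys _ _ _ _ = zero , refl
    ≤⇒atLeast (suc j) {zs} (y ∷ ys) ((y∈ , fy) ∷ good) (ap ∷ aps) apart (s≤s le) =
      y , y∈ , fy , apart (here refl) , ≤⇒atLeast j ys good aps
        (λ y′∈ → ∀-cons (λ w → All.lookup ap y′∈ (walk-sym G w)) (apart (there y′∈))) le

    Representatives : List (V × Fin (M d)) → Set
    Representatives ps = All (λ (x , c) → x ∈ₛ below-path ρ × First d c ρ x) ps ×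
                         AllPairs (λ p q → ¬ Conn ρ (proj₁ p) (proj₁ q)) ps

    -- Greedy choice: a vertex is added, with the least code that a root of its component yields,
    -- unless its component is already represented.
    representatives : ¬ (∃[ x ] x ∈ₛ below-path ρ × (∀ c → ¬ Root d c ρ x)) → ∀ vs →
      ∃[ ps ] Representatives ps × (∀ {y} → y ∈ vs → y ∈ₛ below-path ρ → ∃[ p ] p ∈ ps × Conn ρ y (proj₁ p))
    representatives rooted [] = [] , ([] , []) , λ ()
    representatives rooted (v ∷ vs) with ps , (good , apart) , cover ← representatives rooted vs | v ∈ₛ? below-path ρ
    ... | no v∉ = ps , (good , apart) , λ { (here refl) v∈ → contradiction v∈ v∉ ; (there y∈) → cover y∈ }
    ... | yes v∈ with Any.any? (λ p → walk? G (below-path ρ) v (proj₁ p)) ps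
    ...   | yes conn-v = ps , (good , apart) , λ { (here refl) _ → find conn-v ; (there y∈) → cover y∈ }
    ...   | no ¬conn-v =
      let c , f = least (λ c → root? d c ρ v) (¬∀¬⇒∃ λ none → rooted (v , v∈ , none))
      in (v , c) ∷ ps , ((v∈ , f) ∷ good , ¬Any⇒All¬ ps ¬conn-v ∷ apart) ,
         λ { (here refl) _ → (v , c) , here refl , ε
           ; (there y∈) y∈S → let p , p∈ , w = cover y∈ y∈S in p , there p∈ , w }
      where
      ¬∀¬⇒∃ : ¬ (∀ c → ¬ Root d c ρ v) → ∃[ c ] Root d c ρ v
      ¬∀¬⇒∃ h = decidable-stable (any? λ c → root? d c ρ v) λ ¬∃ → h λ c rt → ¬∃ (c , rt)

    module _ (subtree : ∀ r τ → HasType d (r ∷ ρ) τ →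
                Σ[ g ∈ Forest (Node 𝔄 dec) d ] Elim 𝔄 dec (r ∷ Vec.toList ρ) (below-path (r ∷ ρ)) g × code t (mapF proj₂ g) ≡ τ) where

      -- One tree per representative: the root is the one that witnesses its code, and the children
      -- come from `subtree`. The last two hypotheses say that `S` is the union of the components
      -- that are still to be treated.
      assemble : ∀ ps → Representatives ps → ∀ S → S ⊆ below-path ρ →
        (∀ y → y ∈ₛ S → ∃[ p ] p ∈ ps × Conn ρ (proj₁ p) y) →
        (∀ y → y ∈ₛ below-path ρ → ∀ p → p ∈ ps → Conn ρ (proj₁ p) y → y ∈ₛ S) →
        Σ[ f ∈ Forest (Node 𝔄 dec) (suc d) ] Elim 𝔄 dec (Vec.toList ρ) S f × codes t (mapF proj₂ f) ≡ map proj₂ ps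
      assemble [] _ S S⊆ covered _ =
        [] , empty (λ y y∈ → case proj₁ (proj₂ (covered y y∈)) of λ ()) , refl
      assemble ((x , c) ∷ ps) ((x∈ , (r , w , lbl , ht) , _) ∷ good , ap ∷ apart) S S⊆ covered closed =
        let g , eg , cg = subtree r _ ht
            f , ef , cf = assemble ps (good , apart) (S ─ K) (S⊆ ∘ p─q⊆p S K) covered′ closed′
        in node (r , quotient {ℓ} (#types d) c) g f
         , tree K (∈comp⁺ G ε) K⊆S (λ u∈ v∈ adj → ∈comp⁺ G (∈comp⁻ G u∈ ◅◅ ((comp⊆ G r∈ u∈ , S⊆ v∈ , adj) ◅ ε))) lbl eg ef
         , cong₂ _∷_ (trans (cong (combine (quotient {ℓ} (#types d) c)) cg) (combine-remQuot {ℓ} (#types d) c)) cf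
        where
        r∈ : r ∈ₛ below-path ρ
        r∈ = walk-∈ G x∈ w
        K : Subset (suc order)
        K = comp G (below-path ρ) r
        K⊆S : K ⊆ S
        K⊆S y∈ = closed _ (comp⊆ G r∈ y∈) (x , c) (here refl) (w ◅◅ ∈comp⁻ G y∈)
        covered′ : ∀ y → y ∈ₛ S ─ K → ∃[ p ] p ∈ ps × Conn ρ (proj₁ p) y
        covered′ y y∈ with covered y (p─q⊆p S K y∈)
        ... | _ , here refl , w′ = contradiction (∈comp⁺ G (walk-sym G w ◅◅ w′)) (x∈p─q⇒x∉q S K y∈)
        ... | p , there p∈ , w′ = p , p∈ , w′
        closed′ : ∀ y → y ∈ₛ below-path ρ → ∀ p → p ∈ ps → Conn ρ (proj₁ p) y → y ∈ₛ S ─ K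
        closed′ y y∈ p p∈ w′ = x∈p∧x∉q⇒x∈p─q (closed y y∈ p (there p∈) w′)
          λ y∈K → All.lookup ap p∈ (w ◅◅ ∈comp⁻ G y∈K ◅◅ walk-sym G w′)

  -- The representatives list each component once, with its least code, so `AtLeast` compares with
  -- the number of entries of `ps` that have a given code. Up to the cap these numbers are the
  -- counts in `τ`.
  sound : ∀ d (ρ : Vec V k) τ → HasType d ρ τ →
          Σ[ f ∈ Forest (Node 𝔄 dec) d ] Elim 𝔄 dec (Vec.toList ρ) (below-path ρ) f × code t (mapF proj₂ f) ≡ τ
  sound zero    ρ zero none = [] , empty (λ x x∈ → none (x , x∈)) , refl
  sound (suc d) ρ τ (rooted , counts)
    with ps , (good , apart) , cover ← representatives d ρ rooted (allFin (suc order))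
    with f , ef , cf ← assemble d ρ (λ r → sound d (r ∷ ρ)) ps (good , apart) (below-path ρ) id
           (λ y y∈ → let p , p∈ , w = cover (∈-allFin y) y∈ in p , p∈ , walk-sym G w) (λ y y∈ _ _ _ → y∈) =
    f , ef , trans (code-cong {t = t} {f = mapF proj₂ f} {h = λ c → toℕ (m c)} capped)
      (trans (funToFin-cong λ c → cap-toℕ (m c)) (funToFin-finToFin {M d} {suc (t d)} τ))
    where
    m : Fin (M d) → Fin (suc (t d))
    m = finToFun τ
    ys : Fin (M d) → List V
    ys c = select c ps
    good′ : ∀ c → All (λ y → y ∈ₛ below-path ρ × First d c ρ y) (ys c)
    good′ c = All.tabulate λ y∈ → All.lookup good (select⁻ ps y∈)
    upper : ∀ c j → AtLeast d c j ρ [] → j ≤ length (ys c)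
    upper c j al = atLeast⇒≤ d ρ j (ys c) al λ z z∈ fz _ →
      let (x , c′) , p∈ , w = cover (∈-allFin z) z∈
          eq = first-unique d ρ (proj₂ (All.lookup good p∈)) (first-conn d ρ (walk-sym G w) fz)
      in x , select⁺ (subst (λ c → (x , c) ∈ ps) eq p∈) , w
    lower : ∀ c j → j ≤ length (ys c) → AtLeast d c j ρ []
    lower c j = ≤⇒atLeast d ρ j (ys c) (good′ c) (select-AllPairs c apart) λ _ ()
    capped′ : ∀ c → length (ys c) ⊓ t d ≡ toℕ (m c) ⊓ t d
    capped′ c with toℕ (m c) <ℕ? t d
    ... | yes lt = cong (_⊓ t d) (≤-antisym (≮⇒≥ λ lt′ → proj₂ (counts c) lt (lower c _ lt′)) (upper c _ (proj₁ (counts c))))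
    ... | no ≮ = ⊓-both (≤-trans (≮⇒≥ ≮) (upper c _ (proj₁ (counts c)))) (≮⇒≥ ≮)
    capped : ∀ c → occ c (codes t (mapF proj₂ f)) ⊓ t d ≡ toℕ (m c) ⊓ t d
    capped c = trans (cong (_⊓ t d) (trans (cong (occ c) cf) (sym (length-select c ps)))) (capped′ c)

  -- `Low` gives each component a root, below which there is a type by induction, and `full` gives
  -- that root a label. The counts are found by search.
  complete : ∀ d (ρ : Vec V k) → Low G d (below-path ρ) → ∃[ τ ] HasType d ρ τ
  complete zero    ρ none = zero , λ (x , x∈) → none x x∈
  complete (suc d) ρ lowρ = funToFin m , rooted , λ c →
    subst (λ j → Count d c j ρ) (sym (finToFun-funToFin m c)) (proj₂ (counted c))
    where
    counted : ∀ c → ∃[ j ] Count d c j ρ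
    counted c = greatest (t d) (λ j → atLeast? d c j ρ) (zero , refl)
    m : Fin (M d) → Fin (suc (t d))
    m c = proj₁ (counted c)
    rooted : ¬ (∃[ x ] x ∈ₛ below-path ρ × (∀ c → ¬ Root d c ρ x))
    rooted (x , x∈ , none)
      with r , r∈ , low′ ← lowρ x x∈
      with τ , ht ← complete d (r ∷ ρ) (low-⊆ G d (-‿mono λ y∈ → ∈comp⁺ G (∈comp⁻ G r∈ ◅◅ ∈comp⁻ G y∈)) low′)
      with c , lbl ← Table.full (atomTable σ D) (λ (R , e) → interp R (Vec.map (λ i → nth r (r ∷ Vec.toList ρ) (toℕ i)) e)) =
      none (combine c τ) (r , ∈comp⁻ G r∈ ,
        subst (λ c → HasLabel c r ρ) (sym (cong proj₁ (remQuot-combine c τ))) (λ R e → lbl (R , e)) ,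
        subst (HasType d (r ∷ ρ)) (sym (cong proj₂ (remQuot-combine c τ))) ht)

-- Quantifier alternation

module _ {σ : Signature} where

  private variable
    L : Logic
    k m n : ℕ

  change≤1 : ∀ q q′ → change q q′ ≤ 1
  change≤1 nothing    q′  = z≤n
  change≤1 (just ex)  ex  = z≤n
  change≤1 (just ex)  all = ≤-refl
  change≤1 (just all) ex  = ≤-refl
  change≤1 (just all) all = z≤n

  -- The context affects only the first quantifier on each path.
  alternations-change : ∀ q q′ (φ : Formula σ L k m) → alternations q φ ≤ suc (alternations q′ φ)
  alternations-change q q′ (rel R xs) = z≤n
  alternations-change q q′ (x ≐ y)    = z≤n
  alternations-change q q′ (x ∈ˢ X)   = z≤n
  alternations-change q q′ (¬ᶠ φ)     = alternations-change q q′ φ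
  alternations-change q q′ (φ ∧ᶠ ψ)   = ⊔-mono-≤ (alternations-change q q′ φ) (alternations-change q q′ ψ)
  alternations-change q q′ (φ ∨ᶠ ψ)   = ⊔-mono-≤ (alternations-change q q′ φ) (alternations-change q q′ ψ)
  alternations-change q q′ (∃ᶠ φ)     = +-mono-≤ (change≤1 q ex)  (m≤n+m _ (change q′ ex))
  alternations-change q q′ (∀ᶠ φ)     = +-mono-≤ (change≤1 q all) (m≤n+m _ (change q′ all))
  alternations-change q q′ (∃ˢ φ)     = +-mono-≤ (change≤1 q ex)  (m≤n+m _ (change q′ ex))
  alternations-change q q′ (∀ˢ φ)     = +-mono-≤ (change≤1 q all) (m≤n+m _ (change q′ all))

  alternations-nothing : ∀ q (φ : Formula σ L k m) → alternations nothing φ ≤ alternations q φ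
  alternations-nothing q (rel R xs) = z≤n
  alternations-nothing q (x ≐ y)    = z≤n
  alternations-nothing q (x ∈ˢ X)   = z≤n
  alternations-nothing q (¬ᶠ φ)     = alternations-nothing q φ
  alternations-nothing q (φ ∧ᶠ ψ)   = ⊔-mono-≤ (alternations-nothing q φ) (alternations-nothing q ψ)
  alternations-nothing q (φ ∨ᶠ ψ)   = ⊔-mono-≤ (alternations-nothing q φ) (alternations-nothing q ψ)
  alternations-nothing q (∃ᶠ φ)     = m≤n+m _ (change q ex)
  alternations-nothing q (∀ᶠ φ)     = m≤n+m _ (change q all)
  alternations-nothing q (∃ˢ φ)     = m≤n+m _ (change q ex)
  alternations-nothing q (∀ˢ φ)     = m≤n+m _ (change q all)

  -- φ and ¬ φ are bounded together, so that negation preserves Alt n; it takes Alt∃ n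
  -- to Alt∃ (suc n).
  record Alt (n : ℕ) (φ : Formula σ L k m) : Set where
    constructor alt
    field
      pos : alternations nothing (nnf φ) ≤ n
      neg : alternations nothing (nnf¬ φ) ≤ n

  record Alt∃ (n : ℕ) (φ : Formula σ L k m) : Set where
    constructor alt∃
    field
      pos : alternations (just ex) (nnf φ) ≤ n
      neg : alternations (just all) (nnf¬ φ) ≤ n

  private variable
    φ ψ : Formula σ L k m

  alt⇒alt∃ : Alt n φ → Alt∃ (suc n) φ
  alt⇒alt∃ {φ = φ} (alt p q) = alt∃ (≤-trans (alternations-change _ nothing (nnf φ)) (s≤s p))
                                    (≤-trans (alternations-change _ nothing (nnf¬ φ)) (s≤s q))

  alt∃⇒alt : Alt∃ n φ → Alt n φ
  alt∃⇒alt {φ = φ} (alt∃ p q) = alt (≤-trans (alternations-nothing _ (nnf φ)) p)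
                                    (≤-trans (alternations-nothing _ (nnf¬ φ)) q)

  alt-¬ : Alt n φ → Alt n (¬ᶠ φ)
  alt-¬ (alt p q) = alt q p

  alt-∧ : Alt n φ → Alt n ψ → Alt n (φ ∧ᶠ ψ)
  alt-∧ (alt p q) (alt p′ q′) = alt (⊔-lub p p′) (⊔-lub q q′)

  alt-∨ : Alt n φ → Alt n ψ → Alt n (φ ∨ᶠ ψ)
  alt-∨ (alt p q) (alt p′ q′) = alt (⊔-lub p p′) (⊔-lub q q′)

  alt∃-∧ : Alt∃ n φ → Alt∃ n ψ → Alt∃ n (φ ∧ᶠ ψ)
  alt∃-∧ (alt∃ p q) (alt∃ p′ q′) = alt∃ (⊔-lub p p′) (⊔-lub q q′)

  alt∃-∨ : Alt∃ n φ → Alt∃ n ψ → Alt∃ n (φ ∨ᶠ ψ)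
  alt∃-∨ (alt∃ p q) (alt∃ p′ q′) = alt∃ (⊔-lub p p′) (⊔-lub q q′)

  alt∃-∃ : Alt∃ n φ → Alt∃ n (∃ᶠ φ)
  alt∃-∃ (alt∃ p q) = alt∃ p q

  alt∃-¬ : Alt∃ n φ → Alt∃ (suc n) (¬ᶠ φ)
  alt∃-¬ p = alt⇒alt∃ (alt-¬ (alt∃⇒alt p))

  alt∃-≤ : ∀ {n n′} → n ≤ n′ → Alt∃ n φ → Alt∃ n′ φ
  alt∃-≤ le (alt∃ p q) = alt∃ (≤-trans p le) (≤-trans q le)

module _ (σ : Signature) (D : ℕ) where
  open Describe σ D

  private variable
    v k n : ℕ

  alt∃-⋀ : ∀ j {φ : Fin j → Fo v} → (∀ i → Alt∃ n (φ i)) → Alt∃ n (⋀ j φ)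
  alt∃-⋀ zero    _     = alt∃ z≤n z≤n
  alt∃-⋀ (suc j) h = alt∃-∧ (h zero) (alt∃-⋀ j (h ∘ suc))

  alt∃-⋁ : ∀ j {φ : Fin j → Fo v} → (∀ i → Alt∃ n (φ i)) → Alt∃ n (⋁ j φ)
  alt∃-⋁ zero    _     = alt∃ z≤n z≤n
  alt∃-⋁ (suc j) h = alt∃-∨ (h zero) (alt∃-⋁ j (h ∘ suc))

  alt-⋀ : ∀ j {φ : Fin j → Fo v} → (∀ i → Alt n (φ i)) → Alt n (⋀ j φ)
  alt-⋀ zero    _     = alt z≤n z≤n
  alt-⋀ (suc j) h = alt-∧ (h zero) (alt-⋀ j (h ∘ suc))

  alt-⋁ : ∀ j {φ : Fin j → Fo v} → (∀ i → Alt n (φ i)) → Alt n (⋁ j φ)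
  alt-⋁ zero    _     = alt z≤n z≤n
  alt-⋁ (suc j) h = alt-∨ (h zero) (alt-⋁ j (h ∘ suc))

  alt∃-⋀ᵛ : ∀ a {φ : Vec (Fin D) a → Fo v} → (∀ e → Alt∃ n (φ e)) → Alt∃ n (⋀ᵛ a φ)
  alt∃-⋀ᵛ zero    h = h []
  alt∃-⋀ᵛ (suc a) h = alt∃-⋀ D λ i → alt∃-⋀ᵛ a λ e → h (i ∷ e)

  alt∃-∃* : ∀ a {φ : Fo (a + v)} → Alt∃ n φ → Alt∃ n (∃* a φ)
  alt∃-∃* zero    p = p
  alt∃-∃* (suc a) p = alt∃-∃* a (alt∃-∃ p)

  alt∃-guard : ∀ b {φ : Fo v} → Alt∃ n φ → Alt∃ n (guard b φ)
  alt∃-guard true  p = p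
  alt∃-guard false p = alt∃ z≤n z≤n

  alt∃-adjF : ∀ (x y : Fin v) → Alt∃ 0 (adjF x y)
  alt∃-adjF {v} x y = alt∃-∧ (alt∃ z≤n z≤n) (alt∃-⋁ (symbols σ) λ R →
    alt∃-∃* (arity σ R) (alt∃-∧ (alt∃ z≤n z≤n)
      (alt∃-∧
        (alt∃-⋁ (arity σ R) λ i → alt∃ z≤n z≤n) (alt∃-⋁ (arity σ R) λ i → alt∃ z≤n z≤n))))

  alt∃-insideF : ∀ k (rs : Vec (Fin v) k) y → Alt∃ 0 (insideF k rs y)
  alt∃-walkF   : ∀ k l (rs : Vec (Fin v) k) x y → Alt∃ 0 (walkF k l rs x y)
  alt∃-insideF zero    []       y = alt∃ z≤n z≤n
  alt∃-insideF (suc k) (r ∷ rs) y =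
    alt∃-∧ (alt∃-walkF k (walkBound D) rs r y) (alt∃ z≤n z≤n)
  alt∃-walkF k zero    rs x y = alt∃ z≤n z≤n
  alt∃-walkF k (suc l) rs x y = alt∃-∨ (alt∃ z≤n z≤n) (alt∃-∃ (alt∃-∧
      (alt∃-∧ (alt∃-insideF k (↑ rs) (suc x))
        (alt∃-∧ (alt∃-insideF k (↑ rs) zero) (alt∃-adjF (suc x) zero)))
      (alt∃-walkF k l (↑ rs) zero (suc y))))

  alt∃-connF : ∀ (rs : Vec (Fin v) k) x y → Alt∃ 0 (connF rs x y)
  alt∃-connF {k = k} = alt∃-walkF k (walkBound D)

  alt∃-labelF : ∀ c r (rs : Vec (Fin v) k) → Alt∃ 0 (labelF c r rs)
  alt∃-labelF c r rs = alt∃-⋀ (symbols σ) λ R → alt∃-⋀ᵛ (arity σ R) λ e → literal-ok (atomsOf σ D c R e) R _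
    where
    literal-ok : ∀ b R (xs : Vec (Fin _) (arity σ R)) → Alt∃ 0 (literal b (rel R xs))
    literal-ok true  R xs = alt∃ z≤n z≤n
    literal-ok false R xs = alt∃ z≤n z≤n

module _ (σ : Signature) (D : ℕ) (t : ℕ → ℕ) where
  open DescribeTypes σ D t

  private variable
    v k i : ℕ

  -- The two alternations of a level: one where `rootF` puts an existential quantifier before
  -- `typeF`, one where `firstF` negates `rootF` for the smaller codes. The remaining negations fit
  -- into the same bound.
  alt-typeF     : ∀ d (rs : Vec (Fin v) k) τ → Alt (d * 2) (typeF d rs τ)
  alt∃-rootF    : ∀ d c (rs : Vec (Fin v) k) x → Alt∃ (1 + d * 2) (rootF d c rs x)
  alt∃-firstF   : ∀ d c (rs : Vec (Fin v) k) x → Alt∃ (2 + d * 2) (firstF d c rs x)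
  alt∃-atLeastF : ∀ d c j (rs : Vec (Fin v) k) (zs : Vec (Fin v) i) → Alt∃ (2 + d * 2) (atLeastF d c j rs zs)
  alt-countF    : ∀ d c m (rs : Vec (Fin v) k) → Alt (2 + d * 2) (countF d c m rs)

  alt-typeF {k = k} zero    rs τ =
    alt-¬ (alt∃⇒alt (alt∃-∃ (alt∃-insideF σ D k (↑ rs) zero)))
  alt-typeF {k = k} (suc d) rs τ = alt-∧
    (alt-¬ (alt∃⇒alt (alt∃-∃ (alt∃-∧ (alt∃-≤ z≤n (alt∃-insideF σ D k (↑ rs) zero))
      (alt∃-⋀ σ D (ℓ * #types d) λ c → alt∃-¬ (alt∃-rootF d c (↑ rs) zero))))))
    (alt-⋀ σ D (ℓ * #types d) λ c → alt-countF d c _ rs)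

  alt∃-rootF d c rs x = alt∃-∃ (alt∃-∧ (alt∃-≤ z≤n (alt∃-connF σ D (↑ rs) (suc x) zero))
    (alt∃-∧ (alt∃-≤ z≤n (alt∃-labelF σ D (quotient {ℓ} (#types d) c) zero (↑ rs)))
      (alt⇒alt∃ (alt-typeF d (zero ∷ ↑ rs) _))))

  alt∃-firstF d c rs x = alt∃-∧ (alt∃-≤ (n≤1+n _) (alt∃-rootF d c rs x))
    (alt∃-⋀ σ D (ℓ * #types d) λ c′ → alt∃-guard σ D (does (toℕ c′ <ℕ? toℕ c)) (alt∃-¬ (alt∃-rootF d c′ rs x)))

  alt∃-atLeastF d c zero    rs zs = alt∃ z≤n z≤n
  alt∃-atLeastF {k = k} {i} d c (suc j) rs zs =
    alt∃-∃ (alt∃-∧ (alt∃-≤ z≤n (alt∃-insideF σ D k (↑ rs) zero))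
    (alt∃-∧ (alt∃-firstF d c (↑ rs) zero)
    (alt∃-∧ (alt∃-⋀ σ D i λ m → alt∃-≤ (s≤s z≤n) (alt∃-¬ (alt∃-connF σ D (↑ rs) zero (lookup (↑ zs) m))))
      (alt∃-atLeastF d c j (↑ rs) (zero ∷ ↑ zs)))))

  alt-countF d c m rs = alt-∧ (alt∃⇒alt (alt∃-atLeastF d c (toℕ m) rs [])) (guarded (does (toℕ m <ℕ? t d)))
    where
    guarded : ∀ b → Alt (2 + d * 2) (guard b (¬ᶠ atLeastF d c (suc (toℕ m)) rs []))
    guarded true  = alt-¬ (alt∃⇒alt (alt∃-atLeastF d c (suc (toℕ m)) rs []))
    guarded false = alt z≤n z≤n

-- Size

-- Takes the place of a maximum: it bounds each of the values.
sumTo : ∀ n → (Fin n → ℕ) → ℕ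
sumTo zero    h = 0
sumTo (suc n) h = h zero + sumTo n (h ∘ suc)

≤sumTo : ∀ {n} (h : Fin n → ℕ) i → h i ≤ sumTo n h
≤sumTo h zero    = m≤m+n _ _
≤sumTo h (suc i) = ≤-trans (≤sumTo (h ∘ suc) i) (m≤n+m _ (h zero))

-- 6 is the size of ⊥ᶠ, and at least that of ⊤ᶠ.
junction : ℕ → ℕ → ℕ
junction j b = j * suc b + 6

module SizeBounds (σ : Signature) (D : ℕ) where
  open Describe σ D

  private variable
    v k : ℕ

  size-⋀ : ∀ j {φ : Fin j → Fo v} {b} → (∀ i → size (φ i) ≤ b) → size (⋀ j φ) ≤ junction j b
  size-⋀ zero    h = n≤1+n 5
  size-⋀ (suc j) {b = b} h = s≤s (≤-trans (+-mono-≤ (h zero) (size-⋀ j (h ∘ suc))) (≤-reflexive (sym (+-assoc b _ 6))))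

  size-⋁ : ∀ j {φ : Fin j → Fo v} {b} → (∀ i → size (φ i) ≤ b) → size (⋁ j φ) ≤ junction j b
  size-⋁ zero    h = ≤-refl
  size-⋁ (suc j) {b = b} h = s≤s (≤-trans (+-mono-≤ (h zero) (size-⋁ j (h ∘ suc))) (≤-reflexive (sym (+-assoc b _ 6))))

  ⋀ᵛ-bound : ℕ → ℕ → ℕ
  ⋀ᵛ-bound zero    b = b
  ⋀ᵛ-bound (suc a) b = junction D (⋀ᵛ-bound a b)

  size-⋀ᵛ : ∀ a {φ : Vec (Fin D) a → Fo v} {b} → (∀ e → size (φ e) ≤ b) → size (⋀ᵛ a φ) ≤ ⋀ᵛ-bound a b
  size-⋀ᵛ zero    h = h []
  size-⋀ᵛ (suc a) h = size-⋀ D λ i → size-⋀ᵛ a λ e → h (i ∷ e)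

  size-∃* : ∀ a (φ : Fo (a + v)) → size (∃* a φ) ≡ a * 2 + size φ
  size-∃* zero    φ = refl
  size-∃* (suc a) φ = trans (size-∃* a (∃ᶠ φ)) (trans (+-suc (a * 2) _) (cong suc (+-suc (a * 2) _)))

  size-guard : ∀ b {φ : Fo v} {s} → size φ ≤ s → size (guard b φ) ≤ s + 5
  size-guard true  le = ≤-trans le (m≤m+n _ 5)
  size-guard false le = m≤n+m 5 _

  tuple-bound adj-bound : ℕ
  tuple-bound = sumTo (symbols σ) λ R →
    arity σ R * 2 + (2 + arity σ R + (1 + junction (arity σ R) 3 + junction (arity σ R) 3))
  adj-bound = 5 + junction (symbols σ) tuple-bound

  size-adjF : ∀ (x y : Fin v) → size (adjF x y) ≤ adj-bound
  size-adjF {v} x y = +-monoʳ-≤ 5 (size-⋁ (symbols σ) λ R →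
    ≤-trans (≤-trans (≤-reflexive (size-∃* (arity σ R) _)) (+-monoʳ-≤ (arity σ R * 2) (s≤s (s≤s (+-monoʳ-≤ (arity σ R) (s≤s
      (+-mono-≤ (size-⋁ (arity σ R) (λ i → ≤-refl)) (size-⋁ (arity σ R) (λ i → ≤-refl)))))))))
      (≤sumTo (λ R → arity σ R * 2 + (2 + arity σ R + (1 + junction (arity σ R) 3 + junction (arity σ R) 3))) R))

  inside-bound : ℕ → ℕ
  walk-bound   : ℕ → ℕ → ℕ
  inside-bound zero    = 3
  inside-bound (suc k) = 1 + walk-bound k (walkBound D) + 4
  walk-bound k zero    = 3
  walk-bound k (suc l) = 4 + (2 + (1 + (1 + inside-bound k + (1 + inside-bound k + adj-bound)) + walk-bound k l))

  size-insideF : ∀ k (rs : Vec (Fin v) k) y → size (insideF k rs y) ≤ inside-bound k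
  size-walkF   : ∀ k l (rs : Vec (Fin v) k) x y → size (walkF k l rs x y) ≤ walk-bound k l
  size-insideF zero    []       y = ≤-refl
  size-insideF (suc k) (r ∷ rs) y = s≤s (+-monoˡ-≤ 4 (size-walkF k (walkBound D) rs r y))
  size-walkF k zero    rs x y = ≤-refl
  size-walkF k (suc l) rs x y = +-monoʳ-≤ 7 (+-mono-≤
    (s≤s (+-mono-≤ (size-insideF k (↑ rs) (suc x)) (s≤s (+-mono-≤ (size-insideF k (↑ rs) zero) (size-adjF (suc x) zero)))))
    (size-walkF k l (↑ rs) zero (suc y)))

  label-bound : ℕ
  label-bound = junction (symbols σ) (sumTo (symbols σ) λ R → ⋀ᵛ-bound (arity σ R) (2 + arity σ R))

  size-labelF : ∀ c r (rs : Vec (Fin v) k) → size (labelF c r rs) ≤ label-bound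
  size-labelF c r rs = size-⋀ (symbols σ) λ R → ≤-trans
    (size-⋀ᵛ (arity σ R) λ e → size-literal (atomsOf σ D c R e) R _)
    (≤sumTo (λ R → ⋀ᵛ-bound (arity σ R) (2 + arity σ R)) R)
    where
    size-literal : ∀ b R (xs : Vec (Fin _) (arity σ R)) → size (literal b (rel R xs)) ≤ 2 + arity σ R
    size-literal true  R xs = n≤1+n _
    size-literal false R xs = ≤-refl

  path-bound : Fin (suc D) → ℕ
  path-bound k = inside-bound (toℕ k) + walk-bound (toℕ k) (walkBound D)

  -- Depends on `σ` and `D` only: the formulas about labels and about the part below a path of
  -- length at most `D` involve no thresholds, so they are constant as the quantifier rank grows.
  base-bound : ℕ
  base-bound = sumTo (suc D) path-bound + label-bound

  private
    ≤base : k ≤ D → inside-bound k + walk-bound k (walkBound D) ≤ base-bound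
    ≤base k≤D = ≤-trans (subst (λ k → inside-bound k + walk-bound k (walkBound D) ≤ sumTo (suc D) path-bound)
      (toℕ-fromℕ< (s≤s k≤D)) (≤sumTo path-bound (fromℕ< (s≤s k≤D)))) (m≤m+n (sumTo (suc D) path-bound) label-bound)

  inside≤base : k ≤ D → ∀ (rs : Vec (Fin v) k) y → size (insideF k rs y) ≤ base-bound
  inside≤base k≤D rs y = ≤-trans (size-insideF _ rs y) (≤-trans (m≤m+n _ _) (≤base k≤D))

  conn≤base : k ≤ D → ∀ (rs : Vec (Fin v) k) x y → size (connF rs x y) ≤ base-bound
  conn≤base {k} k≤D rs x y =
    ≤-trans (size-walkF k (walkBound D) rs x y) (≤-trans (m≤n+m _ (inside-bound k)) (≤base k≤D))

  label≤base : ∀ c r (rs : Vec (Fin v) k) → size (labelF c r rs) ≤ base-bound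
  label≤base c r rs = ≤-trans (size-labelF c r rs) (m≤n+m label-bound (sumTo (suc D) path-bound))

module TypeSize (σ : Signature) (D : ℕ) (t : ℕ → ℕ) where
  open DescribeTypes σ D t
  open SizeBounds σ D

  private
    C : ℕ
    C = base-bound

    M : ℕ → ℕ
    M d = ℓ * #types d

    variable
      v k i : ℕ

  type-bound root-bound first-bound step-bound atLeast-bound : ℕ → ℕ
  type-bound zero    = 3 + C
  type-bound (suc d) = 1 + (3 + (1 + C + junction (M d) (1 + root-bound d))) +
                       junction (M d) (1 + atLeast-bound d + (1 + atLeast-bound d + 5))
  root-bound d    = 3 + C + (1 + C + type-bound d)
  first-bound d   = 1 + root-bound d + junction (M d) (1 + root-bound d + 5)
  -- The last summand pays for keeping the new witness apart from at most `suc (t d)` earlier ones.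
  step-bound d    = 4 + C + first-bound d + (1 + junction (suc (t d)) (1 + C))
  atLeast-bound d = suc (t d) * step-bound d + 5

  size-typeF    : ∀ d (rs : Vec (Fin v) k) τ → d + k ≤ D → size (typeF d rs τ) ≤ type-bound d
  size-rootF    : ∀ d c (rs : Vec (Fin v) k) x → suc d + k ≤ D → size (rootF d c rs x) ≤ root-bound d
  size-firstF   : ∀ d c (rs : Vec (Fin v) k) x → suc d + k ≤ D → size (firstF d c rs x) ≤ first-bound d
  size-atLeastF : ∀ d c j (rs : Vec (Fin v) k) (zs : Vec (Fin v) i) → suc d + k ≤ D → j + i ≤ suc (t d) →
                  size (atLeastF d c j rs zs) ≤ j * step-bound d + 5
  size-countF   : ∀ d c m (rs : Vec (Fin v) k) → suc d + k ≤ D →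
                  size (countF d c m rs) ≤ 1 + atLeast-bound d + (1 + atLeast-bound d + 5)

  size-typeF {k = k} zero    rs τ le = +-monoʳ-≤ 3 (inside≤base le (↑ rs) zero)
  size-typeF {k = k} (suc d) rs τ le = s≤s (+-mono-≤
    (+-monoʳ-≤ 4 (+-mono-≤ (inside≤base (m+n≤o⇒n≤o (suc d) le) (↑ rs) zero)
      (size-⋀ (M d) λ c → s≤s (size-rootF d c (↑ rs) zero le))))
    (size-⋀ (M d) λ c → size-countF d c _ rs le))

  size-rootF {k = k} d c rs x le = +-monoʳ-≤ 3 (+-mono-≤ (conn≤base (m+n≤o⇒n≤o (suc d) le) (↑ rs) (suc x) zero)
    (s≤s (+-mono-≤ (label≤base (quotient {ℓ} (#types d) c) zero (↑ rs))
      (size-typeF d (zero ∷ ↑ rs) _ (≤-trans (≤-reflexive (+-suc d k)) le)))))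

  size-firstF d c rs x le = s≤s (+-mono-≤ (size-rootF d c rs x le)
    (size-⋀ (M d) λ c′ → size-guard (does (toℕ c′ <ℕ? toℕ c)) (s≤s (size-rootF d c′ rs x le))))

  size-atLeastF d c zero    rs zs le bound = ≤-refl
  size-atLeastF {k = k} {i} d c (suc j) rs zs le bound = begin
    3 + size (insideF k (↑ rs) zero) + (1 + size (firstF d c (↑ rs) zero) + (1 + size (⋀ i apart) + size rest))
      ≤⟨ +-mono-≤ (+-monoʳ-≤ 3 (inside≤base (m+n≤o⇒n≤o (suc d) le) (↑ rs) zero))
          (s≤s (+-mono-≤ (size-firstF d c (↑ rs) zero le) (s≤s (+-mono-≤ apart≤ rest≤)))) ⟩
    3 + C + (1 + F + (1 + J + (j * W + 5)))  ≡⟨ cong (3 + C +_) (+-assoc (1 + F) (1 + J) _) ⟨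
    3 + C + (1 + F + (1 + J) + (j * W + 5))  ≡⟨ +-assoc (3 + C) _ _ ⟨
    3 + C + (1 + F + (1 + J)) + (j * W + 5)  ≡⟨ cong (_+ (j * W + 5)) (trans (sym (+-assoc (3 + C) (1 + F) _)) (cong (_+ (1 + J)) (+-suc (3 + C) F))) ⟩
    W + (j * W + 5)                          ≡⟨ +-assoc W (j * W) 5 ⟨
    suc j * W + 5                            ∎
    where
    open ≤-Reasoning
    F J W : ℕ
    F = first-bound d
    J = junction (suc (t d)) (1 + C)
    W = step-bound d
    apart : Fin i → Fo _
    apart m = ¬ᶠ connF (↑ rs) zero (lookup (↑ zs) m)
    rest : Fo _
    rest = atLeastF d c j (↑ rs) (zero ∷ ↑ zs)
    apart≤ : size (⋀ i apart) ≤ J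
    apart≤ = ≤-trans (size-⋀ i λ m → s≤s (conn≤base (m+n≤o⇒n≤o (suc d) le) (↑ rs) zero (lookup (↑ zs) m)))
      (+-monoˡ-≤ 6 (*-monoˡ-≤ (2 + C) (m+n≤o⇒n≤o (suc j) bound)))
    rest≤ : size rest ≤ j * W + 5
    rest≤ = size-atLeastF d c j (↑ rs) (zero ∷ ↑ zs) le (≤-trans (≤-reflexive (+-suc j i)) bound)

  size-countF d c m rs le = s≤s (+-mono-≤ (≤-trans (size-atLeastF d c (toℕ m) rs [] le m≤)
      (+-monoˡ-≤ 5 (*-monoˡ-≤ (step-bound d) (<⇒≤ (toℕ<n m))))) (guarded (toℕ m <ℕ? t d)))
    where
    m≤ : toℕ m + 0 ≤ suc (t d)
    m≤ = ≤-trans (≤-reflexive (+-identityʳ _)) (<⇒≤ (toℕ<n m))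
    guarded : (lt? : Dec (toℕ m < t d)) → size (guard (does lt?) (¬ᶠ atLeastF d c (suc (toℕ m)) rs [])) ≤ 1 + atLeast-bound d + 5
    guarded (no _)   = m≤n+m 5 (1 + atLeast-bound d)
    guarded (yes lt) = ≤-trans (s≤s (≤-trans
      (size-atLeastF d c (suc (toℕ m)) rs [] le (s≤s (≤-trans (≤-reflexive (+-identityʳ _)) (<⇒≤ lt))))
      (+-monoˡ-≤ 5 (*-monoˡ-≤ (step-bound d) (s≤s (<⇒≤ lt)))))) (m≤m+n (1 + atLeast-bound d) 5)

-- Growth rates

-- d-EXP in a form that is closed under sums, products and (for d > 0) powers with
-- exponents in (d - 1)-EXP.
Growth : ℕ → (ℕ → ℕ) → Set
Growth zero    f = (0 -EXP) f
Growth (suc d) f = Σ[ g ∈ (ℕ → ℕ) ] Growth d g × (∀ n → f n ≤ 2 ^ g n)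

growth⇒EXP : ∀ d {f} → Growth d f → (d -EXP) f
growth⇒EXP zero    p           = p
growth⇒EXP (suc d) (g , p , le) =
  let c , bound = growth⇒EXP d p in c , λ n c<n → ≤-trans (le n) (^-monoʳ-≤ 2 (bound n c<n))

growth-≤ : ∀ d {f g} → (∀ n → f n ≤ g n) → Growth d g → Growth d f
growth-≤ zero    le (c , bound)   = c , λ n c<n → ≤-trans (le n) (bound n c<n)
growth-≤ (suc d) le (h , p , le′) = h , p , λ n → ≤-trans (le n) (le′ n)

n≤2^n : ∀ n → n ≤ 2 ^ n
n≤2^n zero    = z≤n
n≤2^n (suc n) = +-mono-≤ (m^n>0 2 n) (≤-trans (n≤2^n n) (≤-reflexive (sym (+-identityʳ _))))

growth-suc : ∀ d {f} → Growth d f → Growth (suc d) f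
growth-suc d {f} p = f , p , n≤2^n ∘ f

growth-const : ∀ d c → Growth d (λ _ → c)
-- One number is both the exponent and the point from which the bound holds; `suc c` makes `n`
-- exceed `c` and the exponent positive.
growth-const zero    c = suc c , λ n c<n → ≤-trans (≤-trans (n≤1+n c) (<⇒≤ c<n)) (≤-trans (≤-reflexive (sym (^-identityʳ n)))
  (^-monoʳ-≤ n {{>-nonZero (≤-<-trans z≤n c<n)}} {1} {suc c} (s≤s z≤n)))
growth-const (suc d) c = growth-suc d (growth-const d c)

growth-id : ∀ d → Growth d (λ n → n)
growth-id zero    = 1 , λ n _ → ≤-reflexive (sym (^-identityʳ n))
growth-id (suc d) = growth-suc d (growth-id d)

growth-+ : ∀ d {f g} → Growth d f → Growth d g → Growth d (λ n → f n + g n)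
growth-+ zero {f} {g} (c , p) (c′ , q) = suc (c + c′) , λ n lt →
  -- The additional factor `n`, which is at least 2, absorbs the 2 that adding two powers produces.
  let c<n = ≤-<-trans (m≤m+n c c′) (<-trans (n<1+n _) lt)
      c′<n = ≤-<-trans (m≤n+m c′ c) (<-trans (n<1+n _) lt)
      instance n≢0 = >-nonZero (≤-<-trans z≤n lt)
  in begin
    f n + g n                    ≤⟨ +-mono-≤ (p n c<n) (q n c′<n) ⟩
    n ^ c + n ^ c′               ≤⟨ +-mono-≤ (^-monoʳ-≤ n (m≤m+n c c′)) (^-monoʳ-≤ n (m≤n+m c′ c)) ⟩
    n ^ (c + c′) + n ^ (c + c′)  ≡⟨ cong (n ^ (c + c′) +_) (+-identityʳ _) ⟨
    2 * n ^ (c + c′)             ≤⟨ *-monoˡ-≤ (n ^ (c + c′)) (≤-trans (s≤s (s≤s z≤n)) lt) ⟩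
    n * n ^ (c + c′)             ∎
  where open ≤-Reasoning
growth-+ (suc d) {f} {g} (u , p , le) (v , q , le′) =
  (λ n → 1 + (u n + v n)) , growth-+ d (growth-const d 1) (growth-+ d p q) , λ n → begin
    f n + g n                        ≤⟨ +-mono-≤ (le n) (le′ n) ⟩
    2 ^ u n + 2 ^ v n                ≤⟨ +-mono-≤ (^-monoʳ-≤ 2 (m≤m+n (u n) (v n))) (^-monoʳ-≤ 2 (m≤n+m (v n) (u n))) ⟩
    2 ^ (u n + v n) + 2 ^ (u n + v n)  ≡⟨ cong (2 ^ (u n + v n) +_) (+-identityʳ _) ⟨
    2 ^ (1 + (u n + v n))            ∎
  where open ≤-Reasoning

growth-* : ∀ d {f g} → Growth d f → Growth d g → Growth d (λ n → f n * g n)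
growth-* zero {f} {g} (c , p) (c′ , q) = c + c′ , λ n lt → ≤-trans
  (*-mono-≤ (p n (≤-<-trans (m≤m+n c c′) lt)) (q n (≤-<-trans (m≤n+m c′ c) lt)))
  (≤-reflexive (sym (^-distribˡ-+-* n c c′)))
growth-* (suc d) (u , p , le) (v , q , le′) = (λ n → u n + v n) , growth-+ d p q , λ n →
  ≤-trans (*-mono-≤ (le n) (le′ n)) (≤-reflexive (sym (^-distribˡ-+-* 2 (u n) (v n))))

-- Only the exponent has to grow more slowly than the result, by one exponential. This is what
-- allows large thresholds in the base.
growth-^ : ∀ d {f g} → Growth (suc d) f → Growth d g → Growth (suc d) (λ n → f n ^ g n)
growth-^ d {g = g} (u , p , le) q = (λ n → u n * g n) , growth-* d p q , λ n →
  ≤-trans (^-monoˡ-≤ (g n) (le n)) (≤-reflexive (^-*-assoc 2 (u n) (g n)))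

-- Markers cost one exponential, as they make the number of labels exponential: the
-- number of codes with d levels has growth d + 1 with them, but growth d without.
module CodeGrowth (ℓ : ℕ) where

  private
    double : ∀ {n m} → n ≤ ℓ * 2 ^ m → n * 2 ≤ ℓ * 2 ^ suc m
    double {n} {m} le = ≤-trans (*-monoˡ-≤ 2 le) (≤-reflexive (trans (*-assoc ℓ (2 ^ m) 2) (cong (ℓ *_) (*-comm (2 ^ m) 2))))

  -- In `codes≤`, `m` marks have been made and `q` quantifiers are left. A quantifier preserves
  -- `q + m`, so one bound serves the whole recursion of `thr`.
  record CodeBound (d : ℕ) : Set where
    field
      bound  : ℕ → ℕ
      growth : Growth (suc d) bound
      codes≤ : ∀ q m n → n ≤ ℓ * 2 ^ m → #codes n (thr q n) d ≤ bound (q + m)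

    #trees : ℕ → ℕ
    #trees Q = ℓ * 2 ^ Q * bound Q

    #trees-growth : Growth (suc d) #trees
    #trees-growth = growth-* (suc d) (growth-* (suc d) (growth-const (suc d) ℓ)
      (growth-^ d (growth-const (suc d) 2) (growth-id d))) growth

    #trees≤ : ∀ q m n → n ≤ ℓ * 2 ^ m → n * #codes n (thr q n) d ≤ #trees (q + m)
    #trees≤ q m n le = *-mono-≤ (≤-trans le (*-monoʳ-≤ ℓ (^-monoʳ-≤ 2 (m≤n+m m q)))) (codes≤ q m n le)

    counts : ℕ → ℕ
    counts Q = (2 + #trees Q) ^ suc Q

    counts-growth : Growth (suc d) counts
    counts-growth = growth-^ d (growth-+ (suc d) (growth-const (suc d) 2) #trees-growth) (growth-+ d (growth-const d 1) (growth-id d))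

    -- Each of the `q` steps multiplies by at most the number of marked tree codes, whence the
    -- power; the summand 2 of each step is absorbed by the 2 in the base.
    thr≤^ : ∀ q m n → n ≤ ℓ * 2 ^ m → thr q n d ≤ (2 + #trees (q + m)) ^ suc q
    thr≤^ zero m n le = ≤-trans (m≤m+n 2 (#trees m)) (≤-reflexive (sym (^-identityʳ (2 + #trees m))))
    thr≤^ (suc q) m n le = begin
      2 + n * 2 * #codes (n * 2) (thr q (n * 2)) d * thr q (n * 2) d
        ≤⟨ +-monoʳ-≤ 2 (*-mono-≤ (#trees≤ q (suc m) (n * 2) (double {m = m} le)) (thr≤^ q (suc m) (n * 2) (double {m = m} le))) ⟩
      2 + Y * X          ≤⟨ +-monoˡ-≤ (Y * X) (*-monoʳ-≤ 2 (m^n>0 (2 + Y) (suc q))) ⟩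
      2 * X + Y * X      ≡⟨ *-distribʳ-+ X 2 Y ⟨
      (2 + Y) ^ suc (suc q)          ≡⟨ cong (λ Q → (2 + #trees Q) ^ suc (suc q)) (+-suc q m) ⟩
      (2 + #trees (suc q + m)) ^ suc (suc q)  ∎
      where
      open ≤-Reasoning
      Y X : ℕ
      Y = #trees (q + suc m)
      X = (2 + Y) ^ suc q

    thr≤ : ∀ q m n → n ≤ ℓ * 2 ^ m → thr q n d ≤ counts (q + m)
    thr≤ q m n le = ≤-trans (thr≤^ q m n le) (^-monoʳ-≤ (2 + #trees (q + m)) (s≤s (m≤m+n q m)))

  codeBound : ∀ d → CodeBound d
  codeBound zero    = record { bound = λ _ → 1 ; growth = growth-const 1 1 ; codes≤ = λ _ _ _ _ → ≤-refl }
  codeBound (suc d) = record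
    { bound  = λ Q → (1 + counts Q) ^ #trees Q
    ; growth = growth-^ (suc d) (growth-suc (suc d) (growth-+ (suc d) (growth-const (suc d) 1) counts-growth)) #trees-growth
    ; codes≤ = λ q m n le → ≤-trans (^-monoˡ-≤ (n * #codes n (thr q n) d) (s≤s (thr≤ q m n le)))
                                    (^-monoʳ-≤ (1 + counts (q + m)) (#trees≤ q m n le)) }
    where open CodeBound (codeBound d)

  thr-growth : ∀ d → Growth (suc d) (λ Q → thr Q ℓ d)
  thr-growth d = growth-≤ (suc d) (λ Q → ≤-trans (thr≤ Q 0 ℓ (≤-reflexive (sym (*-identityʳ ℓ))))
    (≤-reflexive (cong counts (+-identityʳ Q)))) counts-growth
    where open CodeBound (codeBound d)

  -- Without marks the number of labels is the constant `ℓ`, so the exponent grows like the number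
  -- of codes one level below, while the threshold is confined to the base.
  codes-growth : ∀ d → Growth d (λ Q → #codes ℓ (thr Q ℓ) d)
  codes-growth zero    = growth-const 0 1
  codes-growth (suc d) = growth-^ d (growth-+ (suc d) (growth-const (suc d) 1) (thr-growth d))
                                    (growth-* d (growth-const d ℓ) (codes-growth d))

module SentenceSize (σ : Signature) (D : ℕ) where
  open Describe σ D using (ℓ)
  open SizeBounds σ D
  open CodeGrowth ℓ

  private
    c+ : ∀ d {f} c → Growth d f → Growth d (λ Q → c + f Q)
    c+ d c p = growth-+ d (growth-const d c) p

    junction-growth : ∀ d {f g} → Growth d f → Growth d g → Growth d (λ Q → junction (f Q) (g Q))
    junction-growth d p q = growth-+ d (growth-* d p (c+ d 1 q)) (growth-const d 6)

    module TS Q = TypeSize σ D (thr Q ℓ)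

  -- The threshold at `d` exceeds growth d. It enters through `atLeastF`, which is first used in the
  -- types with d + 1 levels; `rootF` and `firstF` at `d` keep growth d.
  type-growth    : ∀ d → Growth d (λ Q → TS.type-bound Q d)
  root-growth    : ∀ d → Growth d (λ Q → TS.root-bound Q d)
  first-growth   : ∀ d → Growth d (λ Q → TS.first-bound Q d)
  atLeast-growth : ∀ d → Growth (suc d) (λ Q → TS.atLeast-bound Q d)

  #trees-growth : ∀ d → Growth d (λ Q → ℓ * #codes ℓ (thr Q ℓ) d)
  #trees-growth d = growth-* d (growth-const d ℓ) (codes-growth d)

  type-growth zero    = growth-const 0 (3 + base-bound)
  type-growth (suc d) = growth-+ (suc d)
    (c+ (suc d) 1 (c+ (suc d) 3 (c+ (suc d) (1 + base-bound)
      (junction-growth (suc d) M-growth (c+ (suc d) 1 (growth-suc d (root-growth d)))))))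
    (junction-growth (suc d) M-growth (growth-+ (suc d) (c+ (suc d) 1 (atLeast-growth d))
      (growth-+ (suc d) (c+ (suc d) 1 (atLeast-growth d)) (growth-const (suc d) 5))))
    where
    M-growth : Growth (suc d) (λ Q → ℓ * #codes ℓ (thr Q ℓ) d)
    M-growth = growth-suc d (#trees-growth d)

  root-growth d = c+ d (3 + base-bound) (c+ d (1 + base-bound) (type-growth d))

  first-growth d = growth-+ d (c+ d 1 (root-growth d))
    (junction-growth d (#trees-growth d) (growth-+ d (c+ d 1 (root-growth d)) (growth-const d 5)))

  atLeast-growth d = growth-+ (suc d)
    (growth-* (suc d) (c+ (suc d) 1 (thr-growth d))
      (growth-+ (suc d) (c+ (suc d) (4 + base-bound) (growth-suc d (first-growth d)))
        (c+ (suc d) 1 (junction-growth (suc d) (c+ (suc d) 1 (thr-growth d)) (growth-const (suc d) (1 + base-bound))))))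
    (growth-const (suc d) 5)

  sentence-bound : ℕ → ℕ
  sentence-bound Q = junction (#codes ℓ (thr Q ℓ) D) (TS.type-bound Q D + 6)

  sentence-growth : Growth D sentence-bound
  sentence-growth = junction-growth D (codes-growth D) (growth-+ D (type-growth D) (growth-const D 6))

-- The translated sentence

module Translation (σ : Signature) (D : ℕ) (φ : Sentence MSO σ) where
  private
    t : ℕ → ℕ
    t = thr (qr φ) (#atoms σ D)
  open DescribeTypes σ D t

  meaning : Meaning σ D 0 0 ℓ
  meaning = ⟪ atomsOf σ D , [] , [] ⟫

  good? : (τ : Fin (#types D)) → Dec (FSat σ D φ (rep ℓ t D τ) meaning)
  good? τ = fsat? σ D φ (rep ℓ t D τ) meaning

  disjunct : Fin (#types D) → Sentence FO σ
  disjunct τ = if does (good? τ) then typeF D [] τ else ⊥ᶠ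

  translation : Sentence FO σ
  translation = ⋁ (#types D) disjunct

  size-translation : size translation ≤ SentenceSize.sentence-bound σ D (qr φ)
  size-translation = SizeBounds.size-⋁ σ D (#types D) λ τ → size-disjunct τ (does (good? τ))
    where
    open TypeSize σ D t
    size-disjunct : ∀ τ b → size (if b then typeF D [] τ else ⊥ᶠ) ≤ type-bound D + 6
    size-disjunct τ true  = ≤-trans (size-typeF D [] τ (≤-reflexive (+-identityʳ D))) (m≤m+n _ 6)
    size-disjunct τ false = m≤n+m 6 (type-bound D)

  qad-translation : qad translation ≤ 2 * D
  qad-translation = ≤-trans (Alt.pos (alt-⋁ σ D (#types D) λ τ → alt-disjunct τ (does (good? τ)))) (≤-reflexive (*-comm D 2))
    where
    alt-disjunct : ∀ τ b → Alt (D * 2) (if b then typeF D [] τ else ⊥ᶠ)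
    alt-disjunct τ true  = alt-typeF σ D t D [] τ
    alt-disjunct τ false = alt z≤n z≤n

  module _ (𝔄 : Structure σ) (td≤D : Fin[ σ , D ] 𝔄) where
    private
      low : Low (gaifman 𝔄) D ⊤ₛ
      low = treeDepth⇒low (gaifman 𝔄) (td-correct (gaifman 𝔄)) td≤D

    open Semantics D t 𝔄 low

    -- The elimination forest given by `sound` and the representative have the same code, so they
    -- agree on formulas of the rank of `φ`.
    type⇔ : ∀ τ → HasType D [] τ → 𝔄 ⊨ φ ⇔ FSat σ D φ (rep ℓ t D τ) meaning
    type⇔ τ h with f , elim , eq ← sound D t 𝔄 low D [] τ h =
      ⇔-trans (Sat⇔FSat 𝔄 (atomsOf σ D) elim φ faithful)
        (mk⇔ (FSat-code (qr φ) φ ≤-refl meaning (trans eq (sym (code-rep ℓ t D τ))))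
             (FSat-code (qr φ) φ ≤-refl meaning (trans (code-rep ℓ t D τ) (sym eq))))
      where
      faithful : Faithful 𝔄 (atomsOf σ D) elim [] [] proj₂ meaning
      faithful = record { atoms≡ = λ _ _ _ → refl ; elem⇔ = λ _ () ; set⇔ = λ _ () }

    equivalent : 𝔄 ⊨ φ ⇔ 𝔄 ⊨ translation
    equivalent = mk⇔ to from
      where
      to : 𝔄 ⊨ φ → 𝔄 ⊨ translation
      to s with τ , h ← complete D t 𝔄 low D [] low = Equivalence.from (sat-⋁ {env = []} (#types D) disjunct) (τ , disj)
        where
        disj : 𝔄 ⊨ disjunct τ
        disj with good? τ
        ... | yes _   = Equivalence.from (sat-typeF {env = []} {rs = []} refl D τ) h
        ... | no ¬good = contradiction (Equivalence.to (type⇔ τ h) s) ¬good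
      from : 𝔄 ⊨ translation → 𝔄 ⊨ φ
      from s with τ , disj ← Equivalence.to (sat-⋁ {env = []} (#types D) disjunct) s with good? τ
      ... | yes good = Equivalence.from (type⇔ τ (Equivalence.to (sat-typeF {env = []} {rs = []} refl D τ) disj)) good
      ... | no _     = contradiction refl (proj₂ disj)

theorem18 : (d : ℕ) → 1 ≤ d → (σ : Signature) →
    Σ[ f ∈ (ℕ → ℕ) ] (d -EXP) f ×
    ((φ : Sentence MSO σ) →
    Σ[ ψ ∈ Sentence FO σ ] size ψ ≤ f (qr φ) × qad ψ ≤ 2 * d ×
    ((𝔄 : Structure σ) → Fin[ σ , d ] 𝔄 → 𝔄 ⊨ φ ⇔ 𝔄 ⊨ ψ))
theorem18 d _ σ = sentence-bound , growth⇒EXP d sentence-growth , λ φ →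
  let open Translation σ d φ in translation , size-translation , qad-translation , equivalent
  where open SentenceSize σ d
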